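{- Let $d>1$ be a squarefree integer and let $m,n$ be nonzero integers with $m^2-dn^2=4$, with the sign of $m$ chosen such that $\mathrm{ord}_3(m-2)\ge\mathrm{ord}_3 n$, where $\mathrm{ord}_3$ denotes the $3$-adic order. Let $p$ be a prime with $p\nmid n$ and $p=x^2+3dy^2$, where $x,y$ are integers with $3\nmid y$ and $x\equiv y\pmod 3$. Then $$U_{\frac{p-1}{3}}(m,1)\equiv \begin{cases} 0\pmod p & \text{if } m\equiv 2\pmod{27},\\ \big(\frac{(m-2)n/3}{3}\big)\frac{x}{dny}\pmod p & \text{if } m\equiv 5,8\pmod 9,\\ -\big(\frac{(m-2)n/27}{3}\big)\frac{x}{dny}\pmod p & \text{if } m\equiv 11,20\pmod{27},\\ \big(\frac{mn/3}{3}\big)\frac{x}{dny}\pmod p & \text{if } m\equiv 0\pmod 3,\\ \big(\frac{(m+2)n/3}{3}\big)\frac{x}{dny}\pmod p & \text{if } m\equiv 1\pmod 3,\end{cases}$$ where $\big(\frac{\cdot}{3}\big)$ is the Legendre symbol (equal to $0$ on multiples of $3$).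
   Context: $\{U_k(b,c)\}_{k\ge0}$ is the Lucas sequence defined by $U_0=0$, $U_1=1$, $U_{k+1}=bU_k-cU_{k-1}$ for $k\ge1$. The denominator $dny$ is prime to $p$ and is inverted modulo $p$. -}

module Defs where

open import Data.Fin using (Fin; toℕ)
open import Data.Fin.Properties using (any?)
open import Data.Integer using (ℤ; +_; _+_; _-_; _*_; _^_; 0ℤ; 1ℤ; -1ℤ; ∣_∣)
open import Data.Integer.Divisibility.Signed using (_∣_; _∣?_)
open import Data.Nat as ℕ using (ℕ; zero; suc)
import Data.Nat.Divisibility as ℕ
import Data.Nat.Properties as ℕ
open import Data.Product using (∃-syntax; _×_; _,_)
open import Data.Sum using (inj₁; inj₂)
open import Relation.Binary.PropositionalEquality using (_≡_; _≢_; refl)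
open import Relation.Nullary using (Dec; yes; no; contradiction)
open import Relation.Unary using (Pred; Decidable)

infix 4 _≡_[mod_] _≡_÷_[mod_]

_≡_[mod_] : ℤ → ℤ → ℕ → Set
a ≡ b [mod k ] = + k ∣ (a - b)

-- c ≡ a / b, where the denominator b is required to be invertible modulo k
-- and the fraction is a times the inverse b′ of b (which is unique mod k).
_≡_÷_[mod_] : ℤ → ℤ → ℤ → ℕ → Set
c ≡ a ÷ b [mod k ] = ∃[ b′ ] (b * b′ ≡ 1ℤ [mod k ] × c ≡ a * b′ [mod k ])

Squarefree : ℤ → Set
Squarefree d = ∀ k → k * k ∣ d → ∣ k ∣ ≡ 1

-- Lucas sequence: U b c k is U_k(b,c).
U : ℤ → ℤ → ℕ → ℤ
U b c zero          = 0ℤ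
U b c (suc zero)    = 1ℤ
U b c (suc (suc k)) = b * U b c (suc k) - c * U b c k

QuadraticResidue : ℤ → ℕ → Set
QuadraticResidue a p = ∃[ i ] ((+ toℕ {p} i) ^ 2 ≡ a [mod p ])

quadraticResidue? : ∀ a p → Dec (QuadraticResidue a p)
quadraticResidue? a p = any? (λ i → + p ∣? ((+ toℕ {p} i) ^ 2 - a))

-- The Legendre symbol (a / p), for p an odd prime.
legendre : ℤ → ℕ → ℤ
legendre a p with + p ∣? a
... | yes _ = 0ℤ
... | no  _ with quadraticResidue? a p
...   | yes _ = 1ℤ
...   | no  _ = -1ℤ

-- The largest k ≤ b satisfying P, or 0 if there is none.
greatest : ∀ {ℓ} {P : Pred ℕ ℓ} → Decidable P → ℕ → ℕ
greatest P? zero = zero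
greatest P? (suc b) with P? (suc b)
... | yes _ = suc b
... | no  _ = greatest P? b

-- The p-adic order of a, for p > 1 and a ≢ 0: the largest k such that p ^ k
-- divides a. The search stops at ∣ a ∣ because k < p ^ k. The value at a = 0
-- is the meaningless 0. Correctness is proved in ord-divides and ord-greatest.
ord : ℕ → ℤ → ℕ
ord p a = greatest (λ k → (p ℕ.^ k) ℕ.∣? ∣ a ∣) ∣ a ∣

private
  greatest-sat : ∀ {ℓ} {P : Pred ℕ ℓ} (P? : Decidable P) b → P 0 → P (greatest P? b)
  greatest-sat P? zero    p₀ = p₀
  greatest-sat P? (suc b) p₀ with P? (suc b)
  ... | yes p = p
  ... | no  _ = greatest-sat P? b p₀

  greatest-max : ∀ {ℓ} {P : Pred ℕ ℓ} (P? : Decidable P) b {k} →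
                 P k → k ℕ.≤ b → k ℕ.≤ greatest P? b
  greatest-max P? zero    pk k≤b = k≤b
  greatest-max P? (suc b) pk k≤b with P? (suc b)
  ... | yes _ = k≤b
  ... | no ¬p with ℕ.m≤n⇒m<n∨m≡n k≤b
  ...   | inj₁ k<b  = greatest-max P? b pk (ℕ.≤-pred k<b)
  ...   | inj₂ refl = contradiction pk ¬p

  k<p^k : ∀ {p} → 1 ℕ.< p → ∀ k → k ℕ.< p ℕ.^ k
  k<p^k 1<p zero = ℕ.≤-refl
  k<p^k {p} 1<p (suc k) = begin-strict
    suc k             ≤⟨ k<p^k 1<p k ⟩
    p ℕ.^ k           <⟨ ℕ.^-monoʳ-< p 1<p (ℕ.n<1+n k) ⟩
    p ℕ.^ suc k       ∎
    where open ℕ.≤-Reasoning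

ord-divides : ∀ p a → (p ℕ.^ ord p a) ℕ.∣ ∣ a ∣
ord-divides p a = greatest-sat (λ k → (p ℕ.^ k) ℕ.∣? ∣ a ∣) ∣ a ∣ (ℕ.1∣ ∣ a ∣)

ord-greatest : ∀ p a → 1 ℕ.< p → a ≢ 0ℤ → ∀ k → (p ℕ.^ k) ℕ.∣ ∣ a ∣ → k ℕ.≤ ord p a
ord-greatest p (+ zero) 1<p a≢0 k div = contradiction refl a≢0
ord-greatest p a@(+ suc _) 1<p _ k div =
  greatest-max (λ k → (p ℕ.^ k) ℕ.∣? ∣ a ∣) ∣ a ∣ div
    (ℕ.≤-trans (ℕ.<⇒≤ (k<p^k 1<p k)) (ℕ.∣⇒≤ div))
ord-greatest p a@(ℤ.negsuc _) 1<p _ k div =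
  greatest-max (λ k → (p ℕ.^ k) ℕ.∣? ∣ a ∣) ∣ a ∣ div
    (ℕ.≤-trans (ℕ.<⇒≤ (k<p^k 1<p k)) (ℕ.∣⇒≤ div))

{-# OPTIONS --safe #-}
-- Put ε = (m + n √d) / 2, a unit of norm 1, so that U_k(m,1) = (ε^k - ε^(-k)) / (n √d). Modulo p the form
-- p = x² + 3 d y² gives √d = x / (y √-3), hence ε = α / (2 y √-3) with α = n x + m y √-3 in ℤ[ω]. With
-- k = (p - 1) / 3 the value of U_k is read off from the cubic residue symbol of α at p, i.e. from the i with
-- α^k ≡ ω^i conj(α)^k (mod p).
--
-- That symbol comes from cubic reciprocity between a rational prime and an element of ℤ[ω]. A Gauss sum G with
-- Jacobi sum J of norm q satisfies G³ = J (q - N) in the group ring ℤ[ω][ℤ/q], N the sum of all group elements;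
-- comparing G^l with its image under Frobenius modulo l yields (l / J)₃ = (J / l)₃. Every element of norm prime
-- to 3 is a product of a power of ω, rational integers and Jacobi sums, so (p / α)₃ makes sense. From
-- m² p = 4 x² + d N(α) it equals (2 x / m)₃² at α, and each prime l dividing 2 x m (after removing common
-- factors) divides exactly one of the two coordinates of α, so α and conj(α) agree up to sign modulo l and only
-- the symbols of ω contribute. These are determined by squares modulo 9.
--
-- This treats m ≡ 2 (mod 3). The case m ≡ 1 follows by ε ↦ -ε, the case m ≡ 0 by ε ↦ -ε².
module Submission where

-- In the group ring no root of unity of order q has to be constructed. The price is that N is not
-- zero; but the values of the character add up to 0, so G N = 0, and N drops out of G^(1+3e) = (J
-- q)^e G and of G^(2+3e) = (J q)^e J G', where G' is the Gauss sum of the squared character.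
-- Frobenius says that the coefficient of G^l at the group element l is 1 modulo l. The rational
-- constant q^e in these formulas is removed by comparison with the conjugate equation. This is why
-- a symbol modulo l always appears as the ratio of β^e to conj(β)^e: rational factors then have
-- trivial ratio, and l need not stay prime in ℤ[ω]. For m ≡ 2 (mod 3) the norm n² x² + 3 m² y² of α
-- is divisible by 3 exactly when 3 ∣ n. In that case √-3 is taken out of α, which exchanges the
-- roles of the two coordinates. The ratio does not change, because k is even and so √-3 and its
-- conjugate have the same k-th power. Hence there are two computations modulo 9.

module EisensteinIntegers where

  open import Algebra.Bundles using (CommutativeRing)
  open import Algebra.Structures using (IsCommutativeRing)
  open import Data.Integer using (ℤ; +_; _+_; _-_; _*_; -_; 0ℤ; 1ℤ)
  open import Data.Integer.Properties using (+-*-commutativeRing; *-identityˡ)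
  open import Data.Integer.Tactic.RingSolver using (solve-∀)
  open import Data.Nat using (ℕ)
  open import Data.Product using (_,_)
  open import Level using (0ℓ)
  open import Relation.Binary.PropositionalEquality

  -- Congruences of integers and arithmetic of the Eisenstein integers

  infix 4 _≡_⟨mod_⟩ _≈_⟨mod_⟩

  -- The quotient is stored and the equation is solved for `a`, so that matching on `refl`
  -- substitutes the congruence away and leaves an identity for the ring solver.
  record _≡_⟨mod_⟩ (a b : ℤ) (l : ℕ) : Set where
    constructor modulo
    field
      quotient : ℤ
      equality : a ≡ b + quotient * + l

  ≡⇒mod : ∀ {l a b} → a ≡ b → a ≡ b ⟨mod l ⟩
  ≡⇒mod {l} {b = b} refl = modulo 0ℤ (identity b (+ l))
    where
    identity : ∀ b l → b ≡ b + 0ℤ * l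
    identity = solve-∀

  mod-refl : ∀ {l a} → a ≡ a ⟨mod l ⟩
  mod-refl = ≡⇒mod refl

  mod-sym : ∀ {l a b} → a ≡ b ⟨mod l ⟩ → b ≡ a ⟨mod l ⟩
  mod-sym {l} {b = b} (modulo q refl) = modulo (- q) (identity b q (+ l))
    where
    identity : ∀ b q l → b ≡ b + q * l + (- q) * l
    identity = solve-∀

  mod-trans : ∀ {l a b c} → a ≡ b ⟨mod l ⟩ → b ≡ c ⟨mod l ⟩ → a ≡ c ⟨mod l ⟩
  mod-trans {l} {c = c} (modulo q refl) (modulo r refl) = modulo (q + r) (identity c q r (+ l))
    where
    identity : ∀ c q r l → c + r * l + q * l ≡ c + (q + r) * l
    identity = solve-∀

  mod-+ : ∀ {l a b c d} → a ≡ b ⟨mod l ⟩ → c ≡ d ⟨mod l ⟩ → a + c ≡ b + d ⟨mod l ⟩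
  mod-+ {l} {b = b} {d = d} (modulo q refl) (modulo r refl) = modulo (q + r) (identity b d q r (+ l))
    where
    identity : ∀ b d q r l → b + q * l + (d + r * l) ≡ b + d + (q + r) * l
    identity = solve-∀

  mod-* : ∀ {l a b c d} → a ≡ b ⟨mod l ⟩ → c ≡ d ⟨mod l ⟩ → a * c ≡ b * d ⟨mod l ⟩
  mod-* {l} {b = b} {d = d} (modulo q refl) (modulo r refl) =
    modulo (b * r + q * d + q * r * + l) (identity b d q r (+ l))
    where
    identity : ∀ b d q r l → (b + q * l) * (d + r * l) ≡ b * d + (b * r + q * d + q * r * l) * l
    identity = solve-∀

  mod-neg : ∀ {l a b} → a ≡ b ⟨mod l ⟩ → - a ≡ - b ⟨mod l ⟩
  mod-neg {l} {b = b} (modulo q refl) = modulo (- q) (identity b q (+ l))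
    where
    identity : ∀ b q l → - (b + q * l) ≡ - b + (- q) * l
    identity = solve-∀

  mod-*ˡ : ∀ {l a b} c → a ≡ b ⟨mod l ⟩ → c * a ≡ c * b ⟨mod l ⟩
  mod-*ˡ c = mod-* (mod-refl {a = c})

  mod-*ʳ : ∀ {l a b} c → a ≡ b ⟨mod l ⟩ → a * c ≡ b * c ⟨mod l ⟩
  mod-*ʳ c e = mod-* e (mod-refl {a = c})

  mod-+ˡ : ∀ {l a b} c → a ≡ b ⟨mod l ⟩ → c + a ≡ c + b ⟨mod l ⟩
  mod-+ˡ c = mod-+ (mod-refl {a = c})

  mod-+ʳ : ∀ {l a b} c → a ≡ b ⟨mod l ⟩ → a + c ≡ b + c ⟨mod l ⟩
  mod-+ʳ c e = mod-+ e (mod-refl {a = c})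

  mod-sub : ∀ {l a b} c → a ≡ b ⟨mod l ⟩ → c - a ≡ c - b ⟨mod l ⟩
  mod-sub c e = mod-+ˡ c (mod-neg e)

  ℤ/ : ℕ → CommutativeRing 0ℓ 0ℓ
  ℤ/ l = record
    { Carrier = ℤ ; _≈_ = _≡_⟨mod l ⟩ ; _+_ = _+_ ; _*_ = _*_ ; -_ = -_ ; 0# = 0ℤ ; 1# = 1ℤ
    ; isCommutativeRing = record
      { isRing = record
        { +-isAbelianGroup = record
          { isGroup = record
            { isMonoid = record
              { isSemigroup = record
                { isMagma = record
                  { isEquivalence = record { refl = mod-refl ; sym = mod-sym ; trans = mod-trans }
                  ; ∙-cong = mod-+ }
                ; assoc = λ a b c → ≡⇒mod (R.+-assoc a b c) }
              ; identity = (λ a → ≡⇒mod (R.+-identityˡ a)) , (λ a → ≡⇒mod (R.+-identityʳ a)) }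
            ; inverse = (λ a → ≡⇒mod (R.-‿inverseˡ a)) , (λ a → ≡⇒mod (R.-‿inverseʳ a))
            ; ⁻¹-cong = mod-neg }
          ; comm = λ a b → ≡⇒mod (R.+-comm a b) }
        ; *-cong = mod-*
        ; *-assoc = λ a b c → ≡⇒mod (R.*-assoc a b c)
        ; *-identity = (λ a → ≡⇒mod (R.*-identityˡ a)) , (λ a → ≡⇒mod (R.*-identityʳ a))
        ; distrib = (λ a b c → ≡⇒mod (R.distribˡ a b c)) , (λ a b c → ≡⇒mod (R.distribʳ a b c)) }
      ; *-comm = λ a b → ≡⇒mod (R.*-comm a b) } }
    where module R = CommutativeRing +-*-commutativeRing

  -- The Eisenstein integers ℤ[ω], where ω² = - 1 - ω.
  infix 5 _+ω_
  record 𝔼 : Set where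
    constructor _+ω_
    field
      re im : ℤ

  open 𝔼 public

  ι : ℤ → 𝔼
  ι a = a +ω 0ℤ

  ω : 𝔼
  ω = 0ℤ +ω 1ℤ

  infixl 6 _⊕_
  infixl 7 _⊗_
  infix  8 ⊖_

  _⊕_ _⊗_ : 𝔼 → 𝔼 → 𝔼
  (a +ω b) ⊕ (c +ω d) = a + c +ω b + d
  (a +ω b) ⊗ (c +ω d) = a * c - b * d +ω a * d + b * c - b * d

  ⊖_ conj : 𝔼 → 𝔼
  ⊖ (a +ω b) = - a +ω - b
  conj (a +ω b) = a - b +ω - b

  norm : 𝔼 → ℤ
  norm (a +ω b) = a * a - a * b + b * b

  record _≈_⟨mod_⟩ (α β : 𝔼) (l : ℕ) : Set where
    constructor _,ω_
    field
      re≡ : re α ≡ re β ⟨mod l ⟩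
      im≡ : im α ≡ im β ⟨mod l ⟩

  open _≈_⟨mod_⟩ public

  ≡⇒≈ : ∀ {l α β} → α ≡ β → α ≈ β ⟨mod l ⟩
  ≡⇒≈ refl = mod-refl ,ω mod-refl

  ⊕-assoc : ∀ α β γ → (α ⊕ β) ⊕ γ ≡ α ⊕ (β ⊕ γ)
  ⊕-assoc (a +ω b) (c +ω d) (e +ω f) = cong₂ _+ω_ (R.+-assoc a c e) (R.+-assoc b d f)
    where module R = CommutativeRing +-*-commutativeRing

  ⊕-comm : ∀ α β → α ⊕ β ≡ β ⊕ α
  ⊕-comm (a +ω b) (c +ω d) = cong₂ _+ω_ (R.+-comm a c) (R.+-comm b d)
    where module R = CommutativeRing +-*-commutativeRing

  ⊕-identityˡ : ∀ α → ι 0ℤ ⊕ α ≡ α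
  ⊕-identityˡ (a +ω b) = cong₂ _+ω_ (R.+-identityˡ a) (R.+-identityˡ b)
    where module R = CommutativeRing +-*-commutativeRing

  ⊕-inverseˡ : ∀ α → ⊖ α ⊕ α ≡ ι 0ℤ
  ⊕-inverseˡ (a +ω b) = cong₂ _+ω_ (R.-‿inverseˡ a) (R.-‿inverseˡ b)
    where module R = CommutativeRing +-*-commutativeRing

  ⊗-assoc : ∀ α β γ → (α ⊗ β) ⊗ γ ≡ α ⊗ (β ⊗ γ)
  ⊗-assoc (a +ω b) (c +ω d) (e +ω f) = cong₂ _+ω_ (real a b c d e f) (imag a b c d e f)
    where
    real : ∀ a b c d e f → (a * c - b * d) * e - (a * d + b * c - b * d) * f
      ≡ a * (c * e - d * f) - b * (c * f + d * e - d * f)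
    real = solve-∀
    imag : ∀ a b c d e f →
      (a * c - b * d) * f + (a * d + b * c - b * d) * e - (a * d + b * c - b * d) * f
      ≡ a * (c * f + d * e - d * f) + b * (c * e - d * f) - b * (c * f + d * e - d * f)
    imag = solve-∀

  ⊗-comm : ∀ α β → α ⊗ β ≡ β ⊗ α
  ⊗-comm (a +ω b) (c +ω d) = cong₂ _+ω_ (real a b c d) (imag a b c d)
    where
    real : ∀ a b c d → a * c - b * d ≡ c * a - d * b
    real = solve-∀
    imag : ∀ a b c d → a * d + b * c - b * d ≡ c * b + d * a - d * b
    imag = solve-∀

  ⊗-identityˡ : ∀ α → ι 1ℤ ⊗ α ≡ α
  ⊗-identityˡ (a +ω b) = cong₂ _+ω_ (real a b) (imag a b)
    where
    real : ∀ a b → 1ℤ * a - 0ℤ * b ≡ a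
    real = solve-∀
    imag : ∀ a b → 1ℤ * b + 0ℤ * a - 0ℤ * b ≡ b
    imag = solve-∀

  ⊗-distribˡ : ∀ α β γ → α ⊗ (β ⊕ γ) ≡ α ⊗ β ⊕ α ⊗ γ
  ⊗-distribˡ (a +ω b) (c +ω d) (e +ω f) = cong₂ _+ω_ (real a b c d e f) (imag a b c d e f)
    where
    real : ∀ a b c d e f → a * (c + e) - b * (d + f) ≡ a * c - b * d + (a * e - b * f)
    real = solve-∀
    imag : ∀ a b c d e f → a * (d + f) + b * (c + e) - b * (d + f)
      ≡ a * d + b * c - b * d + (a * f + b * e - b * f)
    imag = solve-∀

  module _ {_≈_ : 𝔼 → 𝔼 → Set} where

    -- The ring laws hold as equalities, so every congruence containing equality inherits them. One
    -- construction yields both ℤ[ω] and ℤ[ω]/l.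
    ringFrom :
      (∀ {α β} → α ≡ β → α ≈ β) → (∀ {α β} → α ≈ β → β ≈ α) →
      (∀ {α β γ} → α ≈ β → β ≈ γ → α ≈ γ) →
      (∀ {α β γ δ} → α ≈ β → γ ≈ δ → (α ⊕ γ) ≈ (β ⊕ δ)) →
      (∀ {α β γ δ} → α ≈ β → γ ≈ δ → (α ⊗ γ) ≈ (β ⊗ δ)) →
      (∀ {α β} → α ≈ β → (⊖ α) ≈ (⊖ β)) → IsCommutativeRing _≈_ _⊕_ _⊗_ ⊖_ (ι 0ℤ) (ι 1ℤ)
    ringFrom reflex symm transit ⊕-cong ⊗-cong ⊖-cong = record
      { isRing = record
        { +-isAbelianGroup = record
          { isGroup = record
            { isMonoid = record
              { isSemigroup = record
                { isMagma = record
                  { isEquivalence = record { refl = reflex refl ; sym = symm ; trans = transit }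
                  ; ∙-cong = ⊕-cong }
                ; assoc = λ α β γ → reflex (⊕-assoc α β γ) }
              ; identity = (λ α → reflex (⊕-identityˡ α))
                         , (λ α → reflex (trans (⊕-comm α _) (⊕-identityˡ α))) }
            ; inverse = (λ α → reflex (⊕-inverseˡ α))
                      , (λ α → reflex (trans (⊕-comm α _) (⊕-inverseˡ α)))
            ; ⁻¹-cong = ⊖-cong }
          ; comm = λ α β → reflex (⊕-comm α β) }
        ; *-cong = ⊗-cong
        ; *-assoc = λ α β γ → reflex (⊗-assoc α β γ)
        ; *-identity = (λ α → reflex (⊗-identityˡ α))
                     , (λ α → reflex (trans (⊗-comm α _) (⊗-identityˡ α)))
        ; distrib = (λ α β γ → reflex (⊗-distribˡ α β γ))
                  , (λ α β γ → reflex (trans (⊗-comm _ α)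
                      (trans (⊗-distribˡ α β γ) (cong₂ _⊕_ (⊗-comm α β) (⊗-comm α γ))))) }
      ; *-comm = λ α β → reflex (⊗-comm α β) }

  𝔼-ring : CommutativeRing 0ℓ 0ℓ
  𝔼-ring = record { isCommutativeRing = ringFrom {_≡_} (λ e → e) sym trans (cong₂ _⊕_) (cong₂ _⊗_) (cong ⊖_) }

  𝔼/ : ℕ → CommutativeRing 0ℓ 0ℓ
  𝔼/ l = record { isCommutativeRing = ringFrom {_≈_⟨mod l ⟩} ≡⇒≈
    (λ (r ,ω i) → mod-sym r ,ω mod-sym i)
    (λ (r ,ω i) (r′ ,ω i′) → mod-trans r r′ ,ω mod-trans i i′)
    (λ (r ,ω i) (r′ ,ω i′) → mod-+ r r′ ,ω mod-+ i i′)
    (λ (r ,ω i) (r′ ,ω i′) → mod-+ (mod-* r r′) (mod-neg (mod-* i i′))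
      ,ω mod-+ (mod-+ (mod-* r i′) (mod-* i r′)) (mod-neg (mod-* i i′)))
    (λ (r ,ω i) → mod-neg r ,ω mod-neg i) }

  conj-⊗ : ∀ α β → conj (α ⊗ β) ≡ conj α ⊗ conj β
  conj-⊗ (a +ω b) (c +ω d) = cong₂ _+ω_ (real a b c d) (imag a b c d)
    where
    real : ∀ a b c d → a * c - b * d - (a * d + b * c - b * d) ≡ (a - b) * (c - d) - (- b) * (- d)
    real = solve-∀
    imag : ∀ a b c d → - (a * d + b * c - b * d) ≡ (a - b) * (- d) + (- b) * (c - d) - (- b) * (- d)
    imag = solve-∀

  conj-⊕ : ∀ α β → conj (α ⊕ β) ≡ conj α ⊕ conj β
  conj-⊕ (a +ω b) (c +ω d) = cong₂ _+ω_ (real a b c d) (imag b d)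
    where
    real : ∀ a b c d → a + c - (b + d) ≡ a - b + (c - d)
    real = solve-∀
    imag : ∀ b d → - (b + d) ≡ - b + - d
    imag = solve-∀

  conj-cong : ∀ {l α β} → α ≈ β ⟨mod l ⟩ → conj α ≈ conj β ⟨mod l ⟩
  conj-cong (r ,ω i) = mod-+ r (mod-neg i) ,ω mod-neg i

  conj-involutive : ∀ α → conj (conj α) ≡ α
  conj-involutive (a +ω b) = cong₂ _+ω_ (real a b) (imag b)
    where
    real : ∀ a b → a - b - - b ≡ a
    real = solve-∀
    imag : ∀ b → - - b ≡ b
    imag = solve-∀

  ⊗-conj : ∀ α → α ⊗ conj α ≡ ι (norm α)
  ⊗-conj (a +ω b) = cong₂ _+ω_ (real a b) (imag a b)
    where
    real : ∀ a b → a * (a - b) - b * (- b) ≡ a * a - a * b + b * b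
    real = solve-∀
    imag : ∀ a b → a * (- b) + b * (a - b) - b * (- b) ≡ 0ℤ
    imag = solve-∀

  norm-⊗ : ∀ α β → norm (α ⊗ β) ≡ norm α * norm β
  norm-⊗ (a +ω b) (c +ω d) = identity a b c d
    where
    identity : ∀ a b c d →
      (a * c - b * d) * (a * c - b * d) - (a * c - b * d) * (a * d + b * c - b * d)
        + (a * d + b * c - b * d) * (a * d + b * c - b * d)
      ≡ (a * a - a * b + b * b) * (c * c - c * d + d * d)
    identity = solve-∀

  ι-* : ∀ a b → ι (a * b) ≡ ι a ⊗ ι b
  ι-* a b = cong₂ _+ω_ (real a b) (imag a b)
    where
    real : ∀ a b → a * b ≡ a * b - 0ℤ * 0ℤ
    real = solve-∀
    imag : ∀ a b → 0ℤ ≡ a * 0ℤ + 0ℤ * b - 0ℤ * 0ℤ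
    imag = solve-∀

  ι-⊗ : ∀ r a b → ι r ⊗ (a +ω b) ≡ (r * a +ω r * b)
  ι-⊗ r a b = cong₂ _+ω_ (real r a b) (imag r a b)
    where
    real : ∀ r a b → r * a - 0ℤ * b ≡ r * a
    real = solve-∀
    imag : ∀ r a b → r * b + 0ℤ * a - 0ℤ * b ≡ r * b
    imag = solve-∀

  ι-cong : ∀ {l a b} → a ≡ b ⟨mod l ⟩ → ι a ≈ ι b ⟨mod l ⟩
  ι-cong e = e ,ω mod-refl

-- Binomial coefficients and the Frobenius map in characteristic l

module FrobeniusMap where

  open import Algebra.Bundles using (CommutativeRing; CommutativeMonoid)
  open import Data.Fin as Fin using (Fin; fromℕ; inject₁)
  import Data.Fin.Properties as Fin
  open import Data.Nat
  open import Data.Nat.Combinatorics using (_C_; nCn≡1; nCk≡nC[n∸k]; nCk+nC[k+1]≡[n+1]C[k+1]; k>n⇒nCk≡0)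
  open import Data.Nat.Divisibility using (_∣_; divides; >⇒∤)
  open import Data.Nat.Primality using (Prime; euclidsLemma)
  open import Data.Nat.Properties using (*-zeroʳ; *-identityˡ; *-distribˡ-+; *-comm; n∸n≡0)
  open import Data.Nat.Tactic.RingSolver using (solve-∀)
  open import Data.Sum using (inj₁; inj₂)
  open import Level using (0ℓ)
  open import Relation.Binary.PropositionalEquality using (_≡_; _≢_; cong; cong₂; subst; module ≡-Reasoning)
  import Relation.Binary.PropositionalEquality as ≡
  open import Relation.Nullary using (contradiction)

  nC0≡1 : ∀ n → n C 0 ≡ 1
  nC0≡1 n = ≡.trans (nCk≡nC[n∸k] {0} {n} z≤n) (nCn≡1 n)

  -- Prepared for `prime∣C`: it exhibits l as a factor of k · C(l,k), from which Euclid's lemma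
  -- removes k. Pascal's rule carries the induction, so factorials are avoided.
  absorption : ∀ n k → suc k * (suc n C suc k) ≡ suc n * (n C k)
  absorption zero zero = ≡.refl
  absorption zero (suc k) = begin
    suc (suc k) * (1 C suc (suc k))   ≡⟨ cong (suc (suc k) *_) (k>n⇒nCk≡0 {1} {suc (suc k)} (s≤s (s≤s z≤n))) ⟩
    suc (suc k) * 0                   ≡⟨ *-zeroʳ (suc (suc k)) ⟩
    0                                 ≡⟨ cong (1 *_) (k>n⇒nCk≡0 {0} {suc k} (s≤s z≤n)) ⟨
    1 * (0 C suc k)                   ∎
    where open ≡-Reasoning
  absorption (suc n) zero = begin
    1 * (suc (suc n) C 1)             ≡⟨ cong (1 *_) (nCk+nC[k+1]≡[n+1]C[k+1] (suc n) 0) ⟨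
    1 * (suc n C 0 + suc n C 1)       ≡⟨ *-distribˡ-+ 1 (suc n C 0) (suc n C 1) ⟩
    1 * (suc n C 0) + 1 * (suc n C 1) ≡⟨ cong₂ _+_ (≡.trans (*-identityˡ _) (nC0≡1 (suc n))) (absorption n 0) ⟩
    1 + suc n * (n C 0)               ≡⟨ cong (λ c → 1 + suc n * c) (nC0≡1 n) ⟩
    1 + suc n * 1                     ≡⟨ arith n ⟩
    suc (suc n) * 1                   ≡⟨ cong (suc (suc n) *_) (nC0≡1 (suc n)) ⟨
    suc (suc n) * (suc n C 0)         ∎
    where
    open ≡-Reasoning
    arith : ∀ n → 1 + suc n * 1 ≡ suc (suc n) * 1
    arith = solve-∀
  absorption (suc n) (suc k) = begin
    suc (suc k) * (suc (suc n) C suc (suc k))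
      ≡⟨ cong (suc (suc k) *_) (nCk+nC[k+1]≡[n+1]C[k+1] (suc n) (suc k)) ⟨
    suc (suc k) * (suc n C suc k + suc n C suc (suc k))
      ≡⟨ arith k (suc n C suc k) (suc n C suc (suc k)) ⟩
    suc n C suc k + (suc k * (suc n C suc k) + suc (suc k) * (suc n C suc (suc k)))
      ≡⟨ cong₂ (λ a b → suc n C suc k + (a + b)) (absorption n k) (absorption n (suc k)) ⟩
    suc n C suc k + (suc n * (n C k) + suc n * (n C suc k))
      ≡⟨ cong (suc n C suc k +_) (*-distribˡ-+ (suc n) (n C k) (n C suc k)) ⟨
    suc n C suc k + suc n * (n C k + n C suc k)
      ≡⟨ cong (λ c → suc n C suc k + suc n * c) (nCk+nC[k+1]≡[n+1]C[k+1] n k) ⟩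
    suc (suc n) * (suc n C suc k) ∎
    where
    open ≡-Reasoning
    arith : ∀ k a b → suc (suc k) * (a + b) ≡ a + (suc k * a + suc (suc k) * b)
    arith = solve-∀

  prime∣C : ∀ {l} → Prime l → ∀ {k} → 0 < k → k < l → l ∣ l C k
  prime∣C {suc n} l-prime {suc k} _ k<l
    with euclidsLemma (suc k) (suc n C suc k) l-prime
           (divides (n C k) (≡.trans (absorption n k) (*-comm (suc n) (n C k))))
  ... | inj₁ l∣k = contradiction l∣k (>⇒∤ k<l)
  ... | inj₂ l∣C = l∣C

  module Frobenius (R : CommutativeRing 0ℓ 0ℓ) where
    open CommutativeRing R using (Carrier; _≈_; 0#; setoid; commutativeSemiring; semiring; +-congˡ; +-cong;
      +-identityˡ; +-identityʳ; +-comm)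
      renaming (_+_ to _⊹_; _*_ to _·_; *-identityˡ to ·-identityˡ; *-identityʳ to ·-identityʳ)
    open CommutativeRing R using (refl; sym; trans)
    open import Algebra.Properties.Semiring.Sum semiring
    open import Algebra.Properties.Semiring.Mult semiring
    open import Algebra.Properties.CommutativeSemiring.Exp commutativeSemiring using ()
      renaming (_^_ to _↑_)
    open import Algebra.Properties.CommutativeSemiring.Binomial commutativeSemiring
    open import Relation.Binary.Reasoning.Setoid setoid

    ×-multiple : ∀ {l m} → l ∣ m → (∀ x → l × x ≈ 0#) → ∀ x → m × x ≈ 0#
    ×-multiple {l} (divides c ≡.refl) l≈0 x = begin
      (c * l) × x  ≈⟨ ×-assocˡ x c l ⟨
      c × (l × x)  ≈⟨ ×-congʳ c (l≈0 x) ⟩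
      c × 0#       ≈⟨ ×-zero c ⟩
      0#           ∎
      where
      ×-zero : ∀ c → c × 0# ≈ 0#
      ×-zero zero    = refl
      ×-zero (suc c) = trans (+-identityˡ _) (×-zero c)

    -- Between the two ends every binomial coefficient is a multiple of l, which annihilates the
    -- ring. The lemma is applied to ℤ/p, to ℤ[ω]/p and to the group ring over ℤ[ω]/l.
    frobenius : ∀ {l} → Prime l → (∀ x → l × x ≈ 0#) → ∀ x y → (x ⊹ y) ↑ l ≈ x ↑ l ⊹ y ↑ l
    frobenius {suc n} l-prime l≈0 x y = begin
      (x ⊹ y) ↑ suc n             ≈⟨ theorem (suc n) x y ⟩
      t Fin.zero ⊹ sum (λ i → t (Fin.suc i))
        ≈⟨ +-congˡ (sum-init-last (λ i → t (Fin.suc i))) ⟩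
      t Fin.zero ⊹ (sum (λ i → t (Fin.suc (inject₁ i))) ⊹ t (Fin.suc (fromℕ n)))
        ≈⟨ +-cong first (+-cong (trans (sum-cong-≋ {n} middle) (sum-replicate-zero n)) last) ⟩
      y ↑ suc n ⊹ (0# ⊹ x ↑ suc n)  ≈⟨ +-congˡ (+-identityˡ _) ⟩
      y ↑ suc n ⊹ x ↑ suc n         ≈⟨ +-comm _ _ ⟩
      x ↑ suc n ⊹ y ↑ suc n         ∎
      where
      t : Fin (suc (suc n)) → Carrier
      t = binomialTerm x y (suc n)
      first : t Fin.zero ≈ y ↑ suc n
      first rewrite nC0≡1 (suc n) = trans (+-identityʳ _) (·-identityˡ _)
      last : t (Fin.suc (fromℕ n)) ≈ x ↑ suc n
      last rewrite Fin.toℕ-fromℕ n | nCn≡1 (suc n) | n∸n≡0 n = trans (+-identityʳ _) (·-identityʳ _)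
      middle : ∀ i → t (Fin.suc (inject₁ i)) ≈ 0#
      middle i = ×-multiple
        (prime∣C l-prime (s≤s z≤n)
          (s≤s (subst (_< n) (≡.sym (Fin.toℕ-inject₁ i)) (Fin.toℕ<n i)))) l≈0 _

    frobenius-sum : ∀ {l} → Prime l → (∀ x → l × x ≈ 0#) → ∀ {n} (f : Fin n → Carrier) →
      sum f ↑ l ≈ sum (λ i → f i ↑ l)
    frobenius-sum {suc l} l-prime l≈0 {zero} f = CommutativeRing.zeroˡ R _
    frobenius-sum l-prime l≈0 {suc n} f = trans (frobenius l-prime l≈0 _ _)
      (+-congˡ (frobenius-sum l-prime l≈0 (λ i → f (Fin.suc i))))

  module _ (M : CommutativeMonoid 0ℓ 0ℓ) where
    open CommutativeMonoid M renaming (Carrier to A; _∙_ to _⊹_; ε to 0#)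
    open import Algebra.Properties.CommutativeMonoid.Sum M

    sum-zero : ∀ {n} (f : Fin n → A) → (∀ i → f i ≈ 0#) → sum f ≈ 0#
    sum-zero {n} f f≈0 = trans (sum-cong-≋ {n} f≈0) (sum-replicate-zero n)

    sum-single : ∀ {n} (f : Fin n → A) i → (∀ j → j ≢ i → f j ≈ 0#) → sum f ≈ f i
    sum-single f Fin.zero off =
      trans (∙-congˡ (sum-zero (λ j → f (Fin.suc j)) (λ j → off (Fin.suc j) λ ()))) (identityʳ _)
    sum-single f (Fin.suc i) off =
      trans (∙-cong (off Fin.zero λ ()) (sum-single (λ j → f (Fin.suc j)) i
        (λ j j≢i → off (Fin.suc j) λ { ≡.refl → j≢i ≡.refl }))) (identityˡ _)

-- Sums over the residues modulo q and the group ring of ℤ/q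

module GroupRings where

  open import Algebra.Bundles using (CommutativeRing)
  open import Data.Fin as Fin using (Fin; toℕ; fromℕ<)
  open import Data.Fin.Permutation using (Permutation′; permutation)
  import Data.Fin.Properties as Fin
  open import Data.Integer using (ℤ; +_; _+_; _-_; _*_; -_; 0ℤ; 1ℤ)
  open import Data.Integer.DivMod using (_/ℕ_; n%ℕd<d; a≡a%ℕn+[a/ℕn]*n)
  import Data.Integer.Properties as ℤ
  open import Data.Integer.Tactic.RingSolver using (solve-∀)
  open import Data.Nat as ℕ using (ℕ; zero; suc; NonZero; _<_)
  import Data.Nat.Divisibility as ℕ
  import Data.Nat.Properties as ℕ
  open import Data.Nat.Primality using (Prime)
  open import Data.Product using (_,_)
  open import Data.Sum using (inj₁; inj₂)
  open import Level using (0ℓ)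
  open import Relation.Binary.PropositionalEquality using (_≡_; cong; subst; module ≡-Reasoning)
  import Relation.Binary.PropositionalEquality as ≡
  open import Relation.Nullary using (Dec; yes; no; contradiction; ¬_)
  open EisensteinIntegers
  open FrobeniusMap

  mod⇒∣ : ∀ {l a b} → + a ≡ + b ⟨mod l ⟩ → a ℕ.≤ b → l ℕ.∣ b ℕ.∸ a
  mod⇒∣ {l} {a} {b} (modulo q e) a≤b = ∣-of (- q) (begin
    + (b ℕ.∸ a)          ≡⟨ ℤ.⊖-≥ a≤b ⟨
    b Data.Integer.⊖ a   ≡⟨ ℤ.m-n≡m⊖n b a ⟨
    + b - + a            ≡⟨ cong (λ z → + b - z) e ⟩
    + b - (+ b + q * + l) ≡⟨ identity (+ b) q (+ l) ⟩
    (- q) * + l          ∎)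
    where
    open ≡-Reasoning
    identity : ∀ b q l → b - (b + q * l) ≡ (- q) * l
    identity = solve-∀
    ∣-of : ∀ {n} z → + n ≡ z * + l → l ℕ.∣ n
    ∣-of z e′ = ℕ.divides Data.Integer.∣ z ∣ (≡.trans (cong Data.Integer.∣_∣ e′) (ℤ.abs-* z (+ l)))

  residue-unique-≤ : ∀ {l a b} → a ℕ.≤ b → b < l → + a ≡ + b ⟨mod l ⟩ → a ≡ b
  residue-unique-≤ {l} {a} {b} a≤b b<l e with b ℕ.∸ a in eq | mod⇒∣ e a≤b
  ... | zero  | _ = ℕ.≤-antisym a≤b (ℕ.m∸n≡0⇒m≤n eq)
  ... | suc k | d = contradiction d
    (ℕ.>⇒∤ (ℕ.≤-<-trans (ℕ.≤-trans (ℕ.≤-reflexive (≡.sym eq)) (ℕ.m∸n≤m b a)) b<l))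

  residue-unique : ∀ {l a b} → a < l → b < l → + a ≡ + b ⟨mod l ⟩ → a ≡ b
  residue-unique {l} {a} {b} a<l b<l e with ℕ.≤-total a b
  ... | inj₁ a≤b = residue-unique-≤ a≤b b<l e
  ... | inj₂ b≤a = ≡.sym (residue-unique-≤ b≤a a<l (mod-sym e))

  module Residue (q : ℕ) .{{_ : NonZero q}} where

    residue : ℤ → Fin q
    residue a = fromℕ< (n%ℕd<d a q)

    rep : Fin q → ℤ
    rep i = + toℕ i

    rep-residue : ∀ a → rep (residue a) ≡ a ⟨mod q ⟩
    rep-residue a rewrite Fin.toℕ-fromℕ< (n%ℕd<d a q) =
      mod-sym (modulo (a /ℕ q) (a≡a%ℕn+[a/ℕn]*n a q))

    rep-injective : ∀ {i j} → rep i ≡ rep j ⟨mod q ⟩ → i ≡ j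
    rep-injective e = Fin.toℕ-injective (residue-unique (Fin.toℕ<n _) (Fin.toℕ<n _) e)

    mod? : ∀ a b → Dec (a ≡ b ⟨mod q ⟩)
    mod? a b with residue a Fin.≟ residue b
    ... | yes e = yes (mod-trans (mod-sym (rep-residue a))
                    (subst (λ i → rep i ≡ b ⟨mod q ⟩) (≡.sym e) (rep-residue b)))
    ... | no ¬e = no λ a≡b → ¬e (rep-injective
                    (mod-trans (rep-residue a) (mod-trans a≡b (mod-sym (rep-residue b)))))

    -- Substitutions such as t ↦ n - t are written on integers, where they need not preserve the
    -- range of representatives; reducing the results turns a pair of maps inverse modulo q into a
    -- permutation of `Fin q`.
    reindexing : (g h : ℤ → ℤ) →
      (∀ {a b} → a ≡ b ⟨mod q ⟩ → g a ≡ g b ⟨mod q ⟩) →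
      (∀ {a b} → a ≡ b ⟨mod q ⟩ → h a ≡ h b ⟨mod q ⟩) →
      (∀ a → g (h a) ≡ a ⟨mod q ⟩) → (∀ a → h (g a) ≡ a ⟨mod q ⟩) → Permutation′ q
    reindexing g h g-cong h-cong gh hg = permutation
      (λ i → residue (g (rep i))) (λ i → residue (h (rep i))) 
      (λ i → rep-injective (mod-trans (rep-residue _)
               (mod-trans (g-cong (rep-residue _)) (gh (rep i)))))
      (λ i → rep-injective (mod-trans (rep-residue _)
               (mod-trans (h-cong (rep-residue _)) (hg (rep i)))))

  module GroupRing (A : CommutativeRing 0ℓ 0ℓ) (q : ℕ) .{{_ : NonZero q}} where
    open Residue q
    open CommutativeRing A hiding (_-_)
      renaming (_+_ to _⊹_; _*_ to _·_; -_ to neg; +-cong to ⊹-cong; +-assoc to ⊹-assoc; +-comm to ⊹-comm;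
        *-cong to ·-cong; *-congˡ to ·-congˡ; *-congʳ to ·-congʳ; *-comm to ·-comm; *-assoc to ·-assoc;
        *-identityˡ to ·-identityˡ; *-identityʳ to ·-identityʳ; zeroˡ to ·-zeroˡ; zeroʳ to ·-zeroʳ)
    open import Algebra.Properties.CommutativeMonoid.Sum +-commutativeMonoid public
    open import Algebra.Properties.Semiring.Sum semiring public using (*-distribˡ-sum; *-distribʳ-sum)
    open import Algebra.Properties.Semiring.Mult semiring using () renaming (_×_ to _××_)
    open import Algebra.Properties.CommutativeSemiring.Exp commutativeSemiring using () renaming (_^_ to _↑_)
    open import Relation.Binary.Reasoning.Setoid setoid

    Periodic : (ℤ → Carrier) → Set
    Periodic f = ∀ {a b} → a ≡ b ⟨mod q ⟩ → f a ≈ f b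

    opaque
      -- Residue classes are handled as integers and functions on ℤ/q as periodic functions on ℤ;
      -- the sum itself runs over 0, ..., q - 1. It is sealed so that it is manipulated through the
      -- substitution rules alone.
      ∑ : (ℤ → Carrier) → Carrier
      ∑ f = sum {q} (λ i → f (rep i))

      ∑-cong : ∀ {f g} → (∀ t → f t ≈ g t) → ∑ f ≈ ∑ g
      ∑-cong f≈g = sum-cong-≋ {q} (λ i → f≈g (rep i))

      ∑-+ : ∀ f g → ∑ (λ t → f t ⊹ g t) ≈ ∑ f ⊹ ∑ g
      ∑-+ f g = ∑-distrib-+ {q} (λ i → f (rep i)) (λ i → g (rep i))

      ∑-*ˡ : ∀ c f → ∑ (λ t → c · f t) ≈ c · ∑ f
      ∑-*ˡ c f = sym (*-distribˡ-sum {q} c (λ i → f (rep i)))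

      ∑-*ʳ : ∀ c f → ∑ (λ t → f t · c) ≈ ∑ f · c
      ∑-*ʳ c f = sym (*-distribʳ-sum {q} c (λ i → f (rep i)))

      ∑-swap : ∀ (f : ℤ → ℤ → Carrier) → ∑ (λ s → ∑ (f s)) ≈ ∑ (λ t → ∑ (λ s → f s t))
      ∑-swap f = ∑-comm {q} {q} (λ i j → f (rep i) (rep j))

      ∑-reindex : ∀ {f} → Periodic f → (g h : ℤ → ℤ) →
        (∀ {a b} → a ≡ b ⟨mod q ⟩ → g a ≡ g b ⟨mod q ⟩) →
        (∀ {a b} → a ≡ b ⟨mod q ⟩ → h a ≡ h b ⟨mod q ⟩) →
        (∀ a → g (h a) ≡ a ⟨mod q ⟩) → (∀ a → h (g a) ≡ a ⟨mod q ⟩) →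
        ∑ f ≈ ∑ (λ t → f (g t))
      ∑-reindex {f} f-per g h g-cong h-cong gh hg = trans
        (∑-permute (λ i → f (rep i)) (reindexing g h g-cong h-cong gh hg))
        (sum-cong-≋ {q} (λ i → f-per (rep-residue (g (rep i)))))

      ∑-single : ∀ {f} → Periodic f → ∀ s → (∀ t → ¬ (t ≡ s ⟨mod q ⟩) → f t ≈ 0#) → ∑ f ≈ f s
      ∑-single {f} f-per s off = trans
        (sum-single +-commutativeMonoid (λ i → f (rep i)) (residue s)
          (λ j j≢ → off (rep j) (λ e → j≢ (rep-injective (mod-trans e (mod-sym (rep-residue s)))))))
        (f-per (rep-residue s))

    ∑-reflect : ∀ {f} → Periodic f → ∀ n → ∑ f ≈ ∑ (λ t → f (n - t))
    ∑-reflect f-per n = ∑-reindex f-per (λ t → n - t) (λ t → n - t) sub-cong sub-cong cancel cancel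
      where
      sub-cong : ∀ {a b} → a ≡ b ⟨mod q ⟩ → n - a ≡ n - b ⟨mod q ⟩
      sub-cong = mod-sub n
      identity : ∀ n a → n - (n - a) ≡ a
      identity = solve-∀
      cancel : ∀ a → n - (n - a) ≡ a ⟨mod q ⟩
      cancel a = ≡⇒mod (identity n a)

    ∑-shift : ∀ {f} → Periodic f → ∀ n → ∑ f ≈ ∑ (λ t → f (t - n))
    ∑-shift f-per n = ∑-reindex f-per (λ t → t - n) (λ t → t + n)
      (mod-+ʳ (- n)) (mod-+ʳ n)
      (λ a → ≡⇒mod (identity₁ n a)) (λ a → ≡⇒mod (identity₂ n a))
      where
      identity₁ : ∀ n a → a + n - n ≡ a
      identity₁ = solve-∀
      identity₂ : ∀ n a → a - n + n ≡ a
      identity₂ = solve-∀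

    ∑-scale : ∀ {f} → Periodic f → ∀ u v → u * v ≡ 1ℤ ⟨mod q ⟩ → ∑ f ≈ ∑ (λ t → f (u * t))
    ∑-scale f-per u v uv≡1 = ∑-reindex f-per (u *_) (v *_)
      (mod-*ˡ u) (mod-*ˡ v)
      (λ a → cancel (identity₁ u v a)) (λ a → cancel (identity₂ u v a))
      where
      identity₁ : ∀ u v a → u * (v * a) ≡ (u * v) * a
      identity₁ = solve-∀
      identity₂ : ∀ u v a → v * (u * a) ≡ (u * v) * a
      identity₂ = solve-∀
      cancel : ∀ {a b} → a ≡ u * v * b → a ≡ b ⟨mod q ⟩
      cancel {b = b} e = mod-trans (≡⇒mod e) (mod-trans (mod-*ʳ b uv≡1) (≡⇒mod (ℤ.*-identityˡ b)))

    -- The group ring A[ℤ/q]: the coefficient functions are q-periodic functions on ℤ.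
    record Element : Set where
      constructor element
      field
        coeff : ℤ → Carrier
        periodic : Periodic coeff
    open Element public

    infix 4 _≋_
    record _≋_ (f g : Element) : Set where
      constructor pointwise
      field at : ∀ t → coeff f t ≈ coeff g t
    open _≋_ public

    infixl 7 _∗_
    _∗_ : Element → Element → Element
    f ∗ g = element (λ n → ∑ (λ t → coeff f t · coeff g (n - t)))
      (λ e → ∑-cong (λ t → ·-congˡ (periodic g (mod-+ʳ (- t) e))))

    private
      product-periodic : ∀ f g n → Periodic (λ t → coeff f t · coeff g (n - t))
      product-periodic f g n e = ·-cong (periodic f e) (periodic g (mod-sub n e))

    opaque
      indicator : ℤ → ℤ → Carrier
      indicator s t with mod? t s
      ... | yes _ = 1#
      ... | no _  = 0#

      indicator-on : ∀ {s t} → t ≡ s ⟨mod q ⟩ → indicator s t ≈ 1#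
      indicator-on {s} {t} e with mod? t s
      ... | yes _ = refl
      ... | no ¬e = contradiction e ¬e

      indicator-off : ∀ {s t} → ¬ (t ≡ s ⟨mod q ⟩) → indicator s t ≈ 0#
      indicator-off {s} {t} ¬e with mod? t s
      ... | yes e = contradiction e ¬e
      ... | no _  = refl

    indicator-cong : ∀ {s t s′ t′} →
      (t ≡ s ⟨mod q ⟩ → t′ ≡ s′ ⟨mod q ⟩) → (t′ ≡ s′ ⟨mod q ⟩ → t ≡ s ⟨mod q ⟩) →
      indicator s t ≈ indicator s′ t′
    indicator-cong {s} {t} {s′} {t′} to from with mod? t s | mod? t′ s′
    ... | yes e | yes e′ = trans (indicator-on e) (sym (indicator-on e′))
    ... | no ¬e | no ¬e′ = trans (indicator-off ¬e) (sym (indicator-off ¬e′))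
    ... | yes e | no ¬e′ = contradiction (to e) ¬e′
    ... | no ¬e | yes e′ = contradiction (from e′) ¬e

    -- The group element s as an element of the group ring; `δ 0ℤ` is the unit.
    δ : ℤ → Element
    δ s = element (indicator s) (λ e → indicator-cong (mod-trans (mod-sym e)) (mod-trans e))

    δ-∗ : ∀ s f n → coeff (δ s ∗ f) n ≈ coeff f (n - s)
    δ-∗ s f n = begin
      ∑ (λ t → indicator s t · coeff f (n - t))
        ≈⟨ ∑-single (product-periodic (δ s) f n) s (λ t ¬e → trans (·-congʳ (indicator-off ¬e)) (·-zeroˡ _)) ⟩
      indicator s s · coeff f (n - s)
        ≈⟨ trans (·-congʳ (indicator-on mod-refl)) (·-identityˡ _) ⟩
      coeff f (n - s) ∎

    ∗-cong : ∀ {f f′ g g′} → f ≋ f′ → g ≋ g′ → f ∗ g ≋ f′ ∗ g′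
    ∗-cong e e′ = pointwise λ n → ∑-cong (λ t → ·-cong (at e t) (at e′ (n - t)))

    ∗-comm : ∀ f g → f ∗ g ≋ g ∗ f
    ∗-comm f g = pointwise λ n → begin
      ∑ (λ t → coeff f t · coeff g (n - t))              ≈⟨ ∑-reflect (product-periodic f g n) n ⟩
      ∑ (λ t → coeff f (n - t) · coeff g (n - (n - t)))
        ≈⟨ ∑-cong (λ t → trans (·-comm _ _) (·-congʳ (periodic g (≡⇒mod (identity n t))))) ⟩
      ∑ (λ t → coeff g t · coeff f (n - t))              ∎
      where
      identity : ∀ n a → n - (n - a) ≡ a
      identity = solve-∀

    ∗-assoc : ∀ f g h → (f ∗ g) ∗ h ≋ f ∗ (g ∗ h)
    ∗-assoc f g h = pointwise λ n → begin
      ∑ (λ s → ∑ (λ t → coeff f t · coeff g (s - t)) · coeff h (n - s))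
        ≈⟨ ∑-cong (λ s → sym (∑-*ʳ _ _)) ⟩
      ∑ (λ s → ∑ (λ t → (coeff f t · coeff g (s - t)) · coeff h (n - s)))
        ≈⟨ ∑-swap _ ⟩
      ∑ (λ t → ∑ (λ s → (coeff f t · coeff g (s - t)) · coeff h (n - s)))
        ≈⟨ ∑-cong (λ t → trans (∑-cong (λ s → trans (·-assoc _ _ _)
             (·-congˡ (·-congˡ (periodic h (≡⇒mod (identity n s t))))))) (∑-*ˡ _ _)) ⟩
      ∑ (λ t → coeff f t · ∑ (λ s → coeff g (s - t) · coeff h (n - t - (s - t))))
        ≈⟨ ∑-cong (λ t → ·-congˡ (sym (∑-shift (product-periodic g h (n - t)) t))) ⟩
      ∑ (λ t → coeff f t · ∑ (λ s → coeff g s · coeff h (n - t - s))) ∎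
      where
      identity : ∀ n s t → n - s ≡ n - t - (s - t)
      identity = solve-∀

    infixl 6 _⊞_
    _⊞_ : Element → Element → Element
    f ⊞ g = element (λ t → coeff f t ⊹ coeff g t) (λ e → ⊹-cong (periodic f e) (periodic g e))

    ⊟_ : Element → Element
    ⊟ f = element (λ t → neg (coeff f t)) (λ e → -‿cong (periodic f e))

    𝟘 : Element
    𝟘 = element (λ _ → 0#) (λ _ → refl)

    ∗-distribˡ : ∀ f g h → f ∗ (g ⊞ h) ≋ f ∗ g ⊞ f ∗ h
    ∗-distribˡ f g h = pointwise λ n → trans (∑-cong (λ t → distribˡ _ _ _)) (∑-+ _ _)

    δ0-identity : ∀ f → δ 0ℤ ∗ f ≋ f
    δ0-identity f = pointwise λ n → trans (δ-∗ 0ℤ f n) (periodic f (≡⇒mod (ℤ.+-identityʳ n)))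

    ≋-trans : ∀ {f g h} → f ≋ g → g ≋ h → f ≋ h
    ≋-trans e e′ = pointwise λ t → trans (at e t) (at e′ t)

    groupRing : CommutativeRing 0ℓ 0ℓ
    groupRing = record
      { Carrier = Element ; _≈_ = _≋_ ; _+_ = _⊞_ ; _*_ = _∗_ ; -_ = ⊟_ ; 0# = 𝟘 ; 1# = δ 0ℤ
      ; isCommutativeRing = record
        { isRing = record
          { +-isAbelianGroup = record
            { isGroup = record
              { isMonoid = record
                { isSemigroup = record
                  { isMagma = record
                    { isEquivalence = record
                      { refl = pointwise λ _ → refl
                      ; sym = λ e → pointwise λ t → sym (at e t)
                      ; trans = ≋-trans }
                    ; ∙-cong = λ e e′ → pointwise λ t → ⊹-cong (at e t) (at e′ t) }
                  ; assoc = λ f g h → pointwise λ t → ⊹-assoc _ _ _ }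
                ; identity = (λ f → pointwise λ t → +-identityˡ _) , (λ f → pointwise λ t → +-identityʳ _) }
              ; inverse = (λ f → pointwise λ t → -‿inverseˡ _) , (λ f → pointwise λ t → -‿inverseʳ _)
              ; ⁻¹-cong = λ e → pointwise λ t → -‿cong (at e t) }
            ; comm = λ f g → pointwise λ t → ⊹-comm _ _ }
          ; *-cong = ∗-cong
          ; *-assoc = ∗-assoc
          ; *-identity = δ0-identity , (λ f → ≋-trans (∗-comm f (δ 0ℤ)) (δ0-identity f))
          ; distrib = ∗-distribˡ , (λ f g h → ≋-trans (∗-comm (g ⊞ h) f)
              (≋-trans (∗-distribˡ f g h) (pointwise λ t → ⊹-cong (at (∗-comm f g) t) (at (∗-comm f h) t)))) }
        ; *-comm = ∗-comm } }

    module G = CommutativeRing groupRing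
    open import Algebra.Properties.CommutativeSemiring.Exp G.commutativeSemiring public using (_^_; ^-congˡ)
    open import Algebra.Properties.Semiring.Mult G.semiring using () renaming (_×_ to _×ᴳ_)
    open import Algebra.Properties.CommutativeMonoid.Sum G.+-commutativeMonoid using () renaming (sum to sumᴳ)

    scalar : Carrier → Element → Element
    scalar c f = element (λ t → c · coeff f t) (λ e → ·-congˡ (periodic f e))

    monomial-^ : ∀ c s n t → coeff (scalar c (δ s) ^ n) t ≈ (c ↑ n) · indicator (+ n * s) t
    monomial-^ c s zero t = sym (·-identityˡ _)
    monomial-^ c s (suc n) t = begin
      ∑ (λ r → (c · indicator s r) · coeff (scalar c (δ s) ^ n) (t - r))
        ≈⟨ ∑-cong (λ r → ·-assoc _ _ _) ⟩
      ∑ (λ r → c · (indicator s r · coeff (scalar c (δ s) ^ n) (t - r)))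
        ≈⟨ ∑-*ˡ _ _ ⟩
      c · coeff (δ s ∗ (scalar c (δ s) ^ n)) t
        ≈⟨ ·-congˡ (δ-∗ s (scalar c (δ s) ^ n) t) ⟩
      c · coeff (scalar c (δ s) ^ n) (t - s)
        ≈⟨ ·-congˡ (monomial-^ c s n (t - s)) ⟩
      c · ((c ↑ n) · indicator (+ n * s) (t - s))
        ≈⟨ ·-assoc _ _ _ ⟨
      (c · (c ↑ n)) · indicator (+ n * s) (t - s)
        ≈⟨ ·-congˡ δ-shift ⟩
      (c · (c ↑ n)) · indicator (+ suc n * s) t ∎
      where
      identity₁ : ∀ t s n → t ≡ t - s + s
      identity₁ = solve-∀
      identity₂ : ∀ s n → n * s + s ≡ (1ℤ + n) * s
      identity₂ = solve-∀
      identity₃ : ∀ s n → (1ℤ + n) * s - s ≡ n * s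
      identity₃ = solve-∀
      δ-shift : indicator (+ n * s) (t - s) ≈ indicator (+ suc n * s) t
      δ-shift = indicator-cong
        (λ e → mod-trans (≡⇒mod (identity₁ t s (+ n))) (mod-trans (mod-+ʳ s e) (≡⇒mod (identity₂ s (+ n)))))
        (λ e → mod-trans (mod-+ʳ (- s) e) (≡⇒mod (identity₃ s (+ n))))

    sumᴳ-coeff : ∀ {n} (F : Fin n → Element) t → coeff (sumᴳ F) t ≈ sum (λ i → coeff (F i) t)
    sumᴳ-coeff {zero}  F t = refl
    sumᴳ-coeff {suc n} F t = ⊹-cong refl (sumᴳ-coeff (λ i → F (Fin.suc i)) t)

    opaque
      unfolding ∑

      sumᴳ-rep : ∀ (F : ℤ → Element) t → coeff (sumᴳ {q} (λ i → F (rep i))) t ≈ ∑ (λ s → coeff (F s) t)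
      sumᴳ-rep F t = sumᴳ-coeff {q} (λ i → F (rep i)) t

    decompose : ∀ f → f ≋ sumᴳ {q} (λ i → scalar (coeff f (rep i)) (δ (rep i)))
    decompose f = pointwise λ t → sym (begin
      coeff (sumᴳ {q} (λ i → scalar (coeff f (rep i)) (δ (rep i)))) t   ≈⟨ sumᴳ-rep (λ s → scalar (coeff f s) (δ s)) t ⟩
      ∑ (λ s → coeff f s · indicator s t)
        ≈⟨ ∑-single (λ {a} {b} e → ·-cong (periodic f e) (indicator-cong (λ e′ → mod-trans e′ e) (λ e′ → mod-trans e′ (mod-sym e)))) t
             (λ s ¬e → trans (·-congˡ (indicator-off (λ e → ¬e (mod-sym e)))) (·-zeroʳ _)) ⟩
      coeff f t · indicator t t   ≈⟨ trans (·-congˡ (indicator-on mod-refl)) (·-identityʳ _) ⟩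
      coeff f t ∎)

    ×ᴳ-coeff : ∀ n f t → coeff (n ×ᴳ f) t ≈ n ×× coeff f t
    ×ᴳ-coeff zero f t = refl
    ×ᴳ-coeff (suc n) f t = ⊹-cong refl (×ᴳ-coeff n f t)

    -- Writing f as the sum of its monomials f(s)[s], Frobenius gives f^l as the sum of f(s)^l
    -- [l s]. Since l is invertible modulo q, only s = 1 contributes to the group element l.
    frobenius-coeff : ∀ {l} → Prime l → (∀ x → l ×× x ≈ 0#) → ∀ u → + l * u ≡ 1ℤ ⟨mod q ⟩ →
      ∀ f → coeff (f ^ l) (+ l) ≈ coeff f 1ℤ ↑ l
    frobenius-coeff {l} l-prime l≈0 u lu≡1 f = begin
      coeff (f ^ l) (+ l)
        ≈⟨ at (^-congˡ l (decompose f)) (+ l) ⟩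
      coeff (sumᴳ {q} (λ i → scalar (coeff f (rep i)) (δ (rep i))) ^ l) (+ l)
        ≈⟨ at (Frobenius.frobenius-sum groupRing l-prime
               (λ g → pointwise λ t → trans (×ᴳ-coeff l g t) (l≈0 _)) {q} _) (+ l) ⟩
      coeff (sumᴳ {q} (λ i → scalar (coeff f (rep i)) (δ (rep i)) ^ l)) (+ l)
        ≈⟨ sumᴳ-rep (λ s → scalar (coeff f s) (δ s) ^ l) (+ l) ⟩
      ∑ (λ s → coeff (scalar (coeff f s) (δ s) ^ l) (+ l))
        ≈⟨ ∑-cong (λ s → monomial-^ (coeff f s) s l (+ l)) ⟩
      ∑ (λ s → (coeff f s ↑ l) · indicator (+ l * s) (+ l))
        ≈⟨ ∑-single (λ e → ·-cong (↑-congˡ l (periodic f e)) (indicator-cong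
               (λ e′ → mod-trans e′ (mod-*ˡ (+ l) e)) (λ e′ → mod-trans e′ (mod-*ˡ (+ l) (mod-sym e))))) 1ℤ
             (λ s ¬e → trans (·-congˡ (indicator-off (λ e → ¬e (cancel e)))) (·-zeroʳ _)) ⟩
      (coeff f 1ℤ ↑ l) · indicator (+ l * 1ℤ) (+ l)
        ≈⟨ ·-congˡ (indicator-on (≡⇒mod (≡.sym (ℤ.*-identityʳ (+ l))))) ⟩
      (coeff f 1ℤ ↑ l) · 1#
        ≈⟨ ·-identityʳ _ ⟩
      coeff f 1ℤ ↑ l ∎
      where
      open import Algebra.Properties.CommutativeSemiring.Exp commutativeSemiring using () renaming (^-congˡ to ↑-congˡ)
      identity : ∀ l s u → (l * u) * s ≡ (l * s) * u
      identity = solve-∀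
      cancel : ∀ {s} → + l ≡ + l * s ⟨mod q ⟩ → s ≡ 1ℤ ⟨mod q ⟩
      cancel {s} e = mod-trans (≡⇒mod (≡.sym (ℤ.*-identityˡ s)))
        (mod-trans (mod-*ʳ s (mod-sym lu≡1))
        (mod-trans (≡⇒mod (identity (+ l) s u)) (mod-trans (mod-*ʳ u (mod-sym e)) lu≡1)))

-- Gauss and Jacobi sums of a cubic character with values in a commutative ring

module GaussSums where

  open import Algebra.Bundles using (CommutativeRing)
  open import Data.Integer using (ℤ; +_; _+_; _-_; _*_; -_; 0ℤ; 1ℤ)
  import Data.Integer.Properties as ℤ
  open import Data.Integer.Tactic.RingSolver using (solve-∀)
  open import Data.Nat as ℕ using (ℕ; zero; suc; NonZero)
  open import Data.Product using (∃; _,_)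
  import Relation.Binary.Reasoning.Setoid
  open import Level using (0ℓ)
  open import Relation.Binary.PropositionalEquality using (_≡_)
  open import Relation.Nullary using (yes; no; ¬_)
  open EisensteinIntegers
  open GroupRings

  module Gauss (A : CommutativeRing 0ℓ 0ℓ) (q : ℕ) .{{_ : NonZero q}}
    (inverse : ∀ u → ¬ (u ≡ 0ℤ ⟨mod q ⟩) → ∃ λ v → u * v ≡ 1ℤ ⟨mod q ⟩) where

    open Residue q public
    open CommutativeRing A public hiding (_-_; ring)
      renaming (_+_ to _⊹_; _*_ to _·_; -_ to neg; +-cong to ⊹-cong; +-assoc to ⊹-assoc; +-comm to ⊹-comm;
        +-congˡ to ⊹-congˡ; +-congʳ to ⊹-congʳ;
        *-cong to ·-cong; *-congˡ to ·-congˡ; *-congʳ to ·-congʳ; *-comm to ·-comm; *-assoc to ·-assoc;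
        *-identityˡ to ·-identityˡ; *-identityʳ to ·-identityʳ; zeroˡ to ·-zeroˡ; zeroʳ to ·-zeroʳ)
    open GroupRing A q public
    open import Algebra.Properties.CommutativeSemigroup *-commutativeSemigroup public
      using (interchange; x∙yz≈y∙xz)
    open import Algebra.Properties.CommutativeSemiring.Exp commutativeSemiring public using () renaming (_^_ to _↑_)
    open import Relation.Binary.Reasoning.Setoid setoid
    open import Algebra.Properties.Ring (CommutativeRing.ring A) public
      using (-1*x≈-x; -0#≈0#; +-inverseʳ-unique)

    -- The two vanishing sums express that χ and χ² are nontrivial. They are fields because in an
    -- arbitrary coefficient ring they do not follow from χ taking a value other than 1.
    record CubicCharacter : Set where
      field
        χ         : ℤ → Carrier
        χ-periodic : Periodic χ
        χ-*       : ∀ s t → χ (s * t) ≈ χ s · χ t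
        χ-0       : χ 0ℤ ≈ 0#
        χ-1       : χ 1ℤ ≈ 1#
        χ-cube    : ∀ {u} → ¬ (u ≡ 0ℤ ⟨mod q ⟩) → χ u · (χ u · χ u) ≈ 1#
        ∑χ≈0      : ∑ χ ≈ 0#
        ∑χχ≈0     : ∑ (λ t → χ t · χ t) ≈ 0#

    -- The number q as an element of the coefficient ring.
    Q : Carrier
    Q = ∑ (λ _ → 1#)

    module Character (X : CubicCharacter) where
      open CubicCharacter X public

      χ-≡0 : ∀ {n} → n ≡ 0ℤ ⟨mod q ⟩ → χ n ≈ 0#
      χ-≡0 e = trans (χ-periodic e) χ-0

      -- The reason is that - 1 is a cube, namely of itself. The branch with - 1 ≡ 0 is the
      -- degenerate modulus 1, which the assumptions on q still allow.
      χ-neg : ∀ t → χ (- t) ≈ χ t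
      χ-neg t with mod? (- 1ℤ) 0ℤ
      ... | yes e = trans (χ-≡0 (mod-trans (≡⇒mod (identity₁ t)) (mod-trans (mod-*ʳ t e) (≡⇒mod (ℤ.*-zeroˡ t)))))
                      (sym (χ-≡0 (mod-trans (≡⇒mod (identity₂ t)) (mod-trans (mod-*ʳ (- t) e) (≡⇒mod (ℤ.*-zeroˡ (- t)))))))
        where
        identity₁ : ∀ t → - t ≡ - 1ℤ * t
        identity₁ = solve-∀
        identity₂ : ∀ t → t ≡ - 1ℤ * (- t)
        identity₂ = solve-∀
      ... | no ¬e = begin
        χ (- t)             ≈⟨ χ-periodic (≡⇒mod (identity t)) ⟩
        χ (- 1ℤ * (- 1ℤ * - 1ℤ) * t)   ≈⟨ trans (χ-* _ _) (·-congʳ (trans (χ-* _ _) (·-congˡ (χ-* _ _)))) ⟩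
        (χ (- 1ℤ) · (χ (- 1ℤ) · χ (- 1ℤ))) · χ t  ≈⟨ ·-congʳ (χ-cube ¬e) ⟩
        1# · χ t            ≈⟨ ·-identityˡ _ ⟩
        χ t                 ∎
        where
        identity : ∀ t → - t ≡ - 1ℤ * (- 1ℤ * - 1ℤ) * t
        identity = solve-∀

      χ-reflect : ∀ {n} → n ≡ 0ℤ ⟨mod q ⟩ → ∀ t → χ (n - t) ≈ χ t
      χ-reflect {n} e t = trans (χ-periodic (mod-trans (mod-+ʳ (- t) e) (≡⇒mod (ℤ.+-identityˡ (- t))))) (χ-neg t)

      χ-scaled : ∀ n t → χ (n - n * t) ≈ χ n · χ (1ℤ - t)
      χ-scaled n t = trans (χ-periodic (≡⇒mod (identity n t))) (χ-* n (1ℤ - t))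
        where
        identity : ∀ n t → n - n * t ≡ n * (1ℤ - t)
        identity = solve-∀

      J : Carrier
      J = ∑ (λ t → χ t · χ (1ℤ - t))

      -- The Gauss sum with the group element t in place of the power ζ^t of a root of unity.
      -- `gauss²` is the Gauss sum of χ², not the square of `gauss`.
      gauss gauss² : Element
      gauss  = element χ χ-periodic
      gauss² = element (λ t → χ t · χ t) (λ e → ·-cong (χ-periodic e) (χ-periodic e))

      product-periodic : ∀ f g n → Periodic (λ t → coeff f t · coeff g (n - t))
      product-periodic f g n e = ·-cong (periodic f e) (periodic g (mod-sub n e))

      -- At a unit n the substitution t ↦ n t pulls χ(n)² out of the convolution and leaves the
      -- Jacobi sum. At 0 the factor χ(- t) equals χ(t), and the sum of χ² vanishes, as does χ(0)².
      gauss∗gauss : gauss ∗ gauss ≋ scalar J gauss²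
      gauss∗gauss = pointwise go
        where
        go : ∀ n → ∑ (λ t → χ t · χ (n - t)) ≈ J · (χ n · χ n)
        go n with mod? n 0ℤ
        ... | yes e = begin
          ∑ (λ t → χ t · χ (n - t))   ≈⟨ ∑-cong (λ t → ·-congˡ (χ-reflect e t)) ⟩
          ∑ (λ t → χ t · χ t)         ≈⟨ ∑χχ≈0 ⟩
          0#                          ≈⟨ ·-zeroʳ _ ⟨
          J · 0#                      ≈⟨ ·-congˡ (trans (·-congʳ (χ-≡0 e)) (·-zeroˡ _)) ⟨
          J · (χ n · χ n)             ∎
        ... | no ¬e with inverse n ¬e
        ...   | v , nv≡1 = begin
          ∑ (λ t → χ t · χ (n - t))   ≈⟨ ∑-scale (product-periodic gauss gauss n) n v nv≡1 ⟩
          ∑ (λ t → χ (n * t) · χ (n - n * t))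
            ≈⟨ ∑-cong (λ t → trans (·-cong (χ-* n t) (χ-scaled n t)) (interchange _ _ _ _)) ⟩
          ∑ (λ t → (χ n · χ n) · (χ t · χ (1ℤ - t)))  ≈⟨ ∑-*ˡ _ _ ⟩
          (χ n · χ n) · J             ≈⟨ ·-comm _ _ ⟩
          J · (χ n · χ n)             ∎

      constant : Carrier → Element
      constant c = element (λ _ → c) (λ _ → refl)

      -- A constant function is a multiple of N, the sum of all group elements. Multiplying N by the
      -- Gauss sum only multiplies it by the total of the values of χ, which is 0. This takes the
      -- place of the relation N = 0 that holds for roots of unity.
      gauss∗constant : ∀ c → gauss ∗ constant c ≋ 𝟘
      gauss∗constant c = pointwise λ n → trans (∑-*ʳ c χ) (trans (·-congʳ ∑χ≈0) (·-zeroˡ _))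

      χ-fourth : ∀ t → (χ t · χ t) · (χ t · χ t) ≈ χ t
      χ-fourth t with mod? t 0ℤ
      ... | yes e = trans (·-congʳ (·-congʳ (χ-≡0 e))) (trans (·-congʳ (·-zeroˡ _)) (trans (·-zeroˡ _) (sym (χ-≡0 e))))
      ... | no ¬e = trans (·-assoc _ _ _) (trans (·-congˡ (χ-cube ¬e)) (·-identityʳ _))

      -- The Jacobi sum of the pair χ, χ². As χ² is the inverse character, its value is to be - 1.
      K : Carrier
      K = ∑ (λ t → χ t · (χ (1ℤ - t) · χ (1ℤ - t)))

      private
        ∑-indicator : ∑ (indicator 0ℤ) ≈ 1#
        ∑-indicator = trans (∑-single (periodic (δ 0ℤ)) 0ℤ (λ t ¬e → indicator-off ¬e)) (indicator-on mod-refl)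

        cube-indicator : ∀ t → χ t · (χ t · χ t) ≈ 1# ⊹ neg (indicator 0ℤ t)
        cube-indicator t with mod? t 0ℤ
        ... | yes e = trans (trans (·-congʳ (χ-≡0 e)) (·-zeroˡ _))
                        (trans (sym (-‿inverseʳ 1#)) (⊹-congˡ (-‿cong (sym (indicator-on e)))))
        ... | no ¬e = trans (χ-cube ¬e) (trans (sym (+-identityʳ 1#))
                        (⊹-congˡ (trans (sym -0#≈0#) (-‿cong (sym (indicator-off ¬e))))))

        ∑-neg : ∀ f → ∑ (λ t → neg (f t)) ≈ neg (∑ f)
        ∑-neg f = trans (∑-cong (λ t → sym (-1*x≈-x _))) (trans (∑-*ˡ (neg 1#) f) (-1*x≈-x _))

      gauss∗gauss²-at-0 : ∀ {n} → n ≡ 0ℤ ⟨mod q ⟩ → coeff (gauss ∗ gauss²) n ≈ Q ⊹ neg 1#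
      gauss∗gauss²-at-0 {n} e = begin
        ∑ (λ t → χ t · (χ (n - t) · χ (n - t)))
          ≈⟨ ∑-cong (λ t → trans (·-congˡ (·-cong (χ-reflect e t) (χ-reflect e t))) (cube-indicator t)) ⟩
        ∑ (λ t → 1# ⊹ neg (indicator 0ℤ t))   ≈⟨ ∑-+ _ _ ⟩
        Q ⊹ ∑ (λ t → neg (indicator 0ℤ t))    ≈⟨ ⊹-congˡ (trans (∑-neg _) (-‿cong ∑-indicator)) ⟩
        Q ⊹ neg 1#                            ∎

      gauss∗gauss²-at-unit : ∀ {n} → ¬ (n ≡ 0ℤ ⟨mod q ⟩) → coeff (gauss ∗ gauss²) n ≈ K
      gauss∗gauss²-at-unit {n} ¬e with inverse n ¬e
      ... | v , nv≡1 = begin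
        ∑ (λ t → χ t · (χ (n - t) · χ (n - t)))   ≈⟨ ∑-scale (product-periodic gauss gauss² n) n v nv≡1 ⟩
        ∑ (λ t → χ (n * t) · (χ (n - n * t) · χ (n - n * t)))
          ≈⟨ ∑-cong (λ t → trans (·-cong (χ-* n t)
               (trans (·-cong (χ-scaled n t) (χ-scaled n t)) (interchange _ _ _ _))) (interchange _ _ _ _)) ⟩
        ∑ (λ t → (χ n · (χ n · χ n)) · (χ t · (χ (1ℤ - t) · χ (1ℤ - t))))  ≈⟨ ∑-*ˡ _ _ ⟩
        (χ n · (χ n · χ n)) · K   ≈⟨ trans (·-congʳ (χ-cube ¬e)) (·-identityˡ _) ⟩
        K ∎

      -- Summing gauss ∗ gauss² over all residues gives (∑ χ)(∑ χ²) = 0.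
      Q-1·K+1 : (Q ⊹ neg 1#) · (K ⊹ 1#) ≈ 0#
      Q-1·K+1 = begin
        (Q ⊹ neg 1#) · (K ⊹ 1#)
          ≈⟨ trans (distribˡ _ _ _) (⊹-cong (·-comm _ _) (·-identityʳ _)) ⟩
        K · (Q ⊹ neg 1#) ⊹ (Q ⊹ neg 1#)
          ≈⟨ ⊹-cong (·-congˡ totals) refl ⟨
        K · ∑ (λ n → 1# ⊹ neg (indicator 0ℤ n)) ⊹ (Q ⊹ neg 1#)
          ≈⟨ ⊹-cong (∑-*ˡ _ _) (trans (∑-*ˡ _ _) (trans (·-congˡ ∑-indicator) (·-identityʳ _))) ⟨
        ∑ (λ n → K · (1# ⊹ neg (indicator 0ℤ n))) ⊹ ∑ (λ n → (Q ⊹ neg 1#) · indicator 0ℤ n)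
          ≈⟨ ∑-+ _ _ ⟨
        ∑ (λ n → K · (1# ⊹ neg (indicator 0ℤ n)) ⊹ (Q ⊹ neg 1#) · indicator 0ℤ n)
          ≈⟨ ∑-cong value ⟨
        ∑ (λ n → ∑ (λ t → χ t · (χ (n - t) · χ (n - t))))   ≈⟨ ∑-swap _ ⟩
        ∑ (λ t → ∑ (λ n → χ t · (χ (n - t) · χ (n - t))))
          ≈⟨ ∑-cong (λ t → trans (∑-*ˡ _ _) (trans (·-congˡ
               (trans (sym (∑-shift (periodic gauss²) t)) ∑χχ≈0)) (·-zeroʳ _))) ⟩
        ∑ (λ t → 0#)      ≈⟨ ∑-cong (λ t → ·-zeroˡ 0#) ⟨
        ∑ (λ t → 0# · 0#) ≈⟨ trans (∑-*ˡ _ _) (·-zeroˡ _) ⟩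
        0# ∎
        where
        totals : ∑ (λ n → 1# ⊹ neg (indicator 0ℤ n)) ≈ Q ⊹ neg 1#
        totals = trans (∑-+ _ _) (⊹-congˡ (trans (∑-neg _) (-‿cong ∑-indicator)))
        value : ∀ n → coeff (gauss ∗ gauss²) n ≈ K · (1# ⊹ neg (indicator 0ℤ n)) ⊹ (Q ⊹ neg 1#) · indicator 0ℤ n
        value n with mod? n 0ℤ
        ... | yes e = trans (gauss∗gauss²-at-0 e) (sym (trans (⊹-cong
                (trans (·-congˡ (trans (⊹-congˡ (-‿cong (indicator-on e))) (-‿inverseʳ 1#))) (·-zeroʳ _))
                (trans (·-congˡ (indicator-on e)) (·-identityʳ _))) (+-identityˡ _)))
        ... | no ¬e = trans (gauss∗gauss²-at-unit ¬e) (sym (trans (⊹-cong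
                (trans (·-congˡ (trans (⊹-congˡ (trans (-‿cong (indicator-off ¬e)) -0#≈0#)) (+-identityʳ 1#))) (·-identityʳ _))
                (trans (·-congˡ (indicator-off ¬e)) (·-zeroʳ _))) (+-identityʳ _)))

    module Relations (X : CubicCharacter) (cancel : ∀ {x} → (Q ⊹ neg 1#) · x ≈ 0# → x ≈ 0#) where
      open Character X

      -- The summation argument only yields (q - 1)(K + 1) = 0. Hence the relations are derived over
      -- a ring where q - 1 can be cancelled, namely ℤ[ω], and are reduced modulo l afterwards.
      K≈-1 : K ≈ neg 1#
      K≈-1 = +-inverseʳ-unique 1# K (trans (⊹-comm _ _) (cancel Q-1·K+1))

      gauss∗gauss² : gauss ∗ gauss² ≋ scalar Q (δ 0ℤ) ⊞ constant (neg 1#)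
      gauss∗gauss² = pointwise go
        where
        go : ∀ n → coeff (gauss ∗ gauss²) n ≈ Q · indicator 0ℤ n ⊹ neg 1#
        go n with mod? n 0ℤ
        ... | yes e = trans (gauss∗gauss²-at-0 e) (⊹-congʳ (sym (trans (·-congˡ (indicator-on e)) (·-identityʳ _))))
        ... | no ¬e = trans (gauss∗gauss²-at-unit ¬e) (trans K≈-1 (sym
                (trans (⊹-congʳ (trans (·-congˡ (indicator-off ¬e)) (·-zeroʳ _))) (+-identityˡ _))))

      scalar-∗ : ∀ c f g → f ∗ scalar c g ≋ scalar c (f ∗ g)
      scalar-∗ c f g = pointwise λ n → trans (∑-cong (λ t → x∙yz≈y∙xz _ _ _)) (∑-*ˡ _ _)

      scalar-cong : ∀ c {f g} → f ≋ g → scalar c f ≋ scalar c g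
      scalar-cong c e = pointwise λ n → ·-congˡ (at e n)

      scalar-scalar : ∀ c d f → scalar c (scalar d f) ≋ scalar (c · d) f
      scalar-scalar c d f = pointwise λ n → sym (·-assoc _ _ _)

      ∗-congˡ : ∀ f {g h} → g ≋ h → f ∗ g ≋ f ∗ h
      ∗-congˡ f = ∗-cong {f} {f} G.refl

      gauss∗[gauss∗gauss²] : gauss ∗ (gauss ∗ gauss²) ≋ scalar Q gauss
      gauss∗[gauss∗gauss²] = G.trans (∗-congˡ gauss gauss∗gauss²)
        (G.trans (∗-distribˡ gauss (scalar Q (δ 0ℤ)) (constant (neg 1#)))
        (G.trans (G.+-cong (G.trans (scalar-∗ Q gauss (δ 0ℤ))
            (scalar-cong Q (G.trans (∗-comm gauss (δ 0ℤ)) (δ0-identity gauss))))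
          (gauss∗constant (neg 1#)))
        (G.+-identityʳ (scalar Q gauss))))

      -- Three further factors contribute J (Q - N), and N is killed by the Gauss sum that remains.
      -- The exponent 3 e itself would keep N, so the powers are arranged to start from 1 or 2.
      gauss^[1+3e] : ∀ e → gauss ^ (1 ℕ.+ e ℕ.* 3) ≋ scalar ((J · Q) ↑ e) gauss
      gauss^[1+3e] zero = pointwise λ n → trans (at (∗-comm gauss (δ 0ℤ)) n)
        (trans (at (δ0-identity gauss) n) (sym (·-identityˡ _)))
      gauss^[1+3e] (suc e) = G.trans
        (∗-congˡ gauss (∗-congˡ gauss (G.trans (∗-congˡ gauss (gauss^[1+3e] e))
          (G.trans (scalar-∗ c gauss gauss) (G.trans (scalar-cong c gauss∗gauss) (scalar-scalar c J gauss²))))))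
        (G.trans (∗-congˡ gauss (scalar-∗ (c · J) gauss gauss²))
        (G.trans (scalar-∗ (c · J) gauss (gauss ∗ gauss²))
        (G.trans (scalar-cong (c · J) gauss∗[gauss∗gauss²])
        (G.trans (scalar-scalar (c · J) Q gauss)
          (pointwise λ n → ·-congʳ (trans (·-assoc _ _ _) (·-comm _ _)))))))
        where
        c = (J · Q) ↑ e

      gauss^[2+3e] : ∀ e → gauss ^ (2 ℕ.+ e ℕ.* 3) ≋ scalar ((J · Q) ↑ e · J) gauss²
      gauss^[2+3e] e = G.trans (∗-congˡ gauss (gauss^[1+3e] e))
        (G.trans (scalar-∗ ((J · Q) ↑ e) gauss gauss) (G.trans (scalar-cong ((J · Q) ↑ e) gauss∗gauss)
          (scalar-scalar ((J · Q) ↑ e) J gauss²)))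

      gauss^3 : gauss ^ 3 ≋ scalar J (scalar Q (δ 0ℤ) ⊞ constant (neg 1#))
      gauss^3 = G.trans (∗-congˡ gauss {g = gauss ^ 2} {h = scalar J gauss²} (G.trans (gauss^[2+3e] 0) (pointwise λ n → ·-congʳ (·-identityˡ _))))
        (G.trans (scalar-∗ J gauss gauss²) (scalar-cong J gauss∗gauss²))

      -- The Jacobi sum of χ² with itself, not the square of `J`.
      J² : Carrier
      J² = ∑ (λ t → (χ t · χ t) · (χ (1ℤ - t) · χ (1ℤ - t)))

      squared : CubicCharacter
      squared = record
        { χ = λ t → χ t · χ t
        ; χ-periodic = periodic gauss²
        ; χ-* = λ s t → trans (·-cong (χ-* s t) (χ-* s t)) (interchange _ _ _ _)
        ; χ-0 = trans (·-congʳ χ-0) (·-zeroˡ _)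
        ; χ-1 = trans (·-cong χ-1 χ-1) (·-identityˡ _)
        ; χ-cube = λ ¬e → trans (·-congˡ (interchange _ _ _ _)) (trans (interchange _ _ _ _)
            (trans (·-cong (χ-cube ¬e) (χ-cube ¬e)) (·-identityˡ _)))
        ; ∑χ≈0 = ∑χχ≈0
        ; ∑χχ≈0 = trans (∑-cong χ-fourth) ∑χ≈0 }

      gauss²∗gauss² : gauss² ∗ gauss² ≋ scalar J² gauss
      gauss²∗gauss² = G.trans {k = scalar J² gauss} (Character.gauss∗gauss squared)
        (scalar-cong J² {Character.gauss² squared} {gauss} (pointwise χ-fourth))

      -- The product gauss · gauss · gauss² is evaluated in two ways. Pairing the first two factors
      -- gives J · gauss² · gauss² = J J² · gauss, pairing the last two gives gauss (Q - N) = Q ·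
      -- gauss. The coefficients at 1 are then compared. No absolute values are involved.
      J·J²≈Q : J · J² ≈ Q
      J·J²≈Q = begin
        J · J²               ≈⟨ trans (·-congˡ χ-1) (·-identityʳ _) ⟨
        (J · J²) · χ 1ℤ      ≈⟨ at chain 1ℤ ⟩
        Q · χ 1ℤ             ≈⟨ trans (·-congˡ χ-1) (·-identityʳ _) ⟩
        Q                    ∎
        where
        module R = Relation.Binary.Reasoning.Setoid G.setoid
        chain : scalar (J · J²) gauss ≋ scalar Q gauss
        chain = R.begin
          scalar (J · J²) gauss        R.≈⟨ scalar-scalar J J² gauss ⟨
          scalar J (scalar J² gauss)   R.≈⟨ scalar-cong J gauss²∗gauss² ⟨
          scalar J (gauss² ∗ gauss²)   R.≈⟨ scalar-∗ J gauss² gauss² ⟨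
          gauss² ∗ scalar J gauss²     R.≈⟨ ∗-congˡ gauss² gauss∗gauss ⟨
          gauss² ∗ (gauss ∗ gauss)     R.≈⟨ ∗-comm gauss² (gauss ∗ gauss) ⟩
          (gauss ∗ gauss) ∗ gauss²     R.≈⟨ ∗-assoc gauss gauss gauss² ⟩
          gauss ∗ (gauss ∗ gauss²)     R.≈⟨ gauss∗[gauss∗gauss²] ⟩
          scalar Q gauss               R.∎

-- Prime moduli: Fermat's theorem and sums of polynomial values

module PrimeFields where

  open import Algebra.Bundles using (CommutativeRing)
  open import Data.Fin as Fin using (Fin; toℕ)
  import Data.Fin.Properties as Fin
  open import Data.Integer using (ℤ; +_; -[1+_]; _+_; _-_; _*_; -_; _^_; 0ℤ; 1ℤ; ∣_∣)
  import Data.Integer.Properties as ℤ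
  open import Data.Integer.Tactic.RingSolver using (solve-∀)
  open import Data.Nat as ℕ using (ℕ; zero; suc; NonZero; _<_; s≤s; z≤n)
  open import Data.Nat.Combinatorics using (_C_; nCk+nC[k+1]≡[n+1]C[k+1]; k>n⇒nCk≡0)
  import Data.Nat.Divisibility as ℕ
  open import Data.Nat.Primality using (Prime; euclidsLemma; prime⇒nonZero; prime⇒nonTrivial)
  import Data.Nat.Properties as ℕ
  open import Data.Product using (∃; _,_)
  open import Data.Sum using (_⊎_; inj₁; inj₂)
  open import Relation.Binary.PropositionalEquality
  open import Relation.Nullary using (contradiction; ¬_)
  open EisensteinIntegers
  open FrobeniusMap
  open GroupRings

  ∣⇒≡0 : ∀ {l a} → l ℕ.∣ ∣ a ∣ → a ≡ 0ℤ ⟨mod l ⟩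
  ∣⇒≡0 {l} {+ n} (ℕ.divides c eq) = modulo (+ c)
    (trans (cong +_ eq) (trans (ℤ.pos-* c l) (sym (ℤ.+-identityˡ _))))
  ∣⇒≡0 {l} { -[1+ n ]} (ℕ.divides c eq) = modulo (- (+ c))
    (trans (cong (λ z → - (+ z)) eq) (trans (cong -_ (ℤ.pos-* c l))
      (trans (ℤ.neg-distribˡ-* (+ c) (+ l)) (sym (ℤ.+-identityˡ _)))))

  ≡0⇒∣ : ∀ {l a} → a ≡ 0ℤ ⟨mod l ⟩ → l ℕ.∣ ∣ a ∣
  ≡0⇒∣ {l} {a} (modulo q e) = ℕ.divides ∣ q ∣
    (trans (cong ∣_∣ (trans e (ℤ.+-identityˡ (q * + l)))) (ℤ.abs-* q (+ l)))

  mod-weaken : ∀ {l m a b} → l ℕ.∣ m → a ≡ b ⟨mod m ⟩ → a ≡ b ⟨mod l ⟩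
  mod-weaken {l} {a = a} {b} (ℕ.divides c refl) (modulo q e) = modulo (q * + c)
    (trans e (cong (λ z → b + z) (trans (cong (q *_) (ℤ.pos-* c l)) (sym (ℤ.*-assoc q (+ c) (+ l))))))

  mod-difference : ∀ {l a b} → a ≡ b ⟨mod l ⟩ → a - b ≡ 0ℤ ⟨mod l ⟩
  mod-difference {b = b} e = mod-trans (mod-+ʳ (- b) e) (≡⇒mod (ℤ.+-inverseʳ b))

  difference-mod : ∀ {l a b} → a - b ≡ 0ℤ ⟨mod l ⟩ → a ≡ b ⟨mod l ⟩
  difference-mod {a = a} {b} e = mod-trans (≡⇒mod (identity a b)) (mod-trans (mod-+ʳ b e) (≡⇒mod (ℤ.+-identityˡ b)))
    where
    identity : ∀ a b → a ≡ a - b + b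
    identity = solve-∀

  mod-^ : ∀ {l a b} n → a ≡ b ⟨mod l ⟩ → a ^ n ≡ b ^ n ⟨mod l ⟩
  mod-^ zero e = mod-refl
  mod-^ (suc n) e = mod-* e (mod-^ n e)

  zero-^ : ∀ n .{{_ : NonZero n}} → 0ℤ ^ n ≡ 0ℤ
  zero-^ (suc n) = refl

  module PrimeModulus {q : ℕ} (q-prime : Prime q) where

    private instance
      q≢0 : NonZero q
      q≢0 = prime⇒nonZero q-prime

    euclid : ∀ a b → a * b ≡ 0ℤ ⟨mod q ⟩ → a ≡ 0ℤ ⟨mod q ⟩ ⊎ b ≡ 0ℤ ⟨mod q ⟩
    euclid a b e with euclidsLemma ∣ a ∣ ∣ b ∣ q-prime (subst (q ℕ.∣_) (ℤ.abs-* a b) (≡0⇒∣ e))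
    ... | inj₁ d = inj₁ (∣⇒≡0 d)
    ... | inj₂ d = inj₂ (∣⇒≡0 d)

    cancelˡ : ∀ c {a b} → ¬ (c ≡ 0ℤ ⟨mod q ⟩) → c * a ≡ c * b ⟨mod q ⟩ → a ≡ b ⟨mod q ⟩
    cancelˡ c {a} {b} c≢0 e with euclid c (a - b) (mod-trans (≡⇒mod (identity c a b)) (mod-difference e))
      where
      identity : ∀ c a b → c * (a - b) ≡ c * a - c * b
      identity = solve-∀
    ... | inj₁ c≡0 = contradiction c≡0 c≢0
    ... | inj₂ d   = difference-mod d

    1≢0 : ¬ (1ℤ ≡ 0ℤ ⟨mod q ⟩)
    1≢0 e = contradiction (ℕ.∣1⇒≡1 (≡0⇒∣ e)) (ℕ.nonTrivial⇒≢1 {{prime⇒nonTrivial q-prime}})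

    ^-nonzero : ∀ {a} n → ¬ (a ≡ 0ℤ ⟨mod q ⟩) → ¬ (a ^ n ≡ 0ℤ ⟨mod q ⟩)
    ^-nonzero zero a≢0 = 1≢0
    ^-nonzero {a} (suc n) a≢0 e with euclid a (a ^ n) e
    ... | inj₁ z = a≢0 z
    ... | inj₂ z = ^-nonzero n a≢0 z

    *-nonzero : ∀ {a b} → ¬ (a ≡ 0ℤ ⟨mod q ⟩) → ¬ (b ≡ 0ℤ ⟨mod q ⟩) → ¬ (a * b ≡ 0ℤ ⟨mod q ⟩)
    *-nonzero {a} {b} a≢0 b≢0 e with euclid a b e
    ... | inj₁ z = a≢0 z
    ... | inj₂ z = b≢0 z

    -- By induction on n, the Frobenius map applied to 1 + n in ℤ/q.
    fermat-ℕ : ∀ n → (+ n) ^ q ≡ + n ⟨mod q ⟩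
    fermat-ℕ zero = ≡⇒mod (zero-^ q)
    fermat-ℕ (suc n) = mod-trans (≡⇒mod (power≡ (1ℤ + + n) q))
      (mod-trans (F.frobenius q-prime q≈0 1ℤ (+ n))
      (mod-+ (mod-trans (≡⇒mod (sym (power≡ 1ℤ q))) (≡⇒mod (ℤ.^-zeroˡ q)))
        (mod-trans (≡⇒mod (sym (power≡ (+ n) q))) (fermat-ℕ n))))
      where
      module F = Frobenius (ℤ/ q)
      open import Algebra.Properties.Semiring.Exp (CommutativeRing.semiring (ℤ/ q)) renaming (_^_ to _^ᵣ_)
      open import Algebra.Properties.Semiring.Mult (CommutativeRing.semiring (ℤ/ q)) renaming (_×_ to _×ᵣ_)
      power≡ : ∀ a n → a ^ n ≡ a ^ᵣ n
      power≡ a zero = refl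
      power≡ a (suc n) = cong (a *_) (power≡ a n)
      multiple≡ : ∀ n x → n ×ᵣ x ≡ + n * x
      multiple≡ zero x = sym (ℤ.*-zeroˡ x)
      multiple≡ (suc n) x = trans (cong (λ z → x + z) (multiple≡ n x)) (sym (ℤ.suc-* (+ n) x))
      q≈0 : ∀ x → q ×ᵣ x ≡ 0ℤ ⟨mod q ⟩
      q≈0 x = modulo x (trans (multiple≡ q x) (trans (ℤ.*-comm (+ q) x) (sym (ℤ.+-identityˡ _))))

    open Residue q

    fermat : ∀ a → a ^ q ≡ a ⟨mod q ⟩
    fermat a = mod-trans (mod-^ q (mod-sym (rep-residue a))) (mod-trans (fermat-ℕ (toℕ (residue a))) (rep-residue a))

    fermat-unit : ∀ a → ¬ (a ≡ 0ℤ ⟨mod q ⟩) → a ^ (q ℕ.∸ 1) ≡ 1ℤ ⟨mod q ⟩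
    fermat-unit a a≢0 = cancelˡ a a≢0 (mod-trans (≡⇒mod (cong (a ^_) (ℕ.suc-pred q)))
      (mod-trans (fermat a) (≡⇒mod (sym (ℤ.*-identityʳ a)))))

    inverse : ∀ u → ¬ (u ≡ 0ℤ ⟨mod q ⟩) → ∃ λ v → u * v ≡ 1ℤ ⟨mod q ⟩
    inverse u u≢0 = u ^ (q ℕ.∸ 2) , mod-trans (≡⇒mod (cong (u ^_) exponent)) (fermat-unit u u≢0)
      where
      exponent : suc (q ℕ.∸ 2) ≡ q ℕ.∸ 1
      exponent = sym (ℕ.+-∸-assoc 1 (ℕ.nonTrivial⇒n>1 q {{prime⇒nonTrivial q-prime}}))

  -- Functions ℕ → ℤ whose d-th finite difference vanishes, i.e. polynomials of degree < d.
  Δ : (ℕ → ℤ) → ℕ → ℤ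
  Δ f n = f (suc n) - f n

  Degree< : ℕ → (ℕ → ℤ) → Set
  Degree< zero    f = ∀ n → f n ≡ 0ℤ
  Degree< (suc d) f = Degree< d (Δ f)

  degree-resp : ∀ d {f g} → (∀ n → f n ≡ g n) → Degree< d f → Degree< d g
  degree-resp zero    e p n = trans (sym (e n)) (p n)
  degree-resp (suc d) e p = degree-resp d (λ n → cong₂ _-_ (e (suc n)) (e n)) p

  degree-+ : ∀ d {f g} → Degree< d f → Degree< d g → Degree< d (λ n → f n + g n)
  degree-+ zero p r n = cong₂ _+_ (p n) (r n)
  degree-+ (suc d) {f} {g} p r = degree-resp d (λ n → identity (f (suc n)) (f n) (g (suc n)) (g n)) (degree-+ d p r)
    where
    identity : ∀ a b c d → (a - b) + (c - d) ≡ (a + c) - (b + d)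
    identity = solve-∀

  degree-scale : ∀ d c {f} → Degree< d f → Degree< d (λ n → c * f n)
  degree-scale zero c p n = trans (cong (c *_) (p n)) (ℤ.*-zeroʳ c)
  degree-scale (suc d) c {f} p = degree-resp d (λ n → identity c (f (suc n)) (f n)) (degree-scale d c p)
    where
    identity : ∀ c a b → c * (a - b) ≡ c * a - c * b
    identity = solve-∀

  -- The product rule for differences: the difference of (a + b n) f is (a + b + b n) Δ f + b f. The
  -- first summand multiplies a function of smaller degree by another linear factor.
  degree-linear : ∀ d a b {f} → Degree< d f → Degree< (suc d) (λ n → (a + b * + n) * f n)
  degree-linear zero a b {f} p n = trans (cong₂ (λ x y → (a + b * + suc n) * x - (a + b * + n) * y) (p (suc n)) (p n))
    (identity (a + b * + suc n) (a + b * + n))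
    where
    identity : ∀ x y → x * 0ℤ - y * 0ℤ ≡ 0ℤ
    identity = solve-∀
  degree-linear (suc d) a b {f} p = degree-resp (suc d) (λ n → identity a b (+ n) (f (suc n)) (f n))
    (degree-+ (suc d) {λ n → ((a + b) + b * + n) * Δ f n} {λ n → b * f n} (degree-linear d (a + b) b {Δ f} p) (degree-scale (suc d) b {f} p))
    where
    identity : ∀ a b n x y →
      ((a + b) + b * n) * (x - y) + b * y ≡ (a + b * (1ℤ + n)) * x - (a + b * n) * y
    identity = solve-∀

  -- Newton's interpolation sum of C(n, k + i) times the i-th difference of f at 0, for i < d. The
  -- offset k is there for the recursion, which replaces f by Δ f.
  newton : ℕ → ℕ → (ℕ → ℤ) → ℕ → ℤ
  newton zero    k f n = 0ℤ
  newton (suc d) k f n = + (n C k) * f 0 + newton d (suc k) (Δ f) n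

  newton-pascal : ∀ d k f n → newton d (suc k) f (suc n) ≡ newton d (suc k) f n + newton d k f n
  newton-pascal zero k f n = refl
  newton-pascal (suc d) k f n = begin
    + (suc n C suc k) * f 0 + newton d (suc (suc k)) (Δ f) (suc n)
      ≡⟨ cong₂ (λ c x → + c * f 0 + x) (sym (nCk+nC[k+1]≡[n+1]C[k+1] n k)) (newton-pascal d (suc k) (Δ f) n) ⟩
    + (n C k ℕ.+ n C suc k) * f 0 + (newton d (suc (suc k)) (Δ f) n + newton d (suc k) (Δ f) n)
      ≡⟨ cong (λ c → c * f 0 + (newton d (suc (suc k)) (Δ f) n + newton d (suc k) (Δ f) n)) (ℤ.pos-+ (n C k) (n C suc k)) ⟩
    (+ (n C k) + + (n C suc k)) * f 0 + (newton d (suc (suc k)) (Δ f) n + newton d (suc k) (Δ f) n)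
      ≡⟨ identity (+ (n C k)) (+ (n C suc k)) (f 0) _ _ ⟩
    + (n C suc k) * f 0 + newton d (suc (suc k)) (Δ f) n + (+ (n C k) * f 0 + newton d (suc k) (Δ f) n) ∎
    where
    open ≡-Reasoning
    identity : ∀ a b c x y → (a + b) * c + (x + y) ≡ b * c + x + (a * c + y)
    identity = solve-∀

  newton-0 : ∀ d k f → newton d (suc k) f 0 ≡ 0ℤ
  newton-0 zero k f = refl
  newton-0 (suc d) k f = trans (cong₂ (λ c x → + c * f 0 + x) (k>n⇒nCk≡0 {0} {suc k} (s≤s z≤n)) (newton-0 d (suc k) (Δ f)))
    (trans (ℤ.+-identityʳ _) (ℤ.*-zeroˡ (f 0)))

  newton-formula : ∀ d f → Degree< d f → ∀ n → newton d 0 f n ≡ f n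
  newton-formula zero f p n = sym (p n)
  newton-formula (suc d) f p zero = trans (cong (λ x → 1ℤ * f 0 + x) (newton-0 d 0 (Δ f)))
    (trans (ℤ.+-identityʳ _) (ℤ.*-identityˡ (f 0)))
  newton-formula (suc d) f p (suc n) = begin
    + (suc n C 0) * f 0 + newton d 1 (Δ f) (suc n)
      ≡⟨ cong₂ (λ c x → + c * f 0 + x) (trans (nC0≡1 (suc n)) (sym (nC0≡1 n))) (newton-pascal d 0 (Δ f) n) ⟩
    + (n C 0) * f 0 + (newton d 1 (Δ f) n + newton d 0 (Δ f) n)
      ≡⟨ ℤ.+-assoc (+ (n C 0) * f 0) _ _ ⟨
    newton (suc d) 0 f n + newton d 0 (Δ f) n
      ≡⟨ cong₂ _+_ (newton-formula (suc d) f p n) (newton-formula d (Δ f) p n) ⟩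
    f n + (f (suc n) - f n)
      ≡⟨ identity (f n) (f (suc n)) ⟩
    f (suc n) ∎
    where
    open ≡-Reasoning
    identity : ∀ a b → a + (b - a) ≡ b
    identity = solve-∀

  -- The lower indices run from k + 1 to k + d. The bound keeps them strictly between 0 and q, where
  -- q divides C(q, i).
  newton-prime : ∀ {q} → Prime q → ∀ d k f → suc k ℕ.+ d ℕ.≤ q → newton d (suc k) f q ≡ 0ℤ ⟨mod q ⟩
  newton-prime q-prime zero k f le = mod-refl
  newton-prime {q} q-prime (suc d) k f le = mod-trans
    (mod-+ (mod-*ʳ (f 0) (∣⇒≡0 {a = + (q C suc k)} (prime∣C q-prime (s≤s z≤n)
        (ℕ.≤-trans (ℕ.≤-trans (s≤s (ℕ.m≤m+n (suc k) d)) (ℕ.≤-reflexive (sym (ℕ.+-suc (suc k) d)))) le))))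
      (newton-prime q-prime d (suc k) (Δ f) (ℕ.≤-trans (ℕ.≤-reflexive (sym (ℕ.+-suc (suc k) d))) le)))
    (≡⇒mod (trans (ℤ.+-identityʳ _) (ℤ.*-zeroˡ (f 0))))

  open import Algebra.Properties.CommutativeMonoid.Sum ℤ.+-0-commutativeMonoid using (sum; sum-init-last; sum-cong-≗)

  partialSum : (ℕ → ℤ) → ℕ → ℤ
  partialSum f n = sum {n} (λ i → f (toℕ i))

  partialSum-suc : ∀ f n → partialSum f (suc n) ≡ partialSum f n + f n
  partialSum-suc f n = trans (sum-init-last {n} (λ i → f (toℕ i)))
    (cong₂ _+_ (sum-cong-≗ {n} (λ i → cong f (Fin.toℕ-inject₁ i))) (cong f (Fin.toℕ-fromℕ n)))

  -- The partial sums form a polynomial function with difference f and value 0 at 0. Evaluated at q,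
  -- Newton's formula for it involves only C(q, i) with 1 ≤ i ≤ d. This replaces the usual argument
  -- with a primitive root.
  power-sum : ∀ {q} → Prime q → ∀ d f → Degree< d f → d < q → partialSum f q ≡ 0ℤ ⟨mod q ⟩
  power-sum {q} q-prime d f p d<q = mod-trans
    (≡⇒mod (sym (newton-formula (suc d) (partialSum f) degree q)))
    (mod-trans (mod-+ (≡⇒mod (ℤ.*-zeroʳ (+ (q C 0)))) (newton-prime q-prime d 0 _ d<q)) mod-refl)
    where
    identity : ∀ a b → b ≡ (a + b) - a
    identity = solve-∀
    degree : Degree< d (Δ (partialSum f))
    degree = degree-resp d (λ n → trans (identity (partialSum f n) (f n)) (cong (_- partialSum f n) (sym (partialSum-suc f n)))) p

  degree-one : Degree< 1 (λ _ → 1ℤ)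
  degree-one n = refl

  degree-power : ∀ k → Degree< (suc k) (λ n → (+ n) ^ k)
  degree-power zero = degree-one
  degree-power (suc k) = degree-resp (suc (suc k)) (λ n → cong (_* (+ n) ^ k) (identity (+ n)))
    (degree-linear (suc k) 0ℤ 1ℤ {λ n → (+ n) ^ k} (degree-power k))
    where
    identity : ∀ n → 0ℤ + 1ℤ * n ≡ n
    identity = solve-∀

  degree-jacobi : ∀ j k → Degree< (j ℕ.+ suc k) (λ n → (+ n) ^ k * (1ℤ - + n) ^ j)
  degree-jacobi zero k = degree-resp (suc k) (λ n → sym (ℤ.*-identityʳ ((+ n) ^ k))) (degree-power k)
  degree-jacobi (suc j) k = degree-resp (suc j ℕ.+ suc k)
    (λ n → identity (+ n) ((+ n) ^ k) ((1ℤ - + n) ^ j)) (degree-linear (j ℕ.+ suc k) 1ℤ (- 1ℤ) {λ n → (+ n) ^ k * (1ℤ - + n) ^ j} (degree-jacobi j k))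
    where
    identity : ∀ n x y → (1ℤ + - 1ℤ * n) * (x * y) ≡ x * ((1ℤ - n) * y)
    identity = solve-∀

-- The cubic residue character modulo a prime q ≡ 1 (mod 3)

module ResidueCharacters where

  open import Algebra.Bundles using (CommutativeRing)
  open import Data.Fin as Fin using (Fin; toℕ)
  import Data.Fin.Properties as Fin
  open import Data.Integer using (ℤ; +_; _+_; _-_; _*_; -_; _^_; 0ℤ; 1ℤ; -1ℤ; ∣_∣)
  import Data.Integer.Properties as ℤ
  open import Data.Integer.Tactic.RingSolver using (solve-∀)
  open import Data.Nat as ℕ using (ℕ; zero; suc; _<_; s≤s; z≤n)
  import Data.Nat.DivMod as ℕ
  import Data.Nat.Divisibility as ℕ
  open import Data.Nat.Primality using (Prime; prime⇒nonTrivial; prime⇒irreducible)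
  import Data.Nat.Properties as ℕ
  open import Data.Product using (∃; _,_; _×_; proj₁; proj₂)
  open import Data.Sum as Sum using (_⊎_; inj₂; [_,_]′)
  open import Relation.Binary.PropositionalEquality
  open import Relation.Nullary using (Dec; yes; no; contradiction; ¬_)
  open EisensteinIntegers
  open GroupRings
  open GaussSums
  open PrimeFields

  ω² : 𝔼
  ω² = -1ℤ +ω -1ℤ

  data Value : 𝔼 → Set where
    v0  : Value (ι 0ℤ)
    v1  : Value (ι 1ℤ)
    vω  : Value ω
    vω² : Value ω²

  value-⊗ : ∀ {α β} → Value α → Value β → Value (α ⊗ β)
  value-⊗ v0  v0  = v0
  value-⊗ v0  v1  = v0
  value-⊗ v0  vω  = v0
  value-⊗ v0  vω² = v0
  value-⊗ v1  v0  = v0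
  value-⊗ v1  v1  = v1
  value-⊗ v1  vω  = vω
  value-⊗ v1  vω² = vω²
  value-⊗ vω  v0  = v0
  value-⊗ vω  v1  = vω
  value-⊗ vω  vω  = vω²
  value-⊗ vω  vω² = v1
  value-⊗ vω² v0  = v0
  value-⊗ vω² v1  = vω²
  value-⊗ vω² vω  = v1
  value-⊗ vω² vω² = vω

  value-conj : ∀ {α} → Value α → conj α ≡ α ⊗ α
  value-conj v0  = refl
  value-conj v1  = refl
  value-conj vω  = refl
  value-conj vω² = refl

  value-cube : ∀ {α} → Value α → α ≢ ι 0ℤ → α ⊗ (α ⊗ α) ≡ ι 1ℤ
  value-cube v0  α≢0 = contradiction refl α≢0
  value-cube v1  _ = refl
  value-cube vω  _ = refl
  value-cube vω² _ = refl

  value-1? : ∀ {α} → Value α → Dec (α ≡ ι 1ℤ)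
  value-1? v0  = no λ ()
  value-1? v1  = yes refl
  value-1? vω  = no λ ()
  value-1? vω² = no λ ()

  triple-zero : ∀ a → a + (a + a) ≡ 0ℤ → a ≡ 0ℤ
  triple-zero a e with ℤ.i*j≡0⇒i≡0∨j≡0 (+ 3) (trans (identity a) e)
    where
    identity : ∀ a → + 3 * a ≡ a + (a + a)
    identity = solve-∀
  ... | inj₂ a≡0 = a≡0

  -- Here (c - 1) α = 0 with c a primitive cube root of unity; c - 1 has norm 3, so 3 α = 0. The
  -- case ω² is turned into the case ω by one multiplication with ω.
  fixed-by-value : ∀ {c α} → Value c → c ≢ ι 0ℤ → c ≢ ι 1ℤ → c ⊗ α ≡ α → α ≡ ι 0ℤ
  fixed-by-value v0 c≢0 _ _ = contradiction refl c≢0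
  fixed-by-value v1 _ c≢1 _ = contradiction refl c≢1
  fixed-by-value {α = a +ω b} vω _ _ e = cong₂ _+ω_
    (triple-zero a (trans (identity₁ a b) (trans (cong₂ (λ x y → (a - x) + (a - x) - (b - y)) (cong re e) (cong im e)) (zero₁ a b))))
    (triple-zero b (trans (identity₂ a b) (trans (cong₂ (λ x y → (a - x) + (b - y)) (cong re e) (cong im e)) (zero₂ a b))))
    where
    identity₁ : ∀ a b → a + (a + a) ≡
      (a - (0ℤ * a - 1ℤ * b)) + (a - (0ℤ * a - 1ℤ * b)) - (b - (0ℤ * b + 1ℤ * a - 1ℤ * b))
    identity₁ = solve-∀
    identity₂ : ∀ a b → b + (b + b) ≡ (a - (0ℤ * a - 1ℤ * b)) + (b - (0ℤ * b + 1ℤ * a - 1ℤ * b))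
    identity₂ = solve-∀
    zero₁ : ∀ a b → (a - a) + (a - a) - (b - b) ≡ 0ℤ
    zero₁ = solve-∀
    zero₂ : ∀ a b → (a - a) + (b - b) ≡ 0ℤ
    zero₂ = solve-∀
  fixed-by-value {c} {α} vω² _ _ e = fixed-by-value vω (λ ()) (λ ())
    (trans (cong (ω ⊗_) (sym e)) (trans (sym (⊗-assoc ω ω² α)) (⊗-identityˡ α)))

  module Exponent {q : ℕ} (q-prime : Prime q) (w : ℤ) (w-root : w * w + w + 1ℤ ≡ 0ℤ ⟨mod q ⟩)
    (3≢0 : ¬ (+ 3 ≡ 0ℤ ⟨mod q ⟩)) where
    open PrimeModulus q-prime

    w³≡1 : w ^ 3 ≡ 1ℤ ⟨mod q ⟩
    w³≡1 = mod-trans (≡⇒mod (identity w)) (mod-trans (mod-+ʳ 1ℤ (mod-*ˡ (w - 1ℤ) w-root))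
      (≡⇒mod (trans (cong (λ z → z + 1ℤ) (ℤ.*-zeroʳ (w - 1ℤ))) refl)))
      where
      identity : ∀ w → w * (w * (w * 1ℤ)) ≡ (w - 1ℤ) * (w * w + w + 1ℤ) + 1ℤ
      identity = solve-∀

    w≢0 : ¬ (w ≡ 0ℤ ⟨mod q ⟩)
    w≢0 e = 1≢0 (mod-trans (mod-sym w³≡1) (mod-^ 3 e))

    w≢1 : ¬ (w ≡ 1ℤ ⟨mod q ⟩)
    w≢1 e = 3≢0 (mod-trans (mod-sym (mod-+ʳ 1ℤ (mod-+ (mod-* e e) e))) w-root)

    -- For q = 3 k + 2, Fermat's theorem would give 1 ≡ w^(q-1) = w (w³)^k ≡ w; but w ≡ 1 turns w² +
    -- w + 1 into 3.
    exponent : ∃ λ k → q ≡ suc (k ℕ.* 3) × 0 < k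
    exponent with q ℕ.% 3 in eq | ℕ.m%n<n q 3 | ℕ.m≡m%n+[m/n]*n q 3
    ... | 0 | _ | q≡ with prime⇒irreducible q-prime (ℕ.divides (q ℕ./ 3) q≡)
    ...   | inj₂ refl = contradiction (modulo 1ℤ refl) 3≢0
    exponent | 1 | _ | q≡ = q ℕ./ 3 , q≡ , positive (q ℕ./ 3) q≡
      where
      positive : ∀ k → q ≡ suc (k ℕ.* 3) → 0 < k
      positive zero refl = contradiction refl (ℕ.nonTrivial⇒≢1 {{prime⇒nonTrivial q-prime}})
      positive (suc _) _ = s≤s z≤n
    exponent | 2 | _ | q≡ = contradiction (mod-trans (≡⇒mod (sym w-power)) w-fermat) w≢1′
      where
      k = q ℕ./ 3
      w-fermat : w ^ (q ℕ.∸ 1) ≡ 1ℤ ⟨mod q ⟩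
      w-fermat = fermat-unit w w≢0
      w-power : w ^ (q ℕ.∸ 1) ≡ w * (w ^ 3) ^ k
      w-power = trans (cong (λ n → w ^ (n ℕ.∸ 1)) q≡)
        (cong (w *_) (trans (cong (w ^_) (ℕ.*-comm k 3)) (sym (ℤ.^-*-assoc w 3 k))))
      w≢1′ : ¬ (w * (w ^ 3) ^ k ≡ 1ℤ ⟨mod q ⟩)
      w≢1′ e = w≢1 (mod-trans (≡⇒mod (sym (ℤ.*-identityʳ w)))
        (mod-trans (mod-*ˡ w (mod-sym (mod-trans (mod-^ k w³≡1) (≡⇒mod (ℤ.^-zeroˡ k))))) e))
    exponent | suc (suc (suc _)) | s≤s (s≤s (s≤s ())) | _

    cube-roots : ∀ x → x ^ 3 ≡ 1ℤ ⟨mod q ⟩ →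
      x ≡ 1ℤ ⟨mod q ⟩ ⊎ x ≡ w ⟨mod q ⟩ ⊎ x ≡ -1ℤ + -1ℤ * w ⟨mod q ⟩
    cube-roots x x³≡1 = Sum.map difference-mod
      (λ z → Sum.map difference-mod difference-mod (euclid (x - w) (x - (-1ℤ + -1ℤ * w)) z))
      (euclid (x - 1ℤ) ((x - w) * (x - (-1ℤ + -1ℤ * w))) product≡0)
      where
      identity : ∀ w x → (x - 1ℤ) * ((x - w) * (x - (-1ℤ + -1ℤ * w)))
        ≡ x * (x * (x * 1ℤ)) - 1ℤ + (1ℤ - x) * (w * w + w + 1ℤ)
      identity = solve-∀
      vanish : ∀ x → 0ℤ + (1ℤ - x) * 0ℤ ≡ 0ℤ
      vanish = solve-∀
      product≡0 : (x - 1ℤ) * ((x - w) * (x - (-1ℤ + -1ℤ * w))) ≡ 0ℤ ⟨mod q ⟩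
      product≡0 = mod-trans (≡⇒mod (identity w x))
        (mod-trans (mod-+ (mod-difference x³≡1) (mod-*ˡ (1ℤ - x) w-root)) (≡⇒mod (vanish x)))

  *-^ : ∀ a b n → (a * b) ^ n ≡ a ^ n * b ^ n
  *-^ a b zero = refl
  *-^ a b (suc n) = trans (cong (a * b *_) (*-^ a b n)) (identity a b (a ^ n) (b ^ n))
    where
    identity : ∀ a b x y → a * b * (x * y) ≡ a * x * (b * y)
    identity = solve-∀

  -- The cubic residue character modulo q = 3k + 1 attached to a primitive cube root of unity w modulo q.
  module ResidueCharacter (k : ℕ) (0<k : 0 < k) (q-prime : Prime (suc (k ℕ.* 3))) (w : ℤ)
    (w-root : w * w + w + 1ℤ ≡ 0ℤ ⟨mod suc (k ℕ.* 3) ⟩) (3≢0 : ¬ (+ 3 ≡ 0ℤ ⟨mod suc (k ℕ.* 3) ⟩)) where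

    private
      q : ℕ
      q = suc (k ℕ.* 3)

    open PrimeModulus q-prime
    open Exponent q-prime w w-root 3≢0 using (w³≡1; w≢0; w≢1; cube-roots)
    module 𝔾 = Gauss 𝔼-ring q inverse
    open 𝔾 using (mod?)

    -- The reduction ℤ[ω] → ℤ/q with ω ↦ w. Its kernel is one of the two prime ideals above q.
    φ : 𝔼 → ℤ
    φ (a +ω b) = a + b * w

    φ-⊗ : ∀ α β → φ (α ⊗ β) ≡ φ α * φ β ⟨mod q ⟩
    φ-⊗ (a +ω b) (c +ω d) = mod-sym (mod-trans (≡⇒mod (identity a b c d w))
      (mod-trans (mod-+ˡ (φ ((a +ω b) ⊗ (c +ω d))) (mod-*ˡ (b * d) w-root))
      (≡⇒mod (trans (cong (λ z → φ ((a +ω b) ⊗ (c +ω d)) + z) (ℤ.*-zeroʳ (b * d))) (ℤ.+-identityʳ _)))))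
      where
      identity : ∀ a b c d w → (a + b * w) * (c + d * w)
        ≡ (a * c - b * d) + (a * d + b * c - b * d) * w + b * d * (w * w + w + 1ℤ)
      identity = solve-∀

    private
      fact : ∀ a → ¬ (a ≡ 0ℤ ⟨mod q ⟩) → ∀ {x y} → x - y ≡ a → ¬ (x ≡ y ⟨mod q ⟩)
      fact a a≢0 e x≡y = a≢0 (mod-trans (≡⇒mod (sym e)) (mod-difference x≡y))

    -- The classes of 0, 1, w, w² modulo q are distinct. Identities between character values
    -- therefore follow from the corresponding identities between powers t^k.
    value-injective : ∀ {α β} → Value α → Value β → φ α ≡ φ β ⟨mod q ⟩ → α ≡ β
    value-injective v0  v0  _ = refl
    value-injective v1  v1  _ = refl
    value-injective vω  vω  _ = refl
    value-injective vω² vω² _ = refl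
    value-injective v1  v0  e = contradiction e (fact 1ℤ 1≢0 refl)
    value-injective vω  v0  e = contradiction e (fact w w≢0 (identity w))
      where
      identity : ∀ w → 0ℤ + 1ℤ * w - 0ℤ ≡ w
      identity = solve-∀
    value-injective vω² v0  e = contradiction e (fact (- (1ℤ + w)) 1+w≢0 (identity w))
      where
      identity : ∀ w → -1ℤ + -1ℤ * w - 0ℤ ≡ - (1ℤ + w)
      identity = solve-∀
      identity′ : ∀ w → w * w ≡ w * w + w + 1ℤ + - (1ℤ + w)
      identity′ = solve-∀
      1+w≢0 : ¬ (- (1ℤ + w) ≡ 0ℤ ⟨mod q ⟩)
      1+w≢0 z = *-nonzero w≢0 w≢0 (mod-trans (≡⇒mod (identity′ w)) (mod-+ w-root z))
    value-injective vω  v1  e = contradiction (mod-trans (≡⇒mod (identity w)) e) w≢1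
      where
      identity : ∀ w → w ≡ 0ℤ + 1ℤ * w
      identity = solve-∀
    value-injective vω² v1  e = contradiction
        (mod-trans (mod-sym (mod-trans (≡⇒mod (identity w)) (mod-trans (mod-*ˡ w e) (≡⇒mod (ℤ.*-identityʳ w)))))
          (mod-sub 1ℤ w-root)) w≢1
      where
      identity : ∀ w → 1ℤ - (w * w + w + 1ℤ) ≡ w * (-1ℤ + -1ℤ * w)
      identity = solve-∀
    value-injective vω  vω² e = contradiction (mod-trans (≡⇒mod (sym (ℤ.*-identityʳ w)))
        (mod-trans (mod-*ˡ w (mod-sym w²≡1)) (mod-trans (≡⇒mod (identity₂ w)) w³≡1))) w≢1
      where
      identity₁ : ∀ w → w * (-1ℤ + -1ℤ * w) ≡ 1ℤ - (w * w + w + 1ℤ)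
      identity₁ = solve-∀
      identity₂ : ∀ w → w * (w * (0ℤ + 1ℤ * w)) ≡ w * (w * (w * 1ℤ))
      identity₂ = solve-∀
      w²≡1 : w * (0ℤ + 1ℤ * w) ≡ 1ℤ ⟨mod q ⟩
      w²≡1 = mod-trans (mod-*ˡ w e) (mod-trans (≡⇒mod (identity₁ w)) (mod-sub 1ℤ w-root))
    value-injective v0  v1  e = sym (value-injective v1 v0 (mod-sym e))
    value-injective v0  vω  e = sym (value-injective vω v0 (mod-sym e))
    value-injective v0  vω² e = sym (value-injective vω² v0 (mod-sym e))
    value-injective v1  vω  e = sym (value-injective vω v1 (mod-sym e))
    value-injective v1  vω² e = sym (value-injective vω² v1 (mod-sym e))
    value-injective vω² vω  e = sym (value-injective vω vω² (mod-sym e))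

    select : ∀ {A B C : Set} → Dec A → Dec B → Dec C → 𝔼
    select (yes _) _       _       = ι 0ℤ
    select (no _)  (yes _) _       = ι 1ℤ
    select (no _)  (no _)  (yes _) = ω
    select (no _)  (no _)  (no _)  = ω²

    select-value : ∀ {A B C : Set} (a : Dec A) (b : Dec B) (c : Dec C) → Value (select a b c)
    select-value (yes _) _       _       = v0
    select-value (no _)  (yes _) _       = v1
    select-value (no _)  (no _)  (yes _) = vω
    select-value (no _)  (no _)  (no _)  = vω²

    -- Euler's criterion as a definition: the value with image t^k under `φ`, where k = (q - 1) / 3.
    -- The last branch of `select` stands for t^k ≡ w².
    χ : ℤ → 𝔼
    χ t = select (mod? t 0ℤ) (mod? (t ^ k) 1ℤ) (mod? (t ^ k) w)

    χ-value : ∀ t → Value (χ t)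
    χ-value t = select-value (mod? t 0ℤ) (mod? (t ^ k) 1ℤ) (mod? (t ^ k) w)

    0^k≡0 : ∀ {t} → t ≡ 0ℤ ⟨mod q ⟩ → t ^ k ≡ 0ℤ ⟨mod q ⟩
    0^k≡0 e = mod-trans (mod-^ k e) (≡⇒mod (zero-^ k {{ℕ.>-nonZero 0<k}}))

    φ-select : ∀ x {A : Set} (a : Dec A) (b : Dec (x ≡ 1ℤ ⟨mod q ⟩)) (c : Dec (x ≡ w ⟨mod q ⟩)) →
      (A → x ≡ 0ℤ ⟨mod q ⟩) → (¬ A → x ^ 3 ≡ 1ℤ ⟨mod q ⟩) → φ (select a b c) ≡ x ⟨mod q ⟩
    φ-select x (yes a) _       _       zeros _ = mod-sym (zeros a)
    φ-select x (no _)  (yes e) _       _ _ = mod-sym e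
    φ-select x (no _)  (no _)  (yes e) _ _ = mod-trans (≡⇒mod (identity w)) (mod-sym e)
      where
      identity : ∀ w → 0ℤ + 1ℤ * w ≡ w
      identity = solve-∀
    φ-select x (no ¬a) (no ≢1) (no ≢w) _ cube = [ (λ e → contradiction e ≢1) ,
      [ (λ e → contradiction e ≢w) , mod-sym ]′ ]′ (cube-roots x (cube ¬a))

    φ-χ : ∀ t → φ (χ t) ≡ t ^ k ⟨mod q ⟩
    φ-χ t = φ-select (t ^ k) (mod? t 0ℤ) (mod? (t ^ k) 1ℤ) (mod? (t ^ k) w) 0^k≡0
      (λ t≢0 → mod-trans (≡⇒mod (ℤ.^-*-assoc t k 3)) (fermat-unit t t≢0))

    χ-periodic : ∀ {s t} → s ≡ t ⟨mod q ⟩ → χ s ≡ χ t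
    χ-periodic {s} {t} e = value-injective (χ-value s) (χ-value t)
      (mod-trans (φ-χ s) (mod-trans (mod-^ k e) (mod-sym (φ-χ t))))

    χ-⊗ : ∀ s t → χ (s * t) ≡ χ s ⊗ χ t
    χ-⊗ s t = value-injective (χ-value (s * t)) (value-⊗ (χ-value s) (χ-value t))
      (mod-trans (φ-χ (s * t)) (mod-trans (≡⇒mod (*-^ s t k))
        (mod-trans (mod-* (mod-sym (φ-χ s)) (mod-sym (φ-χ t))) (mod-sym (φ-⊗ (χ s) (χ t))))))

    χ-1 : χ 1ℤ ≡ ι 1ℤ
    χ-1 = value-injective (χ-value 1ℤ) v1 (mod-trans (φ-χ 1ℤ) (≡⇒mod (ℤ.^-zeroˡ k)))

    χ-0 : χ 0ℤ ≡ ι 0ℤ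
    χ-0 = value-injective (χ-value 0ℤ) v0 (mod-trans (φ-χ 0ℤ) (0^k≡0 mod-refl))

    χ≢0 : ∀ {t} → ¬ (t ≡ 0ℤ ⟨mod q ⟩) → χ t ≢ ι 0ℤ
    χ≢0 {t} t≢0 e = ^-nonzero k t≢0 (mod-trans (mod-sym (φ-χ t)) (≡⇒mod (cong φ e)))

    open import Algebra.Properties.CommutativeMonoid.Sum ℤ.+-0-commutativeMonoid using () renaming (sum to sumℤ)
    open import Algebra.Properties.CommutativeMonoid.Sum (CommutativeRing.+-commutativeMonoid 𝔼-ring) using ()
      renaming (sum to sum𝔼)

    φ-sum : ∀ {n} (f : Fin n → 𝔼) (g : Fin n → ℤ) → (∀ i → φ (f i) ≡ g i ⟨mod q ⟩) → φ (sum𝔼 f) ≡ sumℤ g ⟨mod q ⟩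
    φ-sum {zero} f g e = mod-refl
    φ-sum {suc n} f g e = mod-trans (≡⇒mod (identity (f Fin.zero) (sum𝔼 (λ i → f (Fin.suc i)))))
      (mod-+ (e Fin.zero) (φ-sum (λ i → f (Fin.suc i)) (λ i → g (Fin.suc i)) (λ i → e (Fin.suc i))))
      where
      identity : ∀ α β → φ (α ⊕ β) ≡ φ α + φ β
      identity (a +ω b) (c +ω d) = identity′ a b c d w
        where
        identity′ : ∀ a b c d w → a + c + (b + d) * w ≡ a + b * w + (c + d * w)
        identity′ = solve-∀

    sum-conj : ∀ {n} (f : Fin n → 𝔼) → conj (sum𝔼 f) ≡ sum𝔼 (λ i → conj (f i))
    sum-conj {zero} f = refl
    sum-conj {suc n} f = trans (conj-⊕ (f Fin.zero) _) (cong (conj (f Fin.zero) ⊕_) (sum-conj (λ i → f (Fin.suc i))))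

    sum-1 : ∀ n → sum𝔼 {n} (λ _ → ι 1ℤ) ≡ ι (+ n)
    sum-1 zero = refl
    sum-1 (suc n) = cong (ι 1ℤ ⊕_) (sum-1 n)

    sum-mod-1 : ∀ {n} (f : Fin n → ℤ) → (∀ i → f i ≡ 1ℤ ⟨mod q ⟩) → sumℤ f ≡ + n ⟨mod q ⟩
    sum-mod-1 {zero} f e = mod-refl
    sum-mod-1 {suc n} f e = mod-+ (e Fin.zero) (sum-mod-1 (λ i → f (Fin.suc i)) (λ i → e (Fin.suc i)))

    private
      1+k<q : suc k < q
      1+k<q = s≤s (ℕ.<-≤-trans (ℕ.m<m*n k 3 {{ℕ.>-nonZero 0<k}} (s≤s (s≤s z≤n))) ℕ.≤-refl)

      power : ℕ → ℤ
      power n = (+ n) ^ k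

      power-total : partialSum power q ≡ 0ℤ ⟨mod q ⟩
      power-total = power-sum q-prime (suc k) power (degree-power k) 1+k<q

      -- The powers t^k add up to 0 modulo q, since k is small against q. If all of them with t ≠ 0
      -- were 1, their sum would be q - 1.
      all-cubes-impossible : ¬ (∀ (i : Fin (k ℕ.* 3)) → χ (+ suc (toℕ i)) ≡ ι 1ℤ)
      all-cubes-impossible cubes = 1≢0 (mod-trans (mod-+ˡ 1ℤ count≡0) (∣⇒≡0 {a = + q} (ℕ.∣-refl {q})))
        where
        terms : ∀ i → power (suc (toℕ i)) ≡ 1ℤ ⟨mod q ⟩
        terms i = mod-trans (mod-sym (φ-χ (+ suc (toℕ i)))) (≡⇒mod {a = φ (χ (+ suc (toℕ i)))} (cong φ (cubes i)))
        nonzero-terms : sumℤ {k ℕ.* 3} (λ i → power (suc (toℕ i))) ≡ + (k ℕ.* 3) ⟨mod q ⟩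
        nonzero-terms = sum-mod-1 {k ℕ.* 3} (λ i → power (suc (toℕ i))) terms
        count≡0 : 0ℤ ≡ + (k ℕ.* 3) ⟨mod q ⟩
        count≡0 = mod-trans (mod-sym power-total) (mod-trans (mod-+ (0^k≡0 {0ℤ} mod-refl) nonzero-terms)
          (≡⇒mod (ℤ.+-identityˡ (+ (k ℕ.* 3)))))

    noncube : ∃ λ u → ¬ (u ≡ 0ℤ ⟨mod q ⟩) × χ u ≢ ι 1ℤ
    noncube = + suc (toℕ (proj₁ search)) , (λ e → contradiction (≡0⇒∣ e) (ℕ.>⇒∤ (s≤s (Fin.toℕ<n (proj₁ search))))) , proj₂ search
      where
      search : ∃ λ (i : Fin (k ℕ.* 3)) → χ (+ suc (toℕ i)) ≢ ι 1ℤ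
      search = Fin.¬∀⟶∃¬ (k ℕ.* 3) (λ i → χ (+ suc (toℕ i)) ≡ ι 1ℤ)
        (λ i → value-1? (χ-value (+ suc (toℕ i)))) all-cubes-impossible

-- The Jacobi sum in ℤ[ω]: its norm and the prime ideal containing it

module JacobiSums where

  open import Algebra.Bundles using (CommutativeRing)
  open import Data.Fin using (toℕ)
  open import Data.Integer using (ℤ; +_; _+_; _-_; _*_; -_; _^_; 0ℤ; 1ℤ; ∣_∣)
  import Data.Integer.Properties as ℤ
  open import Data.Nat as ℕ using (ℕ; suc; _<_; s≤s)
  import Data.Nat.Divisibility as ℕ
  open import Data.Nat.Primality using (Prime)
  import Data.Nat.Properties as ℕ
  open import Data.Product using (_,_; proj₁; proj₂)
  open import Data.Sum using ([_,_]′)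
  open import Relation.Binary.PropositionalEquality hiding (J)
  open import Relation.Nullary using (contradiction; ¬_)
  open EisensteinIntegers
  open GroupRings
  open GaussSums
  open PrimeFields
  open ResidueCharacters

  open CommutativeRing 𝔼-ring public using () renaming
    (commutativeSemiring to 𝔼-semiring; *-commutativeSemigroup to ⊗-semigroup)
  open import Algebra.Properties.CommutativeSemiring.Exp 𝔼-semiring public using ()
    renaming (_^_ to _↑_; ^-distrib-* to ↑-distrib-⊗; ^-homo-* to ↑-homo-⊗; ^-assocʳ to ↑-assocʳ)

  ι-cancel : ∀ {c α} → c ≢ 0ℤ → ι c ⊗ α ≡ ι 0ℤ → α ≡ ι 0ℤ
  ι-cancel {c} {a +ω b} c≢0 e = cong₂ _+ω_
    (part (trans (sym (cong re (ι-⊗ c a b))) (cong re e))) (part (trans (sym (cong im (ι-⊗ c a b))) (cong im e)))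
    where
    part : ∀ {d} → c * d ≡ 0ℤ → d ≡ 0ℤ
    part cd≡0 = [ (λ c≡0 → contradiction c≡0 c≢0) , (λ d≡0 → d≡0) ]′ (ℤ.i*j≡0⇒i≡0∨j≡0 c cd≡0)

  module JacobiSum (k : ℕ) (0<k : 0 < k) (q-prime : Prime (suc (k ℕ.* 3))) (w : ℤ)
    (w-root : w * w + w + 1ℤ ≡ 0ℤ ⟨mod suc (k ℕ.* 3) ⟩) (3≢0 : ¬ (+ 3 ≡ 0ℤ ⟨mod suc (k ℕ.* 3) ⟩)) where

    private
      q : ℕ
      q = suc (k ℕ.* 3)

    open PrimeModulus q-prime
    open ResidueCharacter k 0<k q-prime w w-root 3≢0 public
    open 𝔾 using (∑; rep; Q; CubicCharacter)

    private
      u : ℤ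
      u = proj₁ noncube

      scaled : ∀ f → 𝔾.Periodic f → (∀ t → f (u * t) ≡ f u ⊗ f t) → f u ⊗ ∑ f ≡ ∑ f
      scaled f f-periodic f-⊗ = trans (sym (𝔾.∑-*ˡ (f u) f)) (trans (𝔾.∑-cong (λ t → sym (f-⊗ t)))
        (sym (𝔾.∑-scale {f} f-periodic u (proj₁ u⁻¹) (proj₂ u⁻¹))))
        where
        u⁻¹ = inverse u (proj₁ (proj₂ noncube))

      χu≢0 : χ u ≢ ι 0ℤ
      χu≢0 = χ≢0 (proj₁ (proj₂ noncube))

      χu≢1 : χ u ≢ ι 1ℤ
      χu≢1 = proj₂ (proj₂ noncube)

      ⊗-interchange : ∀ α β γ δ → (α ⊗ β) ⊗ (γ ⊗ δ) ≡ (α ⊗ γ) ⊗ (β ⊗ δ)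
      ⊗-interchange = 𝔾.interchange

    ∑χ≡0 : ∑ χ ≡ ι 0ℤ
    ∑χ≡0 = fixed-by-value (χ-value u) χu≢0 χu≢1 (scaled χ χ-periodic (χ-⊗ u))

    χ² : ℤ → 𝔼
    χ² t = χ t ⊗ χ t

    χu³≡1 : χ u ⊗ χ² u ≡ ι 1ℤ
    χu³≡1 = value-cube (χ-value u) χu≢0

    ∑χ²≡0 : ∑ χ² ≡ ι 0ℤ
    ∑χ²≡0 = fixed-by-value (value-⊗ (χ-value u) (χ-value u))
      (λ e → case-0 (trans (sym χu³≡1) (trans (cong (χ u ⊗_) e) (trans (⊗-comm (χ u) (ι 0ℤ)) (0-⊗ (χ u))))))
      (λ e → χu≢1 (trans (sym (trans (⊗-comm (χ u) (ι 1ℤ)) (⊗-identityˡ (χ u)))) (trans (cong (χ u ⊗_) (sym e)) χu³≡1)))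
      (scaled χ² (λ e → cong₂ _⊗_ (χ-periodic e) (χ-periodic e))
        (λ t → trans (cong₂ _⊗_ (χ-⊗ u t) (χ-⊗ u t)) (⊗-interchange (χ u) (χ t) (χ u) (χ t))))
      where
      case-0 : ι 1ℤ ≢ ι 0ℤ
      case-0 ()
      0-⊗ : ∀ α → ι 0ℤ ⊗ α ≡ ι 0ℤ
      0-⊗ = 𝔾.·-zeroˡ

    character : CubicCharacter
    character = record
      { χ = χ ; χ-periodic = χ-periodic ; χ-* = χ-⊗ ; χ-0 = χ-0 ; χ-1 = χ-1
      ; χ-cube = λ {t} t≢0 → value-cube (χ-value t) (χ≢0 t≢0)
      ; ∑χ≈0 = ∑χ≡0 ; ∑χχ≈0 = ∑χ²≡0 }

    opaque
      unfolding 𝔾.∑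

      Q≡q : Q ≡ ι (+ q)
      Q≡q = sum-1 q

      ∑-conj : ∀ f → conj (∑ f) ≡ ∑ (λ t → conj (f t))
      ∑-conj f = sum-conj {q} (λ i → f (rep i))

      φ-∑ : ∀ f (g : ℕ → ℤ) → (∀ n → φ (f (+ n)) ≡ g n ⟨mod q ⟩) → φ (∑ f) ≡ partialSum g q ⟨mod q ⟩
      φ-∑ f g e = φ-sum {q} (λ i → f (rep i)) (λ i → g (toℕ i)) (λ i → e (toℕ i))

    3k≢0 : + (k ℕ.* 3) ≢ 0ℤ
    3k≢0 e = ℕ.<⇒≢ (ℕ.≤-trans 0<k (ℕ.m≤m*n k 3)) (sym (cong ∣_∣ e))

    Q-1-cancel : ∀ {α} → (Q ⊕ ⊖ ι 1ℤ) ⊗ α ≡ ι 0ℤ → α ≡ ι 0ℤ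
    Q-1-cancel {α} e = ι-cancel 3k≢0 (trans (cong (λ Q → (Q ⊕ ⊖ ι 1ℤ) ⊗ α) (sym Q≡q)) e)

    open 𝔾.Character character public using (J; gauss; gauss²)
    open 𝔾.Relations character Q-1-cancel public using (J²; J·J²≈Q; gauss^3; gauss^[1+3e]; gauss^[2+3e])

    -- On 0 and the cube roots of unity, squaring agrees with conjugation.
    J²≡conj : J² ≡ conj J
    J²≡conj = trans (𝔾.∑-cong (λ t → trans (cong₂ _⊗_ (sym (value-conj (χ-value t))) (sym (value-conj (χ-value (1ℤ - t)))))
      (sym (conj-⊗ (χ t) (χ (1ℤ - t)))))) (sym (∑-conj (λ t → χ t ⊗ χ (1ℤ - t))))

    J⊗conj : J ⊗ conj J ≡ ι (+ q)
    J⊗conj = trans (cong (J ⊗_) (sym J²≡conj)) (trans J·J²≈Q Q≡q)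

    norm-J : norm J ≡ + q
    norm-J = cong re (trans (sym (⊗-conj J)) J⊗conj)

    -- Under `φ` the Jacobi sum becomes the sum of t^k (1 - t)^k, a polynomial of degree 2 k < q -
    -- 1, over all residues. This decides which of the two primes above q contains `J`: the one
    -- given by w.
    φ-J : φ J ≡ 0ℤ ⟨mod q ⟩
    φ-J = mod-trans (φ-∑ (λ t → χ t ⊗ χ (1ℤ - t)) (λ n → (+ n) ^ k * (1ℤ - + n) ^ k)
        (λ n → mod-trans (φ-⊗ (χ (+ n)) (χ (1ℤ - + n))) (mod-* (φ-χ (+ n)) (φ-χ (1ℤ - + n)))))
      (power-sum q-prime (k ℕ.+ suc k) _ (degree-jacobi k k) bound)
      where
      bound : k ℕ.+ suc k < q
      bound = s≤s (ℕ.≤-trans (ℕ.+-monoʳ-≤ k (ℕ.≤-trans (ℕ.+-monoˡ-≤ k 0<k) (ℕ.+-monoʳ-≤ k (ℕ.m≤m+n k 0))))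
        (ℕ.≤-reflexive (ℕ.*-comm 3 k)))

-- Reciprocity between a rational prime l and a Jacobi sum

module CubicSymbols where

  open import Algebra.Bundles using (CommutativeRing)
  open import Data.Integer using (ℤ; +_; _+_; _-_; _*_; -_; _^_; 0ℤ; 1ℤ; ∣_∣)
  import Data.Integer.Properties as ℤ
  open import Data.Fin using (Fin)
  open import Data.Nat as ℕ using (ℕ; zero; suc; _<_)
  import Data.Nat.Divisibility as ℕ
  open import Data.Nat.Primality using (Prime; prime?; prime⇒nonTrivial; prime⇒irreducible)
  import Data.Nat.Properties as ℕ
  open import Data.Product using (_,_; proj₁; proj₂)
  open import Data.Sum using (inj₁; inj₂)
  open import Relation.Binary.PropositionalEquality hiding (J)
  open import Relation.Nullary using (yes; no; contradiction; ¬_)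
  open import Relation.Nullary.Decidable using (from-yes)
  open EisensteinIntegers
  open GroupRings
  open GaussSums
  open PrimeFields
  open ResidueCharacters
  open JacobiSums

  module Mod (l : ℕ) where
    open CommutativeRing (𝔼/ l) public using ()
      renaming (refl to ≈-refl; sym to ≈-sym; trans to ≈-trans; *-cong to ⊗-cong; *-congˡ to ⊗-congˡ; *-congʳ to ⊗-congʳ;
        +-cong to ⊕-cong; setoid to ≈-setoid)

    ↑-cong : ∀ {α β} n → α ≈ β ⟨mod l ⟩ → α ↑ n ≈ β ↑ n ⟨mod l ⟩
    ↑-cong zero e = ≈-refl
    ↑-cong (suc n) e = ⊗-cong e (↑-cong n e)

    open import Algebra.Properties.Semiring.Mult (CommutativeRing.semiring (𝔼/ l)) using () renaming (_×_ to _×ₗ_)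

    multiple : ∀ n a b → n ×ₗ (a +ω b) ≡ (+ n * a +ω + n * b)
    multiple zero a b = sym (cong₂ _+ω_ (ℤ.*-zeroˡ a) (ℤ.*-zeroˡ b))
    multiple (suc n) a b = trans (cong ((a +ω b) ⊕_) (multiple n a b))
      (sym (cong₂ _+ω_ (ℤ.suc-* (+ n) a) (ℤ.suc-* (+ n) b)))

    characteristic : ∀ α → l ×ₗ α ≈ ι 0ℤ ⟨mod l ⟩
    characteristic (a +ω b) = ≈-trans (≡⇒≈ (multiple l a b)) (vanish a ,ω vanish b)
      where
      vanish : ∀ a → + l * a ≡ 0ℤ ⟨mod l ⟩
      vanish a = modulo a (trans (ℤ.*-comm (+ l) a) (sym (ℤ.+-identityˡ (a * + l))))

  conj-↑ : ∀ α n → conj (α ↑ n) ≡ conj α ↑ n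
  conj-↑ α zero = refl
  conj-↑ α (suc n) = trans (conj-⊗ α (α ↑ n)) (cong (conj α ⊗_) (conj-↑ α n))

  ι-^ : ∀ c n → ι c ↑ n ≡ ι (c ^ n)
  ι-^ c zero = refl
  ι-^ c (suc n) = trans (cong (ι c ⊗_) (ι-^ c n)) (sym (ι-* c (c ^ n)))

  conj-ι : ∀ c → conj (ι c) ≡ ι c
  conj-ι c = cong₂ _+ω_ (ℤ.+-identityʳ c) refl

  1-↑ : ∀ n → ι 1ℤ ↑ n ≡ ι 1ℤ
  1-↑ zero = refl
  1-↑ (suc n) = trans (⊗-identityˡ _) (1-↑ n)

  ⊗-identityʳ : ∀ α → α ⊗ ι 1ℤ ≡ α
  ⊗-identityʳ α = trans (⊗-comm α (ι 1ℤ)) (⊗-identityˡ α)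

  3-prime : Prime 3
  3-prime = from-yes (prime? 3)

  module PrimeMod {l : ℕ} (l-prime : Prime l) where
    open PrimeModulus l-prime
    open Mod l

    ι-cancel-mod : ∀ {c α β} → ¬ (c ≡ 0ℤ ⟨mod l ⟩) → ι c ⊗ α ≈ ι c ⊗ β ⟨mod l ⟩ → α ≈ β ⟨mod l ⟩
    ι-cancel-mod {c} {a +ω b} {a′ +ω b′} c≢0 e with ≈-trans (≡⇒≈ (sym (ι-⊗ c a b))) (≈-trans e (≡⇒≈ (ι-⊗ c a′ b′)))
    ... | r ,ω i = cancelˡ c c≢0 r ,ω cancelˡ c c≢0 i

    -- Conjugation turns c P Y ≡ 1 into c conj(P) Y² ≡ 1 with the same rational c. Cancelling c
    -- gives P Y ≡ conj(P) Y², and multiplication by Y² finishes.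
    unit-ratio : ∀ {c P Y} → ¬ (c ≡ 0ℤ ⟨mod l ⟩) → conj Y ≡ Y ⊗ Y → Y ⊗ (Y ⊗ Y) ≡ ι 1ℤ →
      ι c ⊗ (P ⊗ Y) ≈ ι 1ℤ ⟨mod l ⟩ → P ≈ Y ⊗ conj P ⟨mod l ⟩
    unit-ratio {c} {P} {Y} c≢0 Ȳ Y³ e = begin
      P                            ≡⟨ ⊗-identityʳ P ⟨
      P ⊗ ι 1ℤ                     ≡⟨ cong (P ⊗_) Y³ ⟨
      P ⊗ (Y ⊗ (Y ⊗ Y))            ≡⟨ ⊗-assoc P Y (Y ⊗ Y) ⟨
      (P ⊗ Y) ⊗ (Y ⊗ Y)            ≈⟨ ⊗-congʳ {Y ⊗ Y} (ι-cancel-mod c≢0 (≈-trans e (≈-sym ē))) ⟩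
      (conj P ⊗ (Y ⊗ Y)) ⊗ (Y ⊗ Y) ≡⟨ ⊗-assoc (conj P) (Y ⊗ Y) (Y ⊗ Y) ⟩
      conj P ⊗ ((Y ⊗ Y) ⊗ (Y ⊗ Y)) ≡⟨ cong (conj P ⊗_) (trans (⊗-assoc Y Y (Y ⊗ Y)) (trans (cong (Y ⊗_) Y³) (⊗-identityʳ Y))) ⟩
      conj P ⊗ Y                   ≡⟨ ⊗-comm (conj P) Y ⟩
      Y ⊗ conj P ∎
      where
      open import Relation.Binary.Reasoning.Setoid ≈-setoid
      ē : ι c ⊗ (conj P ⊗ (Y ⊗ Y)) ≈ ι 1ℤ ⟨mod l ⟩
      ē = ≈-trans (≡⇒≈ (sym (trans (conj-⊗ (ι c) (P ⊗ Y))
        (cong₂ _⊗_ (conj-ι c) (trans (conj-⊗ P Y) (cong (conj P ⊗_) Ȳ)))))) (conj-cong e)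

  -- X represents the cubic residue symbol t ↦ (t / β)₃, and the last two fields are the
  -- reciprocity law (l / β)₃ = (β / l)₃, where (β / l)₃ is computed in ℤ[ω]/l.
  record Symbol (β : 𝔼) : Set where
    field
      X          : ℤ → 𝔼
      X-value    : ∀ t → Value (X t)
      X-⊗        : ∀ s t → X (s * t) ≡ X s ⊗ X t
      X-1        : X 1ℤ ≡ ι 1ℤ
      X-periodic : ∀ {s t} → s ≡ t ⟨mod ∣ norm β ∣ ⟩ → X s ≡ X t
      split      : ∀ {l} → Prime l → ¬ (norm β ≡ 0ℤ ⟨mod l ⟩) → ∀ e → l ≡ 1 ℕ.+ e ℕ.* 3 →
                   β ↑ e ≈ X (+ l) ⊗ conj β ↑ e ⟨mod l ⟩
      inert      : ∀ {l} → Prime l → ¬ (norm β ≡ 0ℤ ⟨mod l ⟩) → ∀ e → l ≡ 2 ℕ.+ e ℕ.* 3 →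
                   β ↑ suc e ≈ (X (+ l) ⊗ X (+ l)) ⊗ conj β ↑ suc e ⟨mod l ⟩

  module JacobiSymbol (k : ℕ) (0<k : 0 < k) (q-prime : Prime (suc (k ℕ.* 3))) (w : ℤ)
    (w-root : w * w + w + 1ℤ ≡ 0ℤ ⟨mod suc (k ℕ.* 3) ⟩) (3≢0 : ¬ (+ 3 ≡ 0ℤ ⟨mod suc (k ℕ.* 3) ⟩)) where

    private
      q : ℕ
      q = suc (k ℕ.* 3)

    open PrimeModulus q-prime using (inverse)
    open JacobiSum k 0<k q-prime w w-root 3≢0 public
    open 𝔾 using (∑; rep; mod?; Q; indicator; coeff; at) renaming (_^_ to _^ᴳ_)

    module Reduction {l : ℕ} (l-prime : Prime l) where
      module 𝔾ₗ = GroupRing (𝔼/ l) q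
      open Mod l

      gaussₗ : 𝔾ₗ.Element
      gaussₗ = 𝔾ₗ.element χ (λ e → ≡⇒≈ (χ-periodic e))

      open import Algebra.Properties.CommutativeMonoid.Sum (CommutativeRing.+-commutativeMonoid (𝔼/ l)) using () renaming (sum to sumₗ)
      open import Algebra.Properties.CommutativeMonoid.Sum (CommutativeRing.+-commutativeMonoid 𝔼-ring) using () renaming (sum to sum𝔼)
      open import Algebra.Properties.Semiring.Exp (CommutativeRing.semiring (𝔼/ l)) using () renaming (_^_ to _↑ₗ_)

      sum-agree : ∀ {n} (f g : Fin n → 𝔼) → (∀ i → f i ≡ g i) → sumₗ f ≡ sum𝔼 g
      sum-agree {zero} f g e = refl
      sum-agree {suc n} f g e = cong₂ _⊕_ (e Fin.zero) (sum-agree (λ i → f (Fin.suc i)) (λ i → g (Fin.suc i)) (λ i → e (Fin.suc i)))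

      opaque
        unfolding 𝔾.∑

        ∑-agree : ∀ f g → (∀ t → f t ≡ g t) → 𝔾ₗ.∑ f ≡ ∑ g
        ∑-agree f g e = sum-agree {q} (λ i → f (rep i)) (λ i → g (rep i)) (λ i → e (rep i))

      opaque
        unfolding 𝔾.indicator

        indicator-agree : ∀ s t → 𝔾ₗ.indicator s t ≡ indicator s t
        indicator-agree s t with mod? t s
        ... | yes _ = refl
        ... | no _  = refl

      -- ℤ[ω] and ℤ[ω]/l have the same operations and differ only in their equality, so the powers
      -- over both rings have literally equal coefficients. This carries the exact formulas for
      -- powers of the Gauss sum over to characteristic l.
      power-agree : ∀ n t → 𝔾ₗ.coeff (gaussₗ 𝔾ₗ.^ n) t ≡ coeff (gauss ^ᴳ n) t
      power-agree zero t = indicator-agree 0ℤ t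
      power-agree (suc n) t = ∑-agree _ _ (λ s → cong (χ s ⊗_) (power-agree n (t - s)))

      frobenius-gauss : ¬ (+ l ≡ 0ℤ ⟨mod q ⟩) → coeff (gauss ^ᴳ l) (+ l) ≈ ι 1ℤ ⟨mod l ⟩
      frobenius-gauss l≢0 = ≈-trans (≡⇒≈ (sym (power-agree l (+ l))))
        (≈-trans (𝔾ₗ.frobenius-coeff l-prime characteristic (proj₁ l⁻¹) (proj₂ l⁻¹) gaussₗ)
          (≡⇒≈ (χ1-power l)))
        where
        l⁻¹ = inverse (+ l) l≢0
        χ1-power : ∀ n → χ 1ℤ ↑ₗ n ≡ ι 1ℤ
        χ1-power zero = refl
        χ1-power (suc n) = trans (cong₂ _⊗_ χ-1 (χ1-power n)) (⊗-identityˡ (ι 1ℤ))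

    -- The case l = 3 of the comparison: the coefficient of J (Q - N) at the group element 3, which
    -- is not 0 modulo q, is - J, and Frobenius makes it 1 modulo 3.
    J-primary : J ≈ ⊖ ι 1ℤ ⟨mod 3 ⟩
    J-primary = ≈-trans (≡⇒≈ (double-negation J)) (≈-trans (⊗-congʳ {⊖ ι 1ℤ} J⊗-1) (≡⇒≈ refl))
      where
      open Mod 3
      double-negation : ∀ α → α ≡ (α ⊗ ⊖ ι 1ℤ) ⊗ ⊖ ι 1ℤ
      double-negation α = sym (trans (⊗-assoc α (⊖ ι 1ℤ) (⊖ ι 1ℤ)) (⊗-identityʳ α))
      inner : Q ⊗ indicator 0ℤ (+ 3) ⊕ ⊖ ι 1ℤ ≡ ⊖ ι 1ℤ
      inner = trans (cong (λ α → Q ⊗ α ⊕ ⊖ ι 1ℤ) (𝔾.indicator-off 3≢0))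
        (trans (cong (_⊕ ⊖ ι 1ℤ) (𝔾.·-zeroʳ Q)) (⊕-identityˡ (⊖ ι 1ℤ)))
      J⊗-1 : J ⊗ ⊖ ι 1ℤ ≈ ι 1ℤ ⟨mod 3 ⟩
      J⊗-1 = ≈-trans (≡⇒≈ (trans (cong (J ⊗_) (sym inner)) (sym (at gauss^3 (+ 3)))))
        (Reduction.frobenius-gauss 3-prime 3≢0)

    module _ {l : ℕ} (l-prime : Prime l) (q≢0 : ¬ (norm J ≡ 0ℤ ⟨mod l ⟩)) where
      open Mod l
      open PrimeMod l-prime

      private
        l≢0 : ¬ (+ l ≡ 0ℤ ⟨mod q ⟩)
        l≢0 e with prime⇒irreducible l-prime (≡0⇒∣ e)
        ... | inj₁ q≡1 = contradiction q≡1 (ℕ.nonTrivial⇒≢1 {{prime⇒nonTrivial q-prime}})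
        ... | inj₂ q≡l = q≢0 (mod-trans (≡⇒mod norm-J) (∣⇒≡0 {a = + q} (ℕ.∣-reflexive (sym q≡l))))

        q^e≢0 : ∀ e → ¬ ((+ q) ^ e ≡ 0ℤ ⟨mod l ⟩)
        q^e≢0 e = PrimeModulus.^-nonzero l-prime e (λ z → q≢0 (mod-trans (≡⇒mod norm-J) z))

        X = χ (+ l)
        X³ : X ⊗ (X ⊗ X) ≡ ι 1ℤ
        X³ = value-cube (χ-value (+ l)) (χ≢0 l≢0)

        X̄ : conj X ≡ X ⊗ X
        X̄ = value-conj (χ-value (+ l))

        JQ^e : ∀ e → (J ⊗ Q) ↑ e ≡ J ↑ e ⊗ ι ((+ q) ^ e)
        JQ^e e = trans (cong (λ α → (J ⊗ α) ↑ e) Q≡q) (trans (↑-distrib-⊗ J (ι (+ q)) e) (cong (J ↑ e ⊗_) (ι-^ (+ q) e)))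

      -- At the group element l the l-th power of the Gauss sum has coefficient (J q)^e χ(l) by the
      -- exact formula and 1 by Frobenius; `unit-ratio` disposes of q^e.
      J-split : ∀ e → l ≡ 1 ℕ.+ e ℕ.* 3 → J ↑ e ≈ X ⊗ conj J ↑ e ⟨mod l ⟩
      J-split e l≡ = ≈-trans (unit-ratio {P = J ↑ e} (q^e≢0 e) X̄ X³ relation) (≡⇒≈ (cong (X ⊗_) (conj-↑ J e)))
        where
        C = ι ((+ q) ^ e)
        relation : C ⊗ (J ↑ e ⊗ X) ≈ ι 1ℤ ⟨mod l ⟩
        relation = ≈-trans (≡⇒≈ (trans (sym (⊗-assoc C (J ↑ e) X))
            (trans (cong (_⊗ X) (trans (⊗-comm C (J ↑ e)) (sym (JQ^e e))))
            (trans (sym (at (gauss^[1+3e] e) (+ l))) (cong (λ n → coeff (gauss ^ᴳ n) (+ l)) (sym l≡))))))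
          (Reduction.frobenius-gauss l-prime l≢0)

      -- For this residue of l the coefficient is (J q)^e J χ(l)², whence the exponent e + 1 and the
      -- squared symbol.
      J-inert : ∀ e → l ≡ 2 ℕ.+ e ℕ.* 3 → J ↑ suc e ≈ (X ⊗ X) ⊗ conj J ↑ suc e ⟨mod l ⟩
      J-inert e l≡ = ≈-trans (unit-ratio {P = J ↑ suc e} (q^e≢0 e) (trans (conj-⊗ X X) (cong₂ _⊗_ X̄ X̄)) X⁶ relation)
          (≡⇒≈ (cong ((X ⊗ X) ⊗_) (conj-↑ J (suc e))))
        where
        C = ι ((+ q) ^ e)
        X⁶ : (X ⊗ X) ⊗ ((X ⊗ X) ⊗ (X ⊗ X)) ≡ ι 1ℤ
        X⁶ = trans (cong ((X ⊗ X) ⊗_) (𝔾.interchange X X X X)) (trans (⊗-assoc X X ((X ⊗ X) ⊗ (X ⊗ X)))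
          (trans (cong (X ⊗_) (sym (⊗-assoc X (X ⊗ X) (X ⊗ X)))) (trans (cong (λ α → X ⊗ (α ⊗ (X ⊗ X))) X³)
          (trans (cong (X ⊗_) (⊗-identityˡ (X ⊗ X))) X³))))
        shuffle : C ⊗ ((J ⊗ J ↑ e) ⊗ (X ⊗ X)) ≡ ((J ↑ e ⊗ C) ⊗ J) ⊗ (X ⊗ X)
        shuffle = trans (sym (⊗-assoc C (J ⊗ J ↑ e) (X ⊗ X))) (cong (_⊗ (X ⊗ X))
          (trans (cong (C ⊗_) (⊗-comm J (J ↑ e))) (trans (sym (⊗-assoc C (J ↑ e) J)) (cong (_⊗ J) (⊗-comm C (J ↑ e))))))
        relation : C ⊗ ((J ⊗ J ↑ e) ⊗ (X ⊗ X)) ≈ ι 1ℤ ⟨mod l ⟩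
        relation = ≈-trans (≡⇒≈ (trans shuffle
            (trans (cong (λ α → (α ⊗ J) ⊗ (X ⊗ X)) (sym (JQ^e e)))
            (trans (sym (at (gauss^[2+3e] e) (+ l))) (cong (λ n → coeff (gauss ^ᴳ n) (+ l)) (sym l≡))))))
          (Reduction.frobenius-gauss l-prime l≢0)

    J-symbol : Symbol J
    J-symbol = record
      { X = χ ; X-value = χ-value ; X-⊗ = χ-⊗ ; X-1 = χ-1
      ; X-periodic = λ {s} {t} e → χ-periodic (subst (λ n → s ≡ t ⟨mod ∣ n ∣ ⟩) norm-J e)
      ; split = J-split ; inert = J-inert }

-- Splitting elements of norm prime to 3 into units, rational integers and Jacobi sums

module Factorisation where

  open import Data.Integer using (ℤ; +_; -[1+_]; _+_; _-_; _*_; -_; 0ℤ; 1ℤ; -1ℤ; ∣_∣)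
  import Data.Integer.Properties as ℤ
  open import Data.Integer.Tactic.RingSolver using (solve-∀)
  open import Data.List using ([]; _∷_)
  open import Data.List.Relation.Unary.All using (_∷_)
  open import Data.Nat as ℕ using (ℕ; zero; suc; _<_; s≤s; z≤n)
  import Data.Nat.Divisibility as ℕ
  open import Data.Nat.ListAction using (product)
  open import Data.Nat.Primality using (Prime; prime⇒nonTrivial; prime⇒nonZero; prime⇒irreducible)
  open import Data.Nat.Primality.Factorisation using (factorise)
  import Data.Nat.Properties as ℕ
  open import Data.Product using (∃; _,_; _×_; proj₁; proj₂)
  open import Data.Sum using (inj₁; inj₂; [_,_]′)
  open import Relation.Binary.PropositionalEquality hiding (J)
  open import Relation.Nullary using (Dec; yes; no; contradiction; ¬_)
  open EisensteinIntegers
  open GroupRings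
  open PrimeFields
  open ResidueCharacters
  open JacobiSums
  open CubicSymbols

  prime-divisor : ∀ n → 1 < n → ∃ λ p → Prime p × p ℕ.∣ n
  prime-divisor n 1<n with factorise n {{ℕ.>-nonZero (ℕ.<-trans (s≤s z≤n) 1<n)}}
  ... | record { factors = [] ; isFactorisation = n≡1 } = contradiction (sym n≡1) (ℕ.<⇒≢ 1<n)
  ... | record { factors = p ∷ ps ; isFactorisation = n≡ ; factorsPrime = p-prime ∷ _ } =
    p , p-prime , ℕ.divides (product ps) (trans n≡ (ℕ.*-comm p (product ps)))

  square-abs : ∀ a → a * a ≡ + (∣ a ∣ ℕ.* ∣ a ∣)
  square-abs (+ n) = sym (ℤ.pos-* n n)
  square-abs -[1+ n ] = refl

  -- Completing the square shows that norms are nonnegative and that the coordinates of a unit are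
  -- at most 1 in absolute value.
  four-norm : ∀ α → + 4 * norm α ≡ + (∣ + 2 * re α - im α ∣ ℕ.* ∣ + 2 * re α - im α ∣ ℕ.+ 3 ℕ.* (∣ im α ∣ ℕ.* ∣ im α ∣))
  four-norm (a +ω b) = trans (identity a b) (trans (cong₂ (λ x y → x + + 3 * y) (square-abs (+ 2 * a - b)) (square-abs b))
    (cong (λ z → + (∣ + 2 * a - b ∣ ℕ.* ∣ + 2 * a - b ∣) + z) (sym (ℤ.pos-* 3 (∣ b ∣ ℕ.* ∣ b ∣)))))
    where
    identity : ∀ a b → + 4 * (a * a - a * b + b * b) ≡ (+ 2 * a - b) * (+ 2 * a - b) + + 3 * (b * b)
    identity = solve-∀

  norm-nonneg : ∀ α → norm α ≡ + ∣ norm α ∣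
  norm-nonneg α = from-quadruple (norm α) (four-norm α)
    where
    from-quadruple : ∀ x {n} → + 4 * x ≡ + n → x ≡ + ∣ x ∣
    from-quadruple (+ n) _ = refl

  unit-bound : ∀ α → ∣ norm α ∣ ≡ 1 → ∣ im α ∣ ℕ.≤ 1
  unit-bound α n≡1 = bound (∣ + 2 * re α - im α ∣ ℕ.* ∣ + 2 * re α - im α ∣) ∣ im α ∣ (ℤ.+-injective (trans (sym (four-norm α))
    (cong (+ 4 *_) (trans (norm-nonneg α) (cong +_ n≡1)))))
    where
    bound : ∀ x y → x ℕ.+ 3 ℕ.* (y ℕ.* y) ≡ 4 → y ℕ.≤ 1
    bound _ 0 _ = z≤n
    bound _ 1 _ = s≤s z≤n
    bound x y@(suc (suc n)) e = contradiction (sym e) (ℕ.<⇒≢ (ℕ.<-≤-trans {4} {3 ℕ.* 4} (s≤s (s≤s (s≤s (s≤s (s≤s z≤n)))))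
      (ℕ.≤-trans (ℕ.*-monoʳ-≤ 3 (ℕ.*-mono-≤ {2} {y} {2} {y} (s≤s (s≤s z≤n)) (s≤s (s≤s z≤n)))) (ℕ.m≤n+m _ x))))

  norm-conj-swap : ∀ a b → norm (b +ω a) ≡ norm (a +ω b)
  norm-conj-swap = identity
    where
    identity : ∀ a b → b * b - b * a + a * a ≡ a * a - a * b + b * b
    identity = solve-∀

  Rational₃ : 𝔼 → Set
  Rational₃ α = ∃ λ r → α ≈ ι r ⟨mod 3 ⟩

  -- Rational integers and Jacobi sums are congruent to rational integers modulo 3. Keeping this
  -- fact makes the exponent of the unit readable from α modulo 3.
  record Factored (α : 𝔼) : Set where
    constructor factored
    field
      {unit}     : ℕ
      {primary}  : 𝔼
      factorises : α ≡ ω ↑ unit ⊗ primary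
      rational₃  : Rational₃ primary
      symbol     : Symbol primary

  -- A rational integer is its own conjugate, so the constant 1 satisfies both laws. It is also the
  -- value at arguments having a common factor with r.
  ι-symbol : ∀ r → Symbol (ι r)
  ι-symbol r = record
    { X = λ _ → ι 1ℤ ; X-value = λ _ → v1 ; X-⊗ = λ _ _ → refl ; X-1 = refl ; X-periodic = λ _ → refl
    ; split = λ _ _ e _ → ≡⇒≈ (self e)
    ; inert = λ _ _ e _ → ≡⇒≈ (self (suc e)) }
    where
    self : ∀ e → ι r ↑ e ≡ ι 1ℤ ⊗ conj (ι r) ↑ e
    self e = sym (trans (⊗-identityˡ _) (cong (_↑ e) (conj-ι r)))

  ⊗-interchange : ∀ α β γ δ → (α ⊗ β) ⊗ (γ ⊗ δ) ≡ (α ⊗ γ) ⊗ (β ⊗ δ)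
  ⊗-interchange = interchange
    where open import Algebra.Properties.CommutativeSemigroup ⊗-semigroup using (interchange)

  ⊗-symbol : ∀ {β γ} → Symbol β → Symbol γ → Symbol (β ⊗ γ)
  ⊗-symbol {β} {γ} S T = record
    { X = λ t → S.X t ⊗ T.X t
    ; X-value = λ t → value-⊗ (S.X-value t) (T.X-value t)
    ; X-⊗ = λ s t → trans (cong₂ _⊗_ (S.X-⊗ s t) (T.X-⊗ s t)) (⊗-interchange (S.X s) (S.X t) (T.X s) (T.X t))
    ; X-1 = trans (cong₂ _⊗_ S.X-1 T.X-1) (⊗-identityˡ (ι 1ℤ))
    ; X-periodic = λ e → cong₂ _⊗_
        (S.X-periodic (mod-weaken (ℕ.divides ∣ norm γ ∣ (trans abs-norm (ℕ.*-comm ∣ norm β ∣ ∣ norm γ ∣))) e))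
        (T.X-periodic (mod-weaken (ℕ.divides ∣ norm β ∣ abs-norm) e))
    ; split = λ {l} l-prime nz e l≡ → combine l (S.X (+ l)) (T.X (+ l)) e
        (S.split l-prime (nzβ nz) e l≡) (T.split l-prime (nzγ nz) e l≡)
    ; inert = λ {l} l-prime nz e l≡ → Mod.≈-trans l (combine l (S.X (+ l) ⊗ S.X (+ l)) (T.X (+ l) ⊗ T.X (+ l)) (suc e)
        (S.inert l-prime (nzβ nz) e l≡) (T.inert l-prime (nzγ nz) e l≡))
        (≡⇒≈ (cong (_⊗ conj (β ⊗ γ) ↑ suc e) (⊗-interchange (S.X (+ l)) (S.X (+ l)) (T.X (+ l)) (T.X (+ l))))) }
    where
    module S = Symbol S
    module T = Symbol T
    abs-norm : ∣ norm (β ⊗ γ) ∣ ≡ ∣ norm β ∣ ℕ.* ∣ norm γ ∣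
    abs-norm = trans (cong ∣_∣ (norm-⊗ β γ)) (ℤ.abs-* (norm β) (norm γ))
    nzβ : ∀ {l} → ¬ (norm (β ⊗ γ) ≡ 0ℤ ⟨mod l ⟩) → ¬ (norm β ≡ 0ℤ ⟨mod l ⟩)
    nzβ nz z = nz (mod-trans (≡⇒mod (norm-⊗ β γ)) (mod-trans (mod-*ʳ (norm γ) z) (≡⇒mod (ℤ.*-zeroˡ (norm γ)))))
    nzγ : ∀ {l} → ¬ (norm (β ⊗ γ) ≡ 0ℤ ⟨mod l ⟩) → ¬ (norm γ ≡ 0ℤ ⟨mod l ⟩)
    nzγ nz z = nz (mod-trans (≡⇒mod (norm-⊗ β γ)) (mod-trans (mod-*ˡ (norm β) z) (≡⇒mod (ℤ.*-zeroʳ (norm β)))))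
    combine : ∀ l X Y e → β ↑ e ≈ X ⊗ conj β ↑ e ⟨mod l ⟩ → γ ↑ e ≈ Y ⊗ conj γ ↑ e ⟨mod l ⟩ →
      (β ⊗ γ) ↑ e ≈ (X ⊗ Y) ⊗ conj (β ⊗ γ) ↑ e ⟨mod l ⟩
    combine l X Y e p r = ≈-trans (≡⇒≈ (↑-distrib-⊗ β γ e)) (≈-trans (⊗-cong p r)
      (≡⇒≈ (trans (⊗-interchange X (conj β ↑ e) Y (conj γ ↑ e))
        (cong ((X ⊗ Y) ⊗_) (trans (sym (↑-distrib-⊗ (conj β) (conj γ) e)) (cong (_↑ e) (sym (conj-⊗ β γ))))))))
      where open Mod l

  ⊗-factored : ∀ {α α′} → Factored α → Factored α′ → Factored (α ⊗ α′)
  ⊗-factored (factored {i} {β} e (r , ρ) S) (factored {j} {γ} e′ (r′ , ρ′) T) = factored {unit = i ℕ.+ j}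
    (trans (cong₂ _⊗_ e e′) (trans (⊗-interchange (ω ↑ i) β (ω ↑ j) γ) (cong (_⊗ (β ⊗ γ)) (sym (↑-homo-⊗ ω i j)))))
    (r * r′ , Mod.≈-trans 3 (Mod.⊗-cong 3 ρ ρ′) (≡⇒≈ (sym (ι-* r r′))))
    (⊗-symbol S T)

  ι-factored : ∀ r → Factored (ι r)
  ι-factored r = factored {unit = 0} (sym (⊗-identityˡ (ι r))) (r , Mod.≈-refl 3) (ι-symbol r)

  associate-factored : ∀ i r → Factored (ω ↑ i ⊗ ι r)
  associate-factored i r = factored {unit = i} refl (r , Mod.≈-refl 3) (ι-symbol r)

  unit-factored : ∀ α → ∣ norm α ∣ ≡ 1 → Factored α
  unit-factored α@(a +ω b) n≡1 = small a b (unit-bound (b +ω a) (trans (cong ∣_∣ (norm-conj-swap a b)) n≡1)) (unit-bound α n≡1) n≡1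
    where
    small : ∀ a b → ∣ a ∣ ℕ.≤ 1 → ∣ b ∣ ℕ.≤ 1 → ∣ norm (a +ω b) ∣ ≡ 1 → Factored (a +ω b)
    small (+ 1)   (+ 0)   _ _ _ = associate-factored 0 1ℤ
    small -[1+ 0 ] (+ 0)   _ _ _ = associate-factored 0 -1ℤ
    small (+ 0)   (+ 1)   _ _ _ = associate-factored 1 1ℤ
    small (+ 0)   -[1+ 0 ] _ _ _ = associate-factored 1 -1ℤ
    small -[1+ 0 ] -[1+ 0 ] _ _ _ = associate-factored 2 1ℤ
    small (+ 1)   (+ 1)   _ _ _ = associate-factored 2 -1ℤ
    small (+ 0)   (+ 0)   _ _ ()
    small (+ 1)   -[1+ 0 ] _ _ ()
    small -[1+ 0 ] (+ 1)   _ _ ()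
    small (+ suc (suc _)) _ (s≤s ()) _ _
    small -[1+ suc _ ] _ (s≤s ()) _ _
    small (+ 0) (+ suc (suc _)) _ (s≤s ()) _
    small (+ 0) -[1+ suc _ ] _ (s≤s ()) _
    small (+ 1) (+ suc (suc _)) _ (s≤s ()) _
    small (+ 1) -[1+ suc _ ] _ (s≤s ()) _
    small -[1+ 0 ] (+ suc (suc _)) _ (s≤s ()) _
    small -[1+ 0 ] -[1+ suc _ ] _ (s≤s ()) _

  module PrimeStep {q : ℕ} (q-prime : Prime q) (3≢0 : ¬ (+ 3 ≡ 0ℤ ⟨mod q ⟩)) where
    open PrimeModulus q-prime

    divide : ∀ {a} → a ≡ 0ℤ ⟨mod q ⟩ → ∃ λ c → a ≡ + q * c
    divide (modulo c e) = c , trans e (trans (ℤ.+-identityˡ (c * + q)) (ℤ.*-comm c (+ q)))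

    divide-𝔼 : ∀ {a b} → a ≡ 0ℤ ⟨mod q ⟩ → b ≡ 0ℤ ⟨mod q ⟩ → ∃ λ γ → a +ω b ≡ ι (+ q) ⊗ γ
    divide-𝔼 a≡0 b≡0 with divide a≡0 | divide b≡0
    ... | c , refl | d , refl = (c +ω d) , sym (ι-⊗ (+ q) c d)

    -- With c the inverse of b, the root is w = - a / b: the norm divided by b² is w² + w + 1, and a
    -- + b w vanishes.
    root-of-divisor : ∀ a b c → b * c ≡ 1ℤ ⟨mod q ⟩ → a * a - a * b + b * b ≡ 0ℤ ⟨mod q ⟩ →
      - (a * c) * - (a * c) + - (a * c) + 1ℤ ≡ 0ℤ ⟨mod q ⟩ × a + b * - (a * c) ≡ 0ℤ ⟨mod q ⟩
    root-of-divisor a b c bc≡1 n≡0 = w-root , a+bw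
      where
      identity₁ : ∀ a b c → (a * a - a * b + b * b) * (c * c)
        ≡ a * c * (a * c) - a * c * (b * c) + (b * c) * (b * c)
      identity₁ = solve-∀
      identity₂ : ∀ x → - x * - x + - x + 1ℤ ≡ x * x - x * 1ℤ + 1ℤ * 1ℤ
      identity₂ = solve-∀
      identity₃ : ∀ a b c → a + b * - (a * c) ≡ a * 1ℤ - a * (b * c)
      identity₃ = solve-∀
      identity₄ : ∀ a → a * 1ℤ - a * 1ℤ ≡ 0ℤ
      identity₄ = solve-∀
      collapse : ∀ x {y z} → y ≡ 1ℤ ⟨mod q ⟩ → z ≡ 1ℤ ⟨mod q ⟩ → x * x - x * y + y * z ≡ x * x - x * 1ℤ + 1ℤ * 1ℤ ⟨mod q ⟩
      collapse x y≡1 z≡1 = mod-+ (mod-sub (x * x) (mod-*ˡ x y≡1)) (mod-* y≡1 z≡1)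
      w-root : - (a * c) * - (a * c) + - (a * c) + 1ℤ ≡ 0ℤ ⟨mod q ⟩
      w-root = mod-trans (≡⇒mod (identity₂ (a * c))) (mod-trans
        (mod-sym (collapse (a * c) bc≡1 bc≡1))
        (mod-trans (≡⇒mod (sym (identity₁ a b c))) (mod-trans (mod-*ʳ (c * c) n≡0) (≡⇒mod (ℤ.*-zeroˡ (c * c))))))
      a+bw : a + b * - (a * c) ≡ 0ℤ ⟨mod q ⟩
      a+bw = mod-trans (≡⇒mod (identity₃ a b c)) (mod-trans (mod-sub (a * 1ℤ) (mod-*ˡ a bc≡1)) (≡⇒mod (identity₄ a)))

    -- The two values differ by y (1 + 2 w), and (1 + 2 w)² ≡ - 3. So q divides 3 y, hence y, hence
    -- x.
    both-zero : ∀ w → w * w + w + 1ℤ ≡ 0ℤ ⟨mod q ⟩ → ∀ x y → x + y * w ≡ 0ℤ ⟨mod q ⟩ → x - y + - y * w ≡ 0ℤ ⟨mod q ⟩ →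
      ∃ λ γ → x +ω y ≡ ι (+ q) ⊗ γ
    both-zero w w-root x y e ē = divide-𝔼 x≡0 y≡0
      where
      identity₁ : ∀ x y w → + 3 * y ≡ (x + y * w - (x - y + - y * w)) * - (1ℤ + + 2 * w) + + 4 * y * (w * w + w + 1ℤ)
      identity₁ = solve-∀
      identity₂ : ∀ x y w → x ≡ (x + y * w) - y * w
      identity₂ = solve-∀
      vanish₁ : ∀ y w → (0ℤ - 0ℤ) * - (1ℤ + + 2 * w) + + 4 * y * 0ℤ ≡ 0ℤ
      vanish₁ = solve-∀
      vanish₂ : ∀ w → 0ℤ - 0ℤ * w ≡ 0ℤ
      vanish₂ = solve-∀
      3y≡0 : + 3 * y ≡ 0ℤ ⟨mod q ⟩
      3y≡0 = mod-trans (≡⇒mod (identity₁ x y w)) (mod-trans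
        (mod-+ (mod-*ʳ (- (1ℤ + + 2 * w)) (mod-+ e (mod-neg ē))) (mod-*ˡ (+ 4 * y) w-root)) (≡⇒mod (vanish₁ y w)))
      y≡0 : y ≡ 0ℤ ⟨mod q ⟩
      y≡0 = [ (λ z → contradiction z 3≢0) , (λ z → z) ]′ (euclid (+ 3) y 3y≡0)
      x≡0 : x ≡ 0ℤ ⟨mod q ⟩
      x≡0 = mod-trans (≡⇒mod (identity₂ x y w)) (mod-trans (mod-+ e (mod-neg (mod-*ʳ w y≡0))) (≡⇒mod (vanish₂ w)))

    rational-factor : ∀ a b → b ≡ 0ℤ ⟨mod q ⟩ → a * a - a * b + b * b ≡ 0ℤ ⟨mod q ⟩ → ∃ λ γ → a +ω b ≡ ι (+ q) ⊗ γ
    rational-factor a b b≡0 n≡0 = divide-𝔼 a≡0 b≡0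
      where
      identity : ∀ a b → a * a ≡ (a * a - a * b + b * b) + (a - b) * b
      identity = solve-∀
      vanish : ∀ a b → 0ℤ + (a - b) * 0ℤ ≡ 0ℤ
      vanish = solve-∀
      a≡0 : a ≡ 0ℤ ⟨mod q ⟩
      a≡0 = [ (λ z → z) , (λ z → z) ]′ (euclid a a (mod-trans (≡⇒mod (identity a b))
        (mod-trans (mod-+ n≡0 (mod-*ˡ (a - b) b≡0)) (≡⇒mod (vanish a b)))))

    ι-injective : ∀ {α β} → ι (+ q) ⊗ α ≡ ι (+ q) ⊗ β → α ≡ β
    ι-injective {a +ω b} {c +ω d} e = cong₂ _+ω_
      (ℤ.*-cancelˡ-≡ (+ q) a c {{prime⇒nonZero q-prime}} (trans (sym (cong re (ι-⊗ (+ q) a b))) (trans (cong re e) (cong re (ι-⊗ (+ q) c d)))))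
      (ℤ.*-cancelˡ-≡ (+ q) b d {{prime⇒nonZero q-prime}} (trans (sym (cong im (ι-⊗ (+ q) a b))) (trans (cong im e) (cong im (ι-⊗ (+ q) c d)))))

  module JacobiStep (k : ℕ) (0<k : 0 < k) (q-prime : Prime (suc (k ℕ.* 3))) (w : ℤ)
    (w-root : w * w + w + 1ℤ ≡ 0ℤ ⟨mod suc (k ℕ.* 3) ⟩) (3≢0 : ¬ (+ 3 ≡ 0ℤ ⟨mod suc (k ℕ.* 3) ⟩)) where

    private
      q : ℕ
      q = suc (k ℕ.* 3)

    open PrimeStep q-prime 3≢0
    open JacobiSymbol k 0<k q-prime w w-root 3≢0

    private
      product-0ˡ : ∀ α β → φ α ≡ 0ℤ ⟨mod q ⟩ → φ (α ⊗ β) ≡ 0ℤ ⟨mod q ⟩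
      product-0ˡ α β z = mod-trans (φ-⊗ α β) (mod-trans (mod-*ʳ (φ β) z) (≡⇒mod (ℤ.*-zeroˡ (φ β))))
      product-0ʳ : ∀ α β → φ β ≡ 0ℤ ⟨mod q ⟩ → φ (α ⊗ β) ≡ 0ℤ ⟨mod q ⟩
      product-0ʳ α β z = mod-trans (φ-⊗ α β) (mod-trans (mod-*ˡ (φ α) z) (≡⇒mod (ℤ.*-zeroʳ (φ α))))

      φ-divides : ∀ δ → φ δ ≡ 0ℤ ⟨mod q ⟩ → φ (conj δ) ≡ 0ℤ ⟨mod q ⟩ → ∃ λ γ → δ ≡ ι (+ q) ⊗ γ
      φ-divides (x +ω y) e ē = both-zero w w-root x y e ē

      exchange : ∀ α β β̄ γ c → β ⊗ β̄ ≡ c → α ⊗ β̄ ≡ c ⊗ γ → c ⊗ α ≡ c ⊗ (γ ⊗ β)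
      exchange α β β̄ γ c ββ̄≡c αβ̄≡cγ = trans (⊗-comm c α) (trans (cong (α ⊗_) (trans (sym ββ̄≡c) (⊗-comm β β̄)))
        (trans (sym (⊗-assoc α β̄ β)) (trans (cong (_⊗ β) αβ̄≡cγ) (⊗-assoc c γ β))))

      φ-conj-product : ∀ α β → φ β ≡ 0ℤ ⟨mod q ⟩ → φ (conj (α ⊗ conj β)) ≡ 0ℤ ⟨mod q ⟩
      φ-conj-product α β z = subst (λ δ → φ δ ≡ 0ℤ ⟨mod q ⟩)
        (sym (trans (conj-⊗ α (conj β)) (cong (conj α ⊗_) (conj-involutive β)))) (product-0ʳ (conj α) β z)

    -- Both α conj(β) and its conjugate lie in the kernel of `φ`, so q divides α conj(β).
    -- Multiplying by β and cancelling q = β conj(β) yields the quotient, without a Euclidean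
    -- algorithm in ℤ[ω].
    divides-from-root : ∀ β → β ⊗ conj β ≡ ι (+ q) → φ β ≡ 0ℤ ⟨mod q ⟩ →
      ∀ α → φ α ≡ 0ℤ ⟨mod q ⟩ → ∃ λ γ → α ≡ γ ⊗ β
    divides-from-root β ββ̄ φβ≡0 α φα≡0 = proj₁ quotient , ι-injective (exchange α β (conj β) (proj₁ quotient) (ι (+ q)) ββ̄ (proj₂ quotient))
      where
      quotient : ∃ λ γ → α ⊗ conj β ≡ ι (+ q) ⊗ γ
      quotient = φ-divides (α ⊗ conj β) (product-0ˡ α (conj β) φα≡0) (φ-conj-product α β φβ≡0)

    J-divides : ∀ α → φ α ≡ 0ℤ ⟨mod q ⟩ → ∃ λ γ → α ≡ γ ⊗ J
    J-divides = divides-from-root J J⊗conj φ-J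

    J-factored : Factored J
    J-factored = factored {unit = 0} (sym (⊗-identityˡ J)) (-1ℤ , J-primary) J-symbol

  record PrimeFactor (q : ℕ) (α : 𝔼) : Set where
    constructor primeFactor
    field
      cofactor π : 𝔼
      α≡         : α ≡ cofactor ⊗ π
      π-factored : Factored π
      q∣norm     : q ℕ.∣ ∣ norm π ∣

  module _ {q : ℕ} (q-prime : Prime q) (3≢0 : ¬ (+ 3 ≡ 0ℤ ⟨mod q ⟩)) where
    open PrimeModulus q-prime
    open PrimeStep q-prime 3≢0

    q∣norm-q : q ℕ.∣ ∣ norm (ι (+ q)) ∣
    q∣norm-q = ≡0⇒∣ {a = norm (ι (+ q))} (mod-trans (≡⇒mod (identity (+ q))) (mod-trans (mod-*ˡ (+ q) q≡0) (≡⇒mod (ℤ.*-zeroʳ (+ q)))))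
      where
      identity : ∀ x → x * x - x * 0ℤ + 0ℤ * 0ℤ ≡ x * x
      identity = solve-∀
      q≡0 : + q ≡ 0ℤ ⟨mod q ⟩
      q≡0 = ∣⇒≡0 {a = + q} (ℕ.∣-refl {q})

    rational-case : ∀ {α} → (∃ λ γ → α ≡ ι (+ q) ⊗ γ) → PrimeFactor q α
    rational-case (γ , e) = primeFactor γ (ι (+ q)) (trans e (⊗-comm (ι (+ q)) γ)) (ι-factored (+ q)) q∣norm-q

    root-case : ∀ a b w → w * w + w + 1ℤ ≡ 0ℤ ⟨mod q ⟩ → a + b * w ≡ 0ℤ ⟨mod q ⟩ →
      (∃ λ k → q ≡ suc (k ℕ.* 3) × 0 < k) → PrimeFactor q (a +ω b)
    root-case a b w w-root a+bw (k , refl , 0<k) = primeFactor (proj₁ quotient) J (proj₂ quotient) J-factored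
        (ℕ.∣-reflexive (cong ∣_∣ (sym norm-J)))
      where
      open JacobiStep k 0<k q-prime w w-root 3≢0
      open JacobiSymbol k 0<k q-prime w w-root 3≢0 using (J; norm-J)
      quotient : ∃ λ γ → a +ω b ≡ γ ⊗ J
      quotient = J-divides (a +ω b) a+bw

    -- If q divides b, it divides a too, and q itself splits off. Otherwise - a / b is a primitive
    -- cube root of unity modulo q, which forces q ≡ 1 (mod 3), and the Jacobi sum attached to that
    -- root splits off.
    prime-factor : ∀ a b → a * a - a * b + b * b ≡ 0ℤ ⟨mod q ⟩ → Dec (b ≡ 0ℤ ⟨mod q ⟩) → PrimeFactor q (a +ω b)
    prime-factor a b n≡0 (yes b≡0) = rational-case (rational-factor a b b≡0 n≡0)
    prime-factor a b n≡0 (no b≢0) = root-case a b w (proj₁ root) (proj₂ root)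
        (Exponent.exponent q-prime w (proj₁ root) 3≢0)
      where
      c = proj₁ (inverse b b≢0)
      w = - (a * c)
      root = root-of-divisor a b c (proj₂ (inverse b b≢0)) n≡0

  nontrivial-factor : ∀ {q n} → Prime q → q ℕ.∣ n → n ≢ 0 → 1 < n
  nontrivial-factor {n = zero} _ _ n≢0 = contradiction refl n≢0
  nontrivial-factor {n = 1} q-prime q∣1 _ = contradiction (ℕ.∣1⇒≡1 q∣1) (ℕ.nonTrivial⇒≢1 {{prime⇒nonTrivial q-prime}})
  nontrivial-factor {n = suc (suc _)} _ _ _ = s≤s (s≤s z≤n)

  left-factor-smaller : ∀ g h {n} → n ≢ 0 → n ≡ g ℕ.* h → 1 < h → g < n
  left-factor-smaller zero h {n} n≢0 e 1<h = contradiction e n≢0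
  left-factor-smaller g@(suc _) h n≢0 e 1<h = subst (g <_) (sym e) (ℕ.m<m*n g h 1<h)

  abs-norm≢0 : ∀ α → ¬ (norm α ≡ 0ℤ ⟨mod 3 ⟩) → ∣ norm α ∣ ≢ 0
  abs-norm≢0 α 3∤N e = 3∤N (≡⇒mod (trans (norm-nonneg α) (cong +_ e)))

  abs-norm-⊗ : ∀ α β → ∣ norm (α ⊗ β) ∣ ≡ ∣ norm α ∣ ℕ.* ∣ norm β ∣
  abs-norm-⊗ α β = trans (cong ∣_∣ (norm-⊗ α β)) (ℤ.abs-* (norm α) (norm β))

  3≢0-from-divisor : ∀ {q a} → Prime q → q ℕ.∣ ∣ a ∣ → ¬ (a ≡ 0ℤ ⟨mod 3 ⟩) → ¬ (+ 3 ≡ 0ℤ ⟨mod q ⟩)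
  3≢0-from-divisor q-prime q∣a 3∤a e with prime⇒irreducible 3-prime (≡0⇒∣ e)
  ... | inj₁ q≡1 = contradiction q≡1 (ℕ.nonTrivial⇒≢1 {{prime⇒nonTrivial q-prime}})
  ... | inj₂ refl = 3∤a (∣⇒≡0 q∣a)

  -- Descent on the norm, with n bounding the recursion: each prime divisor of the norm yields a
  -- factor whose norm it divides, so the cofactor has smaller norm, until a unit remains.
  factor : ∀ n α → ∣ norm α ∣ < n → ¬ (norm α ≡ 0ℤ ⟨mod 3 ⟩) → Factored α
  factor (suc n) α (s≤s N≤n) 3∤N = by-size (∣ norm α ∣ ℕ.≟ 1)
    where
    N≢0 : ∣ norm α ∣ ≢ 0
    N≢0 = abs-norm≢0 α 3∤N
    by-size : Dec (∣ norm α ∣ ≡ 1) → Factored α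
    by-size (yes N≡1) = unit-factored α N≡1
    by-size (no N≢1) = subst Factored (sym F.α≡) (⊗-factored (factor n F.cofactor (ℕ.<-≤-trans smaller N≤n) 3∤γ) F.π-factored)
      where
      1<N : 1 < ∣ norm α ∣
      1<N = ℕ.≤∧≢⇒< (ℕ.n≢0⇒n>0 N≢0) (λ e → N≢1 (sym e))
      divisor = prime-divisor ∣ norm α ∣ 1<N
      q = proj₁ divisor
      q-prime = proj₁ (proj₂ divisor)
      q∣N = proj₂ (proj₂ divisor)
      module F = PrimeFactor (prime-factor q-prime (3≢0-from-divisor {a = norm α} q-prime q∣N 3∤N) (re α) (im α) (∣⇒≡0 {a = norm α} q∣N)
        (Residue.mod? q {{prime⇒nonZero q-prime}} (im α) 0ℤ))
      N≡product : ∣ norm α ∣ ≡ ∣ norm F.cofactor ∣ ℕ.* ∣ norm F.π ∣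
      N≡product = trans (cong (λ α → ∣ norm α ∣) F.α≡) (abs-norm-⊗ F.cofactor F.π)
      smaller : ∣ norm F.cofactor ∣ < ∣ norm α ∣
      smaller = left-factor-smaller ∣ norm F.cofactor ∣ ∣ norm F.π ∣ N≢0 N≡product
        (nontrivial-factor q-prime F.q∣norm (λ e → N≢0 (trans N≡product (trans (cong (∣ norm F.cofactor ∣ ℕ.*_) e) (ℕ.*-zeroʳ ∣ norm F.cofactor ∣)))))
      3∤γ : ¬ (norm F.cofactor ≡ 0ℤ ⟨mod 3 ⟩)
      3∤γ z = 3∤N (mod-trans (≡⇒mod (trans (cong norm F.α≡) (norm-⊗ F.cofactor F.π)))
        (mod-trans (mod-*ʳ (norm F.π) z) (≡⇒mod (ℤ.*-zeroˡ (norm F.π)))))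

-- Symbols at primes where γ and its conjugate agree up to sign

module AmbiguousPrimes where

  open import Data.Integer using (ℤ; +_; -[1+_]; _+_; _-_; _*_; -_; _^_; 0ℤ; 1ℤ; ∣_∣)
  import Data.Integer.Properties as ℤ
  open import Data.Integer.Tactic.RingSolver using (solve-∀)
  open import Data.List using ([]; _∷_)
  open import Data.List.Relation.Unary.All using (All; []; _∷_)
  open import Data.Nat as ℕ using (ℕ; zero; suc; NonZero; _<_; s≤s)
  import Data.Nat.Divisibility as ℕ
  import Data.Nat.DivMod as ℕ
  open import Data.Nat.ListAction using (product)
  open import Data.Nat.Primality using (Prime; prime⇒irreducible)
  open import Data.Nat.Primality.Factorisation using (factorise; module PrimeFactorisation)
  import Data.Nat.Properties as ℕ
  import Data.Nat.Tactic.RingSolver as ℕSolver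
  open import Data.Product using (∃; _,_; _×_)
  open import Data.Sum using (_⊎_; inj₁; inj₂; [_,_]′)
  open import Relation.Binary.PropositionalEquality hiding (J)
  open import Relation.Nullary using (contradiction; ¬_)
  open EisensteinIntegers
  open GroupRings
  open PrimeFields
  open ResidueCharacters
  open JacobiSums
  open CubicSymbols
  open Factorisation

  -- A + B √-3, where √-3 = 1 + 2 ω.
  _+√-3_ : ℤ → ℤ → 𝔼
  A +√-3 B = A + B +ω + 2 * B

  norm-√-3 : ∀ A B → norm (A +√-3 B) ≡ A * A + + 3 * (B * B)
  norm-√-3 = identity
    where
    identity : ∀ A B → (A + B) * (A + B) - (A + B) * (+ 2 * B) + (+ 2 * B) * (+ 2 * B) ≡ A * A + + 3 * (B * B)
    identity = solve-∀

  conj-√-3 : ∀ A B → conj (A +√-3 B) ≡ A +√-3 (- B)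
  conj-√-3 A B = cong₂ _+ω_ (identity₁ A B) (identity₂ B)
    where
    identity₁ : ∀ A B → A + B - + 2 * B ≡ A + - B
    identity₁ = solve-∀
    identity₂ : ∀ B → - (+ 2 * B) ≡ + 2 * (- B)
    identity₂ = solve-∀

  value-1-mod : ∀ {l V} → Prime l → Value V → V ≈ ι 1ℤ ⟨mod l ⟩ → V ≡ ι 1ℤ
  value-1-mod l-prime v1 _ = refl
  value-1-mod l-prime v0 (r ,ω _) = contradiction (mod-sym r) (PrimeModulus.1≢0 l-prime)
  value-1-mod l-prime vω (_ ,ω i) = contradiction i (PrimeModulus.1≢0 l-prime)
  value-1-mod l-prime vω² (_ ,ω i) = contradiction (mod-neg i) (PrimeModulus.1≢0 l-prime)

  value-fourth : ∀ {V} → Value V → (V ⊗ V) ⊗ (V ⊗ V) ≡ V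
  value-fourth v0  = refl
  value-fourth v1  = refl
  value-fourth vω  = refl
  value-fourth vω² = refl

  value-↑ : ∀ {V} n → Value V → Value (V ↑ n)
  value-↑ zero v = v1
  value-↑ (suc n) v = value-⊗ v (value-↑ n v)

  ω↑≢0 : ∀ {V} → Value V → V ≢ ι 0ℤ → ∀ n → V ↑ n ≢ ι 0ℤ
  ω↑≢0 v V≢0 zero ()
  ω↑≢0 {V} v V≢0 (suc n) e = V≢0 (zero-product v (value-↑ n v) (ω↑≢0 v V≢0 n) e)
    where
    zero-product : ∀ {V W} → Value V → Value W → W ≢ ι 0ℤ → V ⊗ W ≡ ι 0ℤ → V ≡ ι 0ℤ
    zero-product v0 _ _ _ = refl
    zero-product _ v0 W≢0 _ = contradiction refl W≢0
    zero-product v1 v1 _ ()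
    zero-product v1 vω _ ()
    zero-product v1 vω² _ ()
    zero-product vω v1 _ ()
    zero-product vω vω _ ()
    zero-product vω vω² _ ()
    zero-product vω² v1 _ ()
    zero-product vω² vω _ ()
    zero-product vω² vω² _ ()

  parity : ∀ n → (∃ λ g → n ≡ g ℕ.+ g) ⊎ (∃ λ g → n ≡ suc (g ℕ.+ g))
  parity zero = inj₁ (0 , refl)
  parity (suc n) with parity n
  ... | inj₁ (g , refl) = inj₂ (g , refl)
  ... | inj₂ (g , refl) = inj₁ (suc g , cong suc (sym (ℕ.+-suc g g)))

  data Residue₃ (l : ℕ) : Set where
    residue₁ : ∀ e → l ≡ 1 ℕ.+ e ℕ.* 3 → Residue₃ l
    residue₂ : ∀ e → l ≡ 2 ℕ.+ e ℕ.* 3 → Residue₃ l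

  residue₃ : ∀ {l} → Prime l → l ≢ 3 → Residue₃ l
  residue₃ {l} l-prime l≢3 = go (l ℕ.% 3) (ℕ.m%n<n l 3) (ℕ.m≡m%n+[m/n]*n l 3)
    where
    go : ∀ r → r < 3 → l ≡ r ℕ.+ (l ℕ./ 3) ℕ.* 3 → Residue₃ l
    go 0 _ e = [ (λ ()) , (λ e → contradiction (sym e) l≢3) ]′ (prime⇒irreducible l-prime (ℕ.divides (l ℕ./ 3) e))
    go 1 _ e = residue₁ (l ℕ./ 3) e
    go 2 _ e = residue₂ (l ℕ./ 3) e
    go (suc (suc (suc _))) (s≤s (s≤s (s≤s ()))) _

  even-prime : ∀ {l} → Prime l → 2 ℕ.∣ l → l ≡ 2
  even-prime l-prime 2∣l = [ (λ ()) , sym ]′ (prime⇒irreducible l-prime 2∣l)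

  -- For t prime to 3, the class of t² modulo 9 determines the cubic residue symbol of ω at t.
  Square₉ : ℤ → ℕ → Set
  Square₉ t n = t * t ≡ 1ℤ + + 3 * + n ⟨mod 9 ⟩

  square₉-* : ∀ s t m n → Square₉ s m → Square₉ t n → Square₉ (s * t) (m ℕ.+ n)
  square₉-* s t m n p r = mod-trans (≡⇒mod (identity₁ s t)) (mod-trans (mod-* p r)
    (modulo (+ m * + n) (trans (identity₂ (+ m) (+ n)) (cong (λ z → 1ℤ + + 3 * z + + m * + n * + 9) (sym (ℤ.pos-+ m n))))))
    where
    identity₁ : ∀ s t → (s * t) * (s * t) ≡ (s * s) * (t * t)
    identity₁ = solve-∀
    identity₂ : ∀ m n → (1ℤ + + 3 * m) * (1ℤ + + 3 * n) ≡ 1ℤ + + 3 * (m + n) + m * n * + 9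
    identity₂ = solve-∀

  -- From (1 + 3 e)² ≡ 1 + 6 e (mod 9). The exponent is kept in the form in which `prime-determined`
  -- meets it.
  square₉-split : ∀ e → Square₉ (+ (1 ℕ.+ e ℕ.* 3)) (e ℕ.+ e)
  square₉-split e = modulo (+ e * + e) (trans (cong (λ x → (1ℤ + x) * (1ℤ + x)) (ℤ.pos-* e 3))
    (trans (identity (+ e)) (cong (λ z → 1ℤ + + 3 * z + + e * + e * + 9) (sym (ℤ.pos-+ e e)))))
    where
    identity : ∀ e → (1ℤ + e * + 3) * (1ℤ + e * + 3) ≡ 1ℤ + + 3 * (e + e) + e * e * + 9
    identity = solve-∀

  square₉-inert : ∀ e → Square₉ (+ (2 ℕ.+ e ℕ.* 3)) (suc e)
  square₉-inert e = modulo (+ e * + e + + e) (trans (cong (λ x → (+ 2 + x) * (+ 2 + x)) (ℤ.pos-* e 3)) (identity (+ e)))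
    where
    identity : ∀ e → (+ 2 + e * + 3) * (+ 2 + e * + 3) ≡ 1ℤ + + 3 * (1ℤ + e) + (e * e + e) * + 9
    identity = solve-∀

  module Evaluation (γ β : 𝔼) (j : ℕ) (γ≡ : γ ≡ ω ↑ j ⊗ β) (S : Symbol β) where
    open Symbol S

    z : 𝔼
    z = ω ↑ j

    z-value : Value z
    z-value = value-↑ j vω

    z≢0 : z ≢ ι 0ℤ
    z≢0 = ω↑≢0 vω (λ ()) j

    -- The inverse of the unit z, since z is a cube root of unity.
    v : 𝔼
    v = z ⊗ z

    norm-z : norm z ≡ 1ℤ
    norm-z = norm-value z-value z≢0
      where
      norm-value : ∀ {V} → Value V → V ≢ ι 0ℤ → norm V ≡ 1ℤ
      norm-value v0 V≢0 = contradiction refl V≢0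
      norm-value v1 _ = refl
      norm-value vω _ = refl
      norm-value vω² _ = refl

    norm-γ : norm γ ≡ norm β
    norm-γ = trans (cong norm γ≡) (trans (norm-⊗ z β) (trans (cong (_* norm β) norm-z) (ℤ.*-identityˡ (norm β))))

    module _ (l : ℕ) where
      open Mod l

      -- Passing from β to γ = z β multiplies the ratio to the conjugate by z^f / conj(z)^f. As
      -- conj(z) = z², this is z^(-f), written here as z^(2f).
      transfer : ∀ f Y → β ↑ f ≈ Y ⊗ conj β ↑ f ⟨mod l ⟩ →
        γ ↑ f ≈ ((z ↑ f ⊗ z ↑ f) ⊗ Y) ⊗ conj γ ↑ f ⟨mod l ⟩
      transfer f Y e = begin
        γ ↑ f                       ≡⟨ cong (_↑ f) γ≡ ⟩
        (z ⊗ β) ↑ f                 ≡⟨ ↑-distrib-⊗ z β f ⟩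
        u ⊗ β ↑ f                   ≈⟨ ⊗-congˡ {u} e ⟩
        u ⊗ (Y ⊗ β̄)                 ≡⟨ cong (_⊗ (Y ⊗ β̄)) (value-fourth (value-↑ f z-value)) ⟨
        ((u ⊗ u) ⊗ (u ⊗ u)) ⊗ (Y ⊗ β̄) ≡⟨ ⊗-interchange (u ⊗ u) (u ⊗ u) Y β̄ ⟩
        ((u ⊗ u) ⊗ Y) ⊗ ((u ⊗ u) ⊗ β̄) ≡⟨ cong (((u ⊗ u) ⊗ Y) ⊗_) γ̄↑ ⟨
        ((u ⊗ u) ⊗ Y) ⊗ conj γ ↑ f  ∎
        where
        open import Relation.Binary.Reasoning.Setoid ≈-setoid
        u = z ↑ f
        β̄ = conj β ↑ f
        γ̄↑ : conj γ ↑ f ≡ (u ⊗ u) ⊗ β̄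
        γ̄↑ = trans (cong (λ α → conj α ↑ f) γ≡) (trans (cong (_↑ f) (conj-⊗ z β))
          (trans (↑-distrib-⊗ (conj z) (conj β) f) (cong (_⊗ β̄)
            (trans (cong (_↑ f) (value-conj z-value)) (↑-distrib-⊗ z z f)))))

    -- The ratio for γ is 1 by assumption and z^(2f) Y by `transfer`. Since γ is invertible modulo
    -- l, these agree modulo l. Cube roots of unity congruent to 1 modulo a prime are equal to 1, so
    -- Y is the inverse of z^(2f).
    determine : ∀ {l} → Prime l → ¬ (norm γ ≡ 0ℤ ⟨mod l ⟩) → ∀ f Y → Value Y → β ↑ f ≈ Y ⊗ conj β ↑ f ⟨mod l ⟩ →
      γ ↑ f ≈ conj γ ↑ f ⟨mod l ⟩ → Y ≡ z ↑ f
    determine {l} l-prime N≢0 f Y Y-value e γ≈γ̄ = begin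
      Y                        ≡⟨ ⊗-identityˡ Y ⟨
      ι 1ℤ ⊗ Y                 ≡⟨ cong (_⊗ Y) (value-cube u-value (ω↑≢0 z-value z≢0 f)) ⟨
      (u ⊗ (u ⊗ u)) ⊗ Y        ≡⟨ ⊗-assoc u (u ⊗ u) Y ⟩
      u ⊗ ((u ⊗ u) ⊗ Y)        ≡⟨ cong (u ⊗_) W≡1 ⟩
      u ⊗ ι 1ℤ                 ≡⟨ ⊗-identityʳ u ⟩
      u                        ∎
      where
      open ≡-Reasoning
      open Mod l
      u = z ↑ f
      u-value = value-↑ f z-value
      W = (u ⊗ u) ⊗ Y
      c : 𝔼
      c = ι (norm γ ^ f)
      γ̄γ : conj γ ↑ f ⊗ γ ↑ f ≡ c
      γ̄γ = trans (sym (↑-distrib-⊗ (conj γ) γ f)) (trans (cong (_↑ f) (trans (⊗-comm (conj γ) γ) (⊗-conj γ))) (ι-^ (norm γ) f))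
      scaled : c ⊗ W ≈ c ⊗ ι 1ℤ ⟨mod l ⟩
      scaled = ≈-trans (≡⇒≈ (trans (⊗-comm c W) (trans (cong (W ⊗_) (sym γ̄γ)) (sym (⊗-assoc W (conj γ ↑ f) (γ ↑ f))))))
        (≈-trans (⊗-congʳ {γ ↑ f} (≈-trans (≈-sym (transfer l f Y e)) γ≈γ̄)) (≡⇒≈ (trans γ̄γ (sym (⊗-identityʳ c)))))
      W≡1 : W ≡ ι 1ℤ
      W≡1 = value-1-mod l-prime (value-⊗ (value-⊗ u-value u-value) Y-value)
        (PrimeMod.ι-cancel-mod l-prime (PrimeModulus.^-nonzero l-prime f N≢0) scaled)

    -- At such primes the factor β has the symbol of ω^(-j), because γ^f ≡ conj γ^f for the exponent f of the symbol.
    record Ambiguous (l : ℕ) : Set where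
      field
        ≢3        : l ≢ 3
        norm≢0    : ¬ (norm γ ≡ 0ℤ ⟨mod l ⟩)
        squares   : γ ⊗ γ ≈ conj γ ⊗ conj γ ⟨mod l ⟩
        at-two    : l ≡ 2 → γ ≈ conj γ ⟨mod l ⟩

    even-power : ∀ {l} → γ ⊗ γ ≈ conj γ ⊗ conj γ ⟨mod l ⟩ → ∀ g → γ ↑ (g ℕ.+ g) ≈ conj γ ↑ (g ℕ.+ g) ⟨mod l ⟩
    even-power {l} e g = ≈-trans (≡⇒≈ (double γ)) (≈-trans (↑-cong g e) (≡⇒≈ (sym (double (conj γ)))))
      where
      open Mod l
      double : ∀ α → α ↑ (g ℕ.+ g) ≡ (α ⊗ α) ↑ g
      double α = trans (↑-homo-⊗ α g g) (sym (↑-distrib-⊗ α α g))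

    Determined : ℤ → Set
    Determined t = ∃ λ n → Square₉ t n × X t ≡ v ↑ n

    -- For odd l the exponent, e or e + 1, is even, so agreement of the squares suffices; l = 2 has
    -- exponent 1 and needs `at-two`. When l = 1 + 3 e, X = z^e = v^(2e). When l = 2 + 3 e, the law
    -- gives X² = z^(e+1), and X = X⁴ = v^(e+1). These exponents of v are those of the squares
    -- modulo 9.
    prime-determined : ∀ {l} → Prime l → Ambiguous l → Determined (+ l)
    prime-determined {l} l-prime G = by-residue (residue₃ l-prime ≢3)
      where
      open Ambiguous G
      open Mod l
      Nβ≢0 : ¬ (norm β ≡ 0ℤ ⟨mod l ⟩)
      Nβ≢0 z = norm≢0 (mod-trans (≡⇒mod norm-γ) z)
      by-residue : Residue₃ l → Determined (+ l)
      by-residue (residue₁ e l≡) = e ℕ.+ e , subst (λ l → Square₉ (+ l) (e ℕ.+ e)) (sym l≡) (square₉-split e) ,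
          trans (determine l-prime norm≢0 e (X (+ l)) (X-value (+ l)) (split l-prime Nβ≢0 e l≡) (equal (parity e))) v-power
        where
        equal : (∃ λ g → e ≡ g ℕ.+ g) ⊎ (∃ λ g → e ≡ suc (g ℕ.+ g)) → γ ↑ e ≈ conj γ ↑ e ⟨mod l ⟩
        equal (inj₁ (g , refl)) = even-power squares g
        equal (inj₂ (g , refl)) = contradiction (trans (sym l≡) (even-prime l-prime (ℕ.divides (2 ℕ.+ g ℕ.* 3) (trans l≡ (arith g))))) λ ()
          where
          arith : ∀ g → 1 ℕ.+ suc (g ℕ.+ g) ℕ.* 3 ≡ (2 ℕ.+ g ℕ.* 3) ℕ.* 2
          arith = ℕSolver.solve-∀
        v-power : z ↑ e ≡ v ↑ (e ℕ.+ e)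
        v-power = sym (trans (↑-homo-⊗ v e e) (trans (sym (↑-distrib-⊗ v v e)) (cong (_↑ e) (value-fourth z-value))))
      by-residue (residue₂ e l≡) = suc e , subst (λ l → Square₉ (+ l) (suc e)) (sym l≡) (square₉-inert e) ,
          trans (sym (value-fourth (X-value (+ l)))) (trans (cong (λ Y → Y ⊗ Y) X²) (sym (↑-distrib-⊗ z z (suc e))))
        where
        equal : (∃ λ g → suc e ≡ g ℕ.+ g) ⊎ (∃ λ g → suc e ≡ suc (g ℕ.+ g)) → γ ↑ suc e ≈ conj γ ↑ suc e ⟨mod l ⟩
        equal (inj₁ (g , eq)) = subst (λ f → γ ↑ f ≈ conj γ ↑ f ⟨mod l ⟩) (sym eq) (even-power squares g)
        equal (inj₂ (g , eq)) = ≈-trans (≡⇒≈ (cong (γ ↑_) f≡1)) (≈-trans (↑-cong 1 (at-two l≡2)) (≡⇒≈ (cong (conj γ ↑_) (sym f≡1))))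
          where
          arith : ∀ g → 2 ℕ.+ (g ℕ.+ g) ℕ.* 3 ≡ (1 ℕ.+ g ℕ.* 3) ℕ.* 2
          arith = ℕSolver.solve-∀
          l≡2 : l ≡ 2
          l≡2 = even-prime l-prime (ℕ.divides (1 ℕ.+ g ℕ.* 3) (trans l≡ (trans (cong (λ e → 2 ℕ.+ e ℕ.* 3) (ℕ.suc-injective eq)) (arith g))))
          e≡0 : ∀ e → 2 ≡ 2 ℕ.+ e ℕ.* 3 → e ≡ 0
          e≡0 zero _ = refl
          f≡1 : suc e ≡ 1
          f≡1 = cong suc (e≡0 e (trans (sym l≡2) l≡))
        X² : X (+ l) ⊗ X (+ l) ≡ z ↑ suc e
        X² = determine l-prime norm≢0 (suc e) (X (+ l) ⊗ X (+ l)) (value-⊗ (X-value (+ l)) (X-value (+ l)))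
          (inert l-prime Nβ≢0 e l≡) (equal (parity (suc e)))

    X-neg : ∀ t → X (- t) ≡ X t
    X-neg t = trans (cong X (identity t)) (trans (X-⊗ (- 1ℤ) t) (trans (cong (_⊗ X t)
        (root (X-value (- 1ℤ)) (trans (sym (X-⊗ (- 1ℤ) (- 1ℤ))) X-1))) (⊗-identityˡ (X t))))
      where
      identity : ∀ t → - t ≡ - 1ℤ * t
      identity = solve-∀
      root : ∀ {V} → Value V → V ⊗ V ≡ ι 1ℤ → V ≡ ι 1ℤ
      root v1 _ = refl

    neg-determined : ∀ {t} → Determined t → Determined (- t)
    neg-determined {t} (n , s , e) = n , mod-trans (≡⇒mod (identity t)) s , trans (X-neg t) e
      where
      identity : ∀ t → - t * - t ≡ t * t
      identity = solve-∀

    product-determined : ∀ ps → All Prime ps → (∀ l → Prime l → l ℕ.∣ product ps → Ambiguous l) → Determined (+ product ps)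
    product-determined [] [] _ = 0 , mod-refl , X-1
    product-determined (l ∷ ps) (l-prime ∷ ps-prime) good = combine
      (prime-determined l-prime (good l l-prime (ℕ.m∣m*n (product ps))))
      (product-determined ps ps-prime (λ l′ pr d → good l′ pr (ℕ.∣n⇒∣m*n l d)))
      where
      combine : Determined (+ l) → Determined (+ product ps) → Determined (+ (l ℕ.* product ps))
      combine (m , s , e) (n , t , e′) = m ℕ.+ n ,
        subst (λ x → Square₉ x (m ℕ.+ n)) (sym (ℤ.pos-* l (product ps))) (square₉-* (+ l) (+ product ps) m n s t) ,
        trans (cong X (ℤ.pos-* l (product ps))) (trans (X-⊗ (+ l) (+ product ps))
          (trans (cong₂ _⊗_ e e′) (sym (↑-homo-⊗ v m n))))

    -- Both the symbol and the class of the square modulo 9 are multiplicative and insensitive to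
    -- the sign, so the prime factors of t decide.
    determined : ∀ t → t ≢ 0ℤ → (∀ l → Prime l → t ≡ 0ℤ ⟨mod l ⟩ → Ambiguous l) → Determined t
    determined t t≢0 good = signed t from-abs
      where
      instance
        t-nonZero : NonZero ∣ t ∣
        t-nonZero = ℕ.≢-nonZero (λ e → t≢0 (ℤ.∣i∣≡0⇒i≡0 e))
      open PrimeFactorisation (factorise ∣ t ∣)
      from-abs : Determined (+ ∣ t ∣)
      from-abs = subst (λ n → Determined (+ n)) (sym isFactorisation) (product-determined factors factorsPrime
        (λ l pr d → good l pr (∣⇒≡0 (subst (l ℕ.∣_) (sym isFactorisation) d))))
      signed : ∀ t → Determined (+ ∣ t ∣) → Determined t
      signed (+ n) d = d
      signed -[1+ n ] d = neg-determined d

-- The cubic symbol of A + B √-3 as an exponent modulo 3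

module SymbolExponents where

  open import Data.Integer using (ℤ; +_; _+_; _-_; _*_; -_; 0ℤ; 1ℤ; ∣_∣)
  import Data.Integer.Properties as ℤ
  open import Data.Integer.Tactic.RingSolver using (solve-∀)
  open import Data.Nat as ℕ using (ℕ; zero; suc)
  import Data.Nat.Divisibility as ℕ
  open import Data.Nat.Primality using (Prime; prime⇒irreducible; prime⇒nonTrivial)
  import Data.Nat.Properties as ℕ
  open import Data.Product using (_,_; _×_; proj₁; proj₂)
  open import Data.Sum using (_⊎_; inj₁; inj₂; [_,_]′)
  open import Relation.Binary.PropositionalEquality hiding (J)
  open import Relation.Nullary using (contradiction; ¬_)
  open EisensteinIntegers
  open GroupRings
  open PrimeFields
  open ResidueCharacters
  open JacobiSums
  open CubicSymbols
  open Factorisation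
  open AmbiguousPrimes

  -- Binomial expansion of (1 + (ω - 1))^j, as (ω - 1)² is a multiple of 3.
  ω-power-mod-3 : ∀ j → ω ↑ j ≈ (1ℤ - + j +ω + j) ⟨mod 3 ⟩
  ω-power-mod-3 zero = mod-refl ,ω mod-refl
  ω-power-mod-3 (suc j) = Mod.≈-trans 3 (Mod.⊗-congˡ 3 {ω} (ω-power-mod-3 j))
    (modulo 0ℤ (real (+ j)) ,ω modulo (- + j) (imag (+ j)))
    where
    real : ∀ j → 0ℤ * (1ℤ - j) - 1ℤ * j ≡ 1ℤ - (1ℤ + j) + 0ℤ * + 3
    real = solve-∀
    imag : ∀ j → 0ℤ * j + 1ℤ * (1ℤ - j) - 1ℤ * j ≡ 1ℤ + j + (- j) * + 3
    imag = solve-∀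

  -- Comparing coordinates modulo 3 gives 2 B ≡ j r and A ≡ r. Eliminating r leaves j in terms of A
  -- and B, whichever rational integer the primary factor reduces to.
  unit-exponent : ∀ A B j r β → (A +√-3 B) ≡ ω ↑ j ⊗ β → β ≈ ι r ⟨mod 3 ⟩ → A * + j + B ≡ 0ℤ ⟨mod 3 ⟩
  unit-exponent A B j r β γ≡ β≈r = from-components A B (+ j) r (re≡ components) (im≡ components)
    where
    components : (A +√-3 B) ≈ (1ℤ - + j +ω + j) ⊗ ι r ⟨mod 3 ⟩
    components = Mod.≈-trans 3 (≡⇒≈ γ≡) (Mod.⊗-cong 3 (ω-power-mod-3 j) β≈r)
    from-components : ∀ A B j r → A + B ≡ (1ℤ - j) * r - j * 0ℤ ⟨mod 3 ⟩ → + 2 * B ≡ (1ℤ - j) * 0ℤ + j * r - j * 0ℤ ⟨mod 3 ⟩ →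
      A * j + B ≡ 0ℤ ⟨mod 3 ⟩
    from-components A B j r e₁ e₂ = mod-trans (modulo (B * (j + 1ℤ)) (identity₁ A B j))
      (mod-trans (mod-+ (mod-+ (mod-*ʳ j e₁) (mod-neg (mod-*ʳ j (mod-*ˡ (+ 2) e₂)))) (mod-neg e₂)) (modulo (- (j * j * r)) (identity₂ j r)) )
      where
      identity₁ : ∀ A B j → A * j + B ≡ (A + B) * j + - (+ 2 * (+ 2 * B) * j) + - (+ 2 * B) + B * (j + 1ℤ) * + 3
      identity₁ = solve-∀
      identity₂ : ∀ j r → ((1ℤ - j) * r - j * 0ℤ) * j + - (+ 2 * ((1ℤ - j) * 0ℤ + j * r - j * 0ℤ) * j) + - ((1ℤ - j) * 0ℤ + j * r - j * 0ℤ)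
        ≡ 0ℤ + (- (j * j * r)) * + 3
      identity₂ = solve-∀

  -- The exponents j, k, m, n depend on the factorisations that were found; this trades them for
  -- squares modulo 9. It replaces 3 A j by - 3 B, and 2 (k + m + 2 n) by 2 k + n - m, which is the
  -- same modulo 3.
  exponent-mod-9 : ∀ A B j k m n P CC MM → A * j + B ≡ 0ℤ ⟨mod 3 ⟩ →
    P ≡ 1ℤ + + 3 * (k + k) ⟨mod 9 ⟩ → CC ≡ 1ℤ + + 3 * n ⟨mod 9 ⟩ → MM ≡ 1ℤ + + 3 * m ⟨mod 9 ⟩ →
    + 3 * A * (j * ((k + (m + (n + n))) + (k + (m + (n + n))))) ≡ - B * (P - 1ℤ + CC - MM) ⟨mod 9 ⟩
  exponent-mod-9 A B j k m n P CC MM (modulo h e) p c q = mod-trans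
    (modulo (h * (+ 2 * k + n - m) + A * j * (m + n)) (trans (identity₁ A B j k m n)
      (trans (cong (λ x → + 3 * x * (+ 2 * k + n - m) - + 3 * B * (+ 2 * k + n - m) + + 9 * (A * j * (m + n))) e) (identity₂ A B j k m n h))))
    (mod-*ˡ (- B) (mod-sym (mod-+ (mod-+ (mod-+ p (mod-refl {a = - 1ℤ})) c) (mod-neg q))))
    where
    identity₁ : ∀ A B j k m n → + 3 * A * (j * ((k + (m + (n + n))) + (k + (m + (n + n)))))
      ≡ + 3 * (A * j + B) * (+ 2 * k + n - m) - + 3 * B * (+ 2 * k + n - m) + + 9 * (A * j * (m + n))
    identity₁ = solve-∀
    identity₂ : ∀ A B j k m n h → + 3 * (0ℤ + h * + 3) * (+ 2 * k + n - m) - + 3 * B * (+ 2 * k + n - m) + + 9 * (A * j * (m + n))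
      ≡ - B * ((1ℤ + + 3 * (k + k)) - 1ℤ + (1ℤ + + 3 * n) - (1ℤ + + 3 * m)) + (h * (+ 2 * k + n - m) + A * j * (m + n)) * + 9
    identity₂ = solve-∀

  -- The squares of A + B √-3 and its conjugate differ by 4 A B √-3, the elements themselves by 2 B
  -- √-3. The norm A² + 3 B² is prime to l because l divides just one of A and B.
  ambiguous : ∀ A B {β} j (γ≡ : (A +√-3 B) ≡ ω ↑ j ⊗ β) (S : Symbol β) {l} → Prime l → l ≢ 3 →
    A * B ≡ 0ℤ ⟨mod l ⟩ → ¬ (A ≡ 0ℤ ⟨mod l ⟩ × B ≡ 0ℤ ⟨mod l ⟩) → Evaluation.Ambiguous (A +√-3 B) β j γ≡ S l
  ambiguous A B j γ≡ S {l} l-prime l≢3 (modulo c AB≡) not-both = record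
    { ≢3 = l≢3
    ; norm≢0 = λ z → norm-nonzero (mod-trans (≡⇒mod (sym (norm-√-3 A B))) z)
    ; squares = modulo (+ 4 * c) (trans (identity₁ A B) (trans (cong (λ x → (A + B - + 2 * B) * (A + B - + 2 * B) - (- (+ 2 * B)) * (- (+ 2 * B)) + + 4 * x) AB≡)
          (identity₃ ((A + B - + 2 * B) * (A + B - + 2 * B) - (- (+ 2 * B)) * (- (+ 2 * B))) c (+ l))))
        ,ω modulo (+ 8 * c) (trans (identity₂ A B) (trans (cong (λ x → (A + B - + 2 * B) * (- (+ 2 * B)) + (- (+ 2 * B)) * (A + B - + 2 * B) - (- (+ 2 * B)) * (- (+ 2 * B)) + + 8 * x) AB≡)
          (identity₄ ((A + B - + 2 * B) * (- (+ 2 * B)) + (- (+ 2 * B)) * (A + B - + 2 * B) - (- (+ 2 * B)) * (- (+ 2 * B))) c (+ l))))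
    ; at-two = λ { refl → modulo B (identity₅ A B) ,ω modulo (+ 2 * B) (identity₆ B) } }
    where
    open PrimeModulus l-prime
    identity₁ : ∀ A B → (A + B) * (A + B) - (+ 2 * B) * (+ 2 * B) ≡ (A + B - + 2 * B) * (A + B - + 2 * B) - (- (+ 2 * B)) * (- (+ 2 * B)) + + 4 * (A * B)
    identity₁ = solve-∀
    identity₂ : ∀ A B → (A + B) * (+ 2 * B) + (+ 2 * B) * (A + B) - (+ 2 * B) * (+ 2 * B)
      ≡ (A + B - + 2 * B) * (- (+ 2 * B)) + (- (+ 2 * B)) * (A + B - + 2 * B) - (- (+ 2 * B)) * (- (+ 2 * B)) + + 8 * (A * B)
    identity₂ = solve-∀
    identity₃ : ∀ x c l → x + + 4 * (0ℤ + c * l) ≡ x + + 4 * c * l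
    identity₃ = solve-∀
    identity₄ : ∀ x c l → x + + 8 * (0ℤ + c * l) ≡ x + + 8 * c * l
    identity₄ = solve-∀
    identity₅ : ∀ A B → A + B ≡ A + B - + 2 * B + B * + 2
    identity₅ = solve-∀
    identity₆ : ∀ B → + 2 * B ≡ - (+ 2 * B) + + 2 * B * + 2
    identity₆ = solve-∀
    3≢0 : ¬ (+ 3 ≡ 0ℤ ⟨mod l ⟩)
    3≢0 e = [ (λ l≡1 → contradiction l≡1 (ℕ.nonTrivial⇒≢1 {{prime⇒nonTrivial l-prime}})) , l≢3 ]′
      (prime⇒irreducible 3-prime (≡0⇒∣ e))
    norm-nonzero : ¬ (A * A + + 3 * (B * B) ≡ 0ℤ ⟨mod l ⟩)
    norm-nonzero e = [ A-case , B-case ]′ (euclid A B (modulo c AB≡))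
      where
      identity₇ : ∀ A B → + 3 * (B * B) ≡ (A * A + + 3 * (B * B)) - A * A
      identity₇ = solve-∀
      identity₈ : ∀ A B → A * A ≡ (A * A + + 3 * (B * B)) - + 3 * (B * B)
      identity₈ = solve-∀
      A-case : A ≡ 0ℤ ⟨mod l ⟩ → _
      A-case A≡0 = *-nonzero 3≢0 (*-nonzero B≢0 B≢0) (mod-trans (≡⇒mod (identity₇ A B)) (mod-+ e (mod-neg (mod-* A≡0 A≡0))))
        where
        B≢0 : ¬ (B ≡ 0ℤ ⟨mod l ⟩)
        B≢0 B≡0 = not-both (A≡0 , B≡0)
      B-case : B ≡ 0ℤ ⟨mod l ⟩ → _
      B-case B≡0 = *-nonzero A≢0 A≢0 (mod-trans (≡⇒mod (identity₈ A B)) (mod-+ e (mod-neg (mod-*ˡ (+ 3) (mod-* B≡0 B≡0)))))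
        where
        A≢0 : ¬ (A ≡ 0ℤ ⟨mod l ⟩)
        A≢0 A≡0 = not-both (A≡0 , B≡0)

  module CubicSymbolOf {p k : ℕ} (p-prime : Prime p) (p≡ : p ≡ 1 ℕ.+ k ℕ.* 3) (A B C M : ℤ)
    (3∤A : ¬ (A ≡ 0ℤ ⟨mod 3 ⟩)) (3∤C : ¬ (C ≡ 0ℤ ⟨mod 3 ⟩)) (3∤M : ¬ (M ≡ 0ℤ ⟨mod 3 ⟩))
    (coprime : ∀ l → Prime l → C ≡ 0ℤ ⟨mod l ⟩ ⊎ M ≡ 0ℤ ⟨mod l ⟩ →
      A * B ≡ 0ℤ ⟨mod l ⟩ × ¬ (A ≡ 0ℤ ⟨mod l ⟩ × B ≡ 0ℤ ⟨mod l ⟩))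
    (M²p≡C² : M * M * + p ≡ C * C ⟨mod ∣ norm (A +√-3 B) ∣ ⟩)
    (p∤norm : ¬ (norm (A +√-3 B) ≡ 0ℤ ⟨mod p ⟩)) where

    γ : 𝔼
    γ = A +√-3 B

    3∤norm : ¬ (norm γ ≡ 0ℤ ⟨mod 3 ⟩)
    3∤norm e = PrimeModulus.*-nonzero 3-prime 3∤A 3∤A
      (mod-trans (modulo (- (B * B)) (identity A B)) (mod-trans (≡⇒mod (sym (norm-√-3 A B))) e))
      where
      identity : ∀ A B → A * A ≡ A * A + + 3 * (B * B) + (- (B * B)) * + 3
      identity = solve-∀

    γ-factored : Factored γ
    γ-factored = factor (suc ∣ norm γ ∣) γ ℕ.≤-refl 3∤norm

    open Factored γ-factored
    open Evaluation γ primary unit factorises symbol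
    open Symbol symbol

    nonzero : ∀ {t} → ¬ (t ≡ 0ℤ ⟨mod 3 ⟩) → t ≢ 0ℤ
    nonzero 3∤t refl = 3∤t mod-refl

    divisor≢3 : ∀ {l t} → ¬ (t ≡ 0ℤ ⟨mod 3 ⟩) → t ≡ 0ℤ ⟨mod l ⟩ → l ≢ 3
    divisor≢3 3∤t e refl = 3∤t e

    C-determined : Determined C
    C-determined = determined C (nonzero 3∤C) (λ l pr e → ambiguous A B unit factorises symbol pr (divisor≢3 3∤C e)
      (proj₁ (coprime l pr (inj₁ e))) (proj₂ (coprime l pr (inj₁ e))))

    M-determined : Determined M
    M-determined = determined M (nonzero 3∤M) (λ l pr e → ambiguous A B unit factorises symbol pr (divisor≢3 3∤M e)
      (proj₁ (coprime l pr (inj₂ e))) (proj₂ (coprime l pr (inj₂ e))))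

    n m : ℕ
    n = proj₁ C-determined
    m = proj₁ M-determined

    X-M : X M ≡ v ↑ m
    X-M = proj₂ (proj₂ M-determined)

    X-C : X C ≡ v ↑ n
    X-C = proj₂ (proj₂ C-determined)

    v-value : Value v
    v-value = value-⊗ z-value z-value

    v≢0 : v ≢ ι 0ℤ
    v≢0 e = z≢0 (trans (sym (value-fourth z-value)) (trans (cong (λ α → α ⊗ α) e) refl))

    -- From M² p ≡ C² modulo the norm, X(p) = X(C)² / X(M)² = X(M) X(C)², because X(M) is a cube
    -- root of unity.
    X-p : X (+ p) ≡ v ↑ (m ℕ.+ (n ℕ.+ n))
    X-p = begin
      X (+ p)                               ≡⟨ ⊗-identityˡ (X (+ p)) ⟨
      ι 1ℤ ⊗ X (+ p)                        ≡⟨ cong (_⊗ X (+ p)) cube ⟨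
      (X M ⊗ (X M ⊗ X M)) ⊗ X (+ p)         ≡⟨ ⊗-assoc (X M) (X M ⊗ X M) (X (+ p)) ⟩
      X M ⊗ ((X M ⊗ X M) ⊗ X (+ p))         ≡⟨ cong (λ α → X M ⊗ (α ⊗ X (+ p))) (X-⊗ M M) ⟨
      X M ⊗ (X (M * M) ⊗ X (+ p))           ≡⟨ cong (X M ⊗_) (X-⊗ (M * M) (+ p)) ⟨
      X M ⊗ X (M * M * + p)                 ≡⟨ cong (X M ⊗_) (X-periodic periodic) ⟩
      X M ⊗ X (C * C)                       ≡⟨ cong (X M ⊗_) (X-⊗ C C) ⟩
      X M ⊗ (X C ⊗ X C)                     ≡⟨ cong₂ _⊗_ X-M (cong₂ _⊗_ X-C X-C) ⟩
      v ↑ m ⊗ (v ↑ n ⊗ v ↑ n)               ≡⟨ cong (v ↑ m ⊗_) (↑-homo-⊗ v n n) ⟨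
      v ↑ m ⊗ v ↑ (n ℕ.+ n)                 ≡⟨ ↑-homo-⊗ v m (n ℕ.+ n) ⟨
      v ↑ (m ℕ.+ (n ℕ.+ n))                 ∎
      where
      open ≡-Reasoning
      cube : X M ⊗ (X M ⊗ X M) ≡ ι 1ℤ
      cube = value-cube (X-value M) (λ e → ω↑≢0 v-value v≢0 m (trans (sym X-M) e))
      periodic : M * M * + p ≡ C * C ⟨mod ∣ norm primary ∣ ⟩
      periodic = subst (λ N → M * M * + p ≡ C * C ⟨mod ∣ N ∣ ⟩) norm-γ M²p≡C²

    -- The ratio of γ modulo p is z^(2k) X(p) = v^k v^(m+2n) = v^N, and v = z² with z = ω^unit.
    N i : ℕ
    N = k ℕ.+ (m ℕ.+ (n ℕ.+ n))
    i = unit ℕ.* (N ℕ.+ N)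

    symbol-p : γ ↑ k ≈ ω ↑ i ⊗ conj γ ↑ k ⟨mod p ⟩
    symbol-p = Mod.≈-trans p (transfer p k (X (+ p)) (split p-prime (λ e → p∤norm (mod-trans (≡⇒mod norm-γ) e)) k p≡))
      (≡⇒≈ (cong (_⊗ conj γ ↑ k) (trans (cong₂ _⊗_ (sym (↑-distrib-⊗ z z k)) X-p)
        (trans (sym (↑-homo-⊗ v k (m ℕ.+ (n ℕ.+ n)))) (trans (↑-distrib-⊗ z z N)
          (trans (sym (↑-homo-⊗ z N N)) (↑-assocʳ ω unit (N ℕ.+ N))))))))

    i-mod-9 : + 3 * A * + i ≡ - B * (+ p * + p - 1ℤ + C * C - M * M) ⟨mod 9 ⟩
    i-mod-9 = mod-trans (≡⇒mod (cong (λ x → + 3 * A * x) i≡))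
      (exponent-mod-9 A B (+ unit) (+ k) (+ m) (+ n) (+ p * + p) (C * C) (M * M)
        (unit-exponent A B unit (proj₁ rational₃) primary factorises (proj₂ rational₃))
        (subst (λ p → + p * + p ≡ 1ℤ + + 3 * (+ k + + k) ⟨mod 9 ⟩) (sym p≡) (square₉-split k))
        (proj₁ (proj₂ C-determined)) (proj₁ (proj₂ M-determined)))
      where
      i≡ : + i ≡ + unit * ((+ k + (+ m + (+ n + + n))) + (+ k + (+ m + (+ n + + n))))
      i≡ = ℤ.pos-* unit (N ℕ.+ N)

-- Lucas sequences modulo p in terms of powers of α

module LucasSequences where

  open import Algebra.Bundles using (CommutativeRing)
  open import Data.Integer using (ℤ; +_; _+_; _-_; _*_; -_; _^_; 0ℤ; 1ℤ; -1ℤ; ∣_∣)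
  import Data.Integer.Properties as ℤ
  open import Data.Integer.Tactic.RingSolver using (solve-∀)
  open import Data.Nat as ℕ using (ℕ; zero; suc)
  import Data.Nat.Divisibility as ℕ
  open import Data.Nat.Primality using (Prime)
  import Data.Nat.Properties as ℕ
  import Data.Nat.Tactic.RingSolver as ℕSolver
  open import Data.Product using (∃; _,_; proj₁; proj₂)
  open import Data.Sum using ([_,_]′)
  open import Relation.Binary.PropositionalEquality hiding (J)
  open import Relation.Nullary using (contradiction; ¬_)
  open import Defs using (U)
  open EisensteinIntegers
  open FrobeniusMap
  open GroupRings
  open PrimeFields
  open ResidueCharacters
  open JacobiSums
  open CubicSymbols
  open Factorisation
  open AmbiguousPrimes

  -- The Legendre symbol (n / 3), given a recursion parallel to the period of the powers of ω.
  sign₃ : ℕ → ℤ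
  sign₃ 0 = 0ℤ
  sign₃ 1 = 1ℤ
  sign₃ 2 = -1ℤ
  sign₃ (suc (suc (suc n))) = sign₃ n

  ω-periodic : ∀ n → ω ↑ (3 ℕ.+ n) ≡ ω ↑ n
  ω-periodic n = trans (sym (trans (⊗-assoc ω² ω (ω ↑ n)) (⊗-assoc ω ω (ω ⊗ ω ↑ n)))) (⊗-identityˡ (ω ↑ n))

  ω-1+3k : ∀ k → ω ↑ (1 ℕ.+ k ℕ.* 3) ≡ ω
  ω-1+3k zero = refl
  ω-1+3k (suc k) = trans (cong (ω ⊗_) (ω-periodic (k ℕ.* 3))) (ω-1+3k k)

  √-3-⊗ : ∀ A B C D → (A +√-3 B) ⊗ (C +√-3 D) ≡ (A * C - + 3 * (B * D)) +√-3 (A * D + B * C)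
  √-3-⊗ A B C D = cong₂ _+ω_ (real A B C D) (imag A B C D)
    where
    real : ∀ A B C D → (A + B) * (C + D) - (+ 2 * B) * (+ 2 * D) ≡ (A * C - + 3 * (B * D)) + (A * D + B * C)
    real = solve-∀
    imag : ∀ A B C D → (A + B) * (+ 2 * D) + (+ 2 * B) * (C + D) - (+ 2 * B) * (+ 2 * D) ≡ + 2 * (A * D + B * C)
    imag = solve-∀

  √-3-cong : ∀ {l A B C D} → A ≡ C ⟨mod l ⟩ → B ≡ D ⟨mod l ⟩ → (A +√-3 B) ≈ (C +√-3 D) ⟨mod l ⟩
  √-3-cong a b = mod-+ a b ,ω mod-*ˡ (+ 2) b

  module Fermat {p k : ℕ} (p-prime : Prime p) (p≡ : p ≡ 1 ℕ.+ k ℕ.* 3) where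
    open PrimeModulus p-prime
    open Mod p

    private
      module F = Frobenius (𝔼/ p)
      open import Algebra.Properties.Semiring.Exp (CommutativeRing.semiring (𝔼/ p)) using () renaming (_^_ to _↑ₚ_)

      power-agree : ∀ α n → α ↑ₚ n ≡ α ↑ n
      power-agree α zero = refl
      power-agree α (suc n) = cong (α ⊗_) (power-agree α n)

    split-ω : ∀ a b → (a +ω b) ≡ ι a ⊕ ω ⊗ ι b
    split-ω a b = cong₂ _+ω_ (real a b) (imag b)
      where
      real : ∀ a b → a ≡ a + (0ℤ * b - 1ℤ * 0ℤ)
      real = solve-∀
      imag : ∀ b → b ≡ 0ℤ + (0ℤ * 0ℤ + 1ℤ * b - 1ℤ * 0ℤ)
      imag = solve-∀

    -- Frobenius fixes rational integers by Fermat's theorem and fixes ω because p ≡ 1 (mod 3).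
    fermat-𝔼 : ∀ δ → δ ↑ p ≈ δ ⟨mod p ⟩
    fermat-𝔼 δ@(a +ω b) = begin
      δ ↑ p                                ≡⟨ power-agree δ p ⟨
      δ ↑ₚ p                               ≡⟨ cong (_↑ₚ p) (split-ω a b) ⟩
      (ι a ⊕ ω ⊗ ι b) ↑ₚ p                 ≈⟨ F.frobenius p-prime characteristic (ι a) (ω ⊗ ι b) ⟩
      ι a ↑ₚ p ⊕ (ω ⊗ ι b) ↑ₚ p            ≡⟨ cong₂ _⊕_ (power-agree (ι a) p) (power-agree (ω ⊗ ι b) p) ⟩
      ι a ↑ p ⊕ (ω ⊗ ι b) ↑ p              ≡⟨ cong (ι a ↑ p ⊕_) (↑-distrib-⊗ ω (ι b) p) ⟩
      ι a ↑ p ⊕ ω ↑ p ⊗ ι b ↑ p            ≡⟨ cong (λ α → ι a ↑ p ⊕ α ⊗ ι b ↑ p) (trans (cong (ω ↑_) p≡) (ω-1+3k k)) ⟩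
      ι a ↑ p ⊕ ω ⊗ ι b ↑ p                ≡⟨ cong₂ (λ α β → α ⊕ ω ⊗ β) (ι-^ a p) (ι-^ b p) ⟩
      ι (a ^ p) ⊕ ω ⊗ ι (b ^ p)            ≈⟨ ⊕-cong (ι-cong (fermat a)) (⊗-congˡ {ω} (ι-cong (fermat b))) ⟩
      ι a ⊕ ω ⊗ ι b                        ≡⟨ split-ω a b ⟨
      δ                                    ∎
      where
      open import Relation.Binary.Reasoning.Setoid ≈-setoid

    fermat-unit-𝔼 : ∀ δ → ¬ (norm δ ≡ 0ℤ ⟨mod p ⟩) → δ ↑ (k ℕ.* 3) ≈ ι 1ℤ ⟨mod p ⟩
    fermat-unit-𝔼 δ N≢0 = PrimeMod.ι-cancel-mod p-prime N≢0 (begin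
      ι (norm δ) ⊗ δ ↑ (k ℕ.* 3)           ≡⟨ cong (_⊗ δ ↑ (k ℕ.* 3)) (trans (⊗-comm (conj δ) δ) (⊗-conj δ)) ⟨
      (conj δ ⊗ δ) ⊗ δ ↑ (k ℕ.* 3)         ≡⟨ ⊗-assoc (conj δ) δ (δ ↑ (k ℕ.* 3)) ⟩
      conj δ ⊗ δ ↑ (1 ℕ.+ k ℕ.* 3)         ≡⟨ cong (λ q → conj δ ⊗ δ ↑ q) p≡ ⟨
      conj δ ⊗ δ ↑ p                       ≈⟨ ⊗-congˡ {conj δ} (fermat-𝔼 δ) ⟩
      conj δ ⊗ δ                           ≡⟨ trans (⊗-comm (conj δ) δ) (⊗-conj δ) ⟩
      ι (norm δ)                           ≡⟨ ⊗-identityʳ (ι (norm δ)) ⟨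
      ι (norm δ) ⊗ ι 1ℤ                    ∎)
      where
      open import Relation.Binary.Reasoning.Setoid ≈-setoid

  -- The companion sequence V_k(m,1).
  V : ℤ → ℕ → ℤ
  V m k = + 2 * U m 1ℤ (suc k) - m * U m 1ℤ k

  V-suc : ∀ m d n → m * m - d * (n * n) ≡ + 4 → ∀ k → + 2 * V m (suc k) ≡ m * V m k + d * (n * n) * U m 1ℤ k
  V-suc m d n pell k = trans (identity₁ m (U m 1ℤ (suc k)) (U m 1ℤ k))
      (trans (cong (λ x → m * (+ 2 * U m 1ℤ (suc k) - m * U m 1ℤ k) + (m * m - x) * U m 1ℤ k) (sym pell))
        (identity₂ m d n (U m 1ℤ (suc k)) (U m 1ℤ k)))
    where
    identity₁ : ∀ m u v → + 2 * (+ 2 * (m * u - 1ℤ * v) - m * u) ≡ m * (+ 2 * u - m * v) + (m * m - + 4) * v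
    identity₁ = solve-∀
    identity₂ : ∀ m d n u v → m * (+ 2 * u - m * v) + (m * m - (m * m - d * (n * n))) * v ≡ m * (+ 2 * u - m * v) + d * (n * n) * v
    identity₂ = solve-∀

  U-invariant : ∀ m k → U m 1ℤ (suc k) * U m 1ℤ (suc k) - m * U m 1ℤ (suc k) * U m 1ℤ k + U m 1ℤ k * U m 1ℤ k ≡ 1ℤ
  U-invariant m zero = identity m
    where
    identity : ∀ m → 1ℤ * 1ℤ - m * 1ℤ * 0ℤ + 0ℤ * 0ℤ ≡ 1ℤ
    identity = solve-∀
  U-invariant m (suc k) = trans (identity m (U m 1ℤ (suc k)) (U m 1ℤ k)) (U-invariant m k)
    where
    identity : ∀ m u v → (m * u - 1ℤ * v) * (m * u - 1ℤ * v) - m * (m * u - 1ℤ * v) * u + u * u ≡ u * u - m * u * v + v * v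
    identity = solve-∀

  V²-dn²U² : ∀ m d n → m * m - d * (n * n) ≡ + 4 → ∀ k → V m k * V m k - d * (n * n) * (U m 1ℤ k * U m 1ℤ k) ≡ + 4
  V²-dn²U² m d n pell k = trans (identity₁ m (d * (n * n)) (U m 1ℤ (suc k)) (U m 1ℤ k))
      (trans (cong₂ (λ x y → + 4 * x + (y - + 4) * (U m 1ℤ k * U m 1ℤ k)) (U-invariant m k) pell) (identity₂ (U m 1ℤ k)))
    where
    identity₁ : ∀ m e u v → (+ 2 * u - m * v) * (+ 2 * u - m * v) - e * (v * v) ≡ + 4 * (u * u - m * u * v + v * v) + (m * m - e - + 4) * (v * v)
    identity₁ = solve-∀
    identity₂ : ∀ v → + 4 * 1ℤ + (+ 4 - + 4) * (v * v) ≡ + 4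
    identity₂ = solve-∀

  even-exponent : ∀ {p k} → Prime p → p ≡ 1 ℕ.+ k ℕ.* 3 → ¬ (+ 2 ≡ 0ℤ ⟨mod p ⟩) → ∃ λ h → k ≡ h ℕ.+ h
  even-exponent {p} {k} p-prime p≡ 2≢0 = [ (λ even → even) , (λ (h , odd) → contradiction (2≡0 h odd) 2≢0) ]′ (parity k)
    where
    arith : ∀ h → 1 ℕ.+ suc (h ℕ.+ h) ℕ.* 3 ≡ (2 ℕ.+ h ℕ.* 3) ℕ.* 2
    arith = ℕSolver.solve-∀
    2≡0 : ∀ h → k ≡ suc (h ℕ.+ h) → + 2 ≡ 0ℤ ⟨mod p ⟩
    2≡0 h odd = ∣⇒≡0 {a = + 2} (ℕ.∣-reflexive (even-prime p-prime
      (ℕ.divides (2 ℕ.+ h ℕ.* 3) (trans p≡ (trans (cong (λ k → 1 ℕ.+ k ℕ.* 3) odd) (arith h))))))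

  module Lucas {p k : ℕ} (p-prime : Prime p) (p≡ : p ≡ 1 ℕ.+ k ℕ.* 3) (m n d x y : ℤ)
    (pell : m * m - d * (n * n) ≡ + 4) (p∣form : x * x + + 3 * d * (y * y) ≡ 0ℤ ⟨mod p ⟩)
    (2≢0 : ¬ (+ 2 ≡ 0ℤ ⟨mod p ⟩)) (3≢0 : ¬ (+ 3 ≡ 0ℤ ⟨mod p ⟩)) (y≢0 : ¬ (y ≡ 0ℤ ⟨mod p ⟩)) where
    open PrimeModulus p-prime
    open PrimeMod p-prime
    open Mod p
    open Fermat {p} {k} p-prime p≡

    α T : 𝔼
    α = (n * x) +√-3 (m * y)
    T = 0ℤ +√-3 (+ 2 * y)

    -- Modulo p this is T ε^j: multiplying ε^j = (V_j + n U_j √d) / 2 by T = 2 y √-3 and using √d =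
    -- x / (y √-3) gives n x U_j + y V_j √-3.
    Z : ℕ → 𝔼
    Z j = (n * x * U m 1ℤ j) +√-3 (y * V m j)

    Z-suc : ∀ j → Z j ⊗ α ≈ T ⊗ Z (suc j) ⟨mod p ⟩
    Z-suc j = ≈-trans (≡⇒≈ (√-3-⊗ (n * x * u) (y * v) (n * x) (m * y))) (≈-trans (√-3-cong real imag)
      (≡⇒≈ (sym (√-3-⊗ 0ℤ (+ 2 * y) (n * x * u′) (y * v′)))))
      where
      u = U m 1ℤ j
      v = V m j
      u′ = U m 1ℤ (suc j)
      v′ = V m (suc j)
      identity₁ : ∀ m n d x y u v → n * x * u * (n * x) - + 3 * (y * v * (m * y))
        ≡ n * n * u * (x * x + + 3 * d * (y * y)) + - (+ 3 * (y * y)) * (m * v + d * (n * n) * u)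
      identity₁ = solve-∀
      identity₂ : ∀ n x y u v c → n * n * u * 0ℤ + - (+ 3 * (y * y)) * (+ 2 * v) ≡ 0ℤ * (n * x * c) - + 3 * (+ 2 * y * (y * v))
      identity₂ = solve-∀
      real : n * x * u * (n * x) - + 3 * (y * v * (m * y)) ≡ 0ℤ * (n * x * u′) - + 3 * (+ 2 * y * (y * v′)) ⟨mod p ⟩
      real = mod-trans (≡⇒mod (identity₁ m n d x y u v)) (mod-trans
        (mod-+ (mod-*ˡ (n * n * u) p∣form) (≡⇒mod (cong (λ z → - (+ 3 * (y * y)) * z) (sym (V-suc m d n pell j)))))
        (≡⇒mod (identity₂ n x y u v′ u′)))
      identity₃ : ∀ m n x y u u′ v′ → n * x * u * (m * y) + y * (+ 2 * u′ - m * u) * (n * x) ≡ 0ℤ * (y * v′) + + 2 * y * (n * x * u′)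
      identity₃ = solve-∀
      imag : n * x * u * (m * y) + y * v * (n * x) ≡ 0ℤ * (y * v′) + + 2 * y * (n * x * u′) ⟨mod p ⟩
      imag = ≡⇒mod (identity₃ m n x y u u′ v′)

    power-formula : ∀ j → T ⊗ α ↑ j ≈ T ↑ j ⊗ Z j ⟨mod p ⟩
    power-formula zero = ≡⇒≈ (trans (⊗-identityʳ T) (trans (cong₂ _+√-3_ (identity₁ n x) (identity₂ m y)) (sym (⊗-identityˡ (Z 0)))))
      where
      identity₁ : ∀ n x → 0ℤ ≡ n * x * 0ℤ
      identity₁ = solve-∀
      identity₂ : ∀ m y → + 2 * y ≡ y * (+ 2 * 1ℤ - m * 0ℤ)
      identity₂ = solve-∀
    power-formula (suc j) = begin
      T ⊗ (α ⊗ α ↑ j)            ≡⟨ trans (cong (T ⊗_) (⊗-comm α (α ↑ j))) (sym (⊗-assoc T (α ↑ j) α)) ⟩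
      (T ⊗ α ↑ j) ⊗ α            ≈⟨ ⊗-congʳ {α} (power-formula j) ⟩
      (T ↑ j ⊗ Z j) ⊗ α          ≡⟨ ⊗-assoc (T ↑ j) (Z j) α ⟩
      T ↑ j ⊗ (Z j ⊗ α)          ≈⟨ ⊗-congˡ {T ↑ j} (Z-suc j) ⟩
      T ↑ j ⊗ (T ⊗ Z (suc j))    ≡⟨ trans (sym (⊗-assoc (T ↑ j) T (Z (suc j)))) (cong (_⊗ Z (suc j)) (⊗-comm (T ↑ j) T)) ⟩
      (T ⊗ T ↑ j) ⊗ Z (suc j)    ∎
      where
      open import Relation.Binary.Reasoning.Setoid ≈-setoid

    k-even : ∃ λ h → k ≡ h ℕ.+ h
    k-even = even-exponent p-prime p≡ 2≢0

    -- The value of T^k: it is rational because k is even and T² = - 12 y².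
    c : ℤ
    c = (- (+ 12) * (y * y)) ^ proj₁ k-even

    T² : T ⊗ T ≡ ι (- (+ 12) * (y * y))
    T² = trans (√-3-⊗ 0ℤ (+ 2 * y) 0ℤ (+ 2 * y)) (cong₂ _+ω_ (real y) (imag y))
      where
      real : ∀ y → 0ℤ * 0ℤ - + 3 * (+ 2 * y * (+ 2 * y)) + (0ℤ * (+ 2 * y) + + 2 * y * 0ℤ) ≡ - (+ 12) * (y * y)
      real = solve-∀
      imag : ∀ y → + 2 * (0ℤ * (+ 2 * y) + + 2 * y * 0ℤ) ≡ 0ℤ
      imag = solve-∀

    T↑k : T ↑ k ≡ ι c
    T↑k = trans (cong (T ↑_) (proj₂ k-even)) (trans (↑-homo-⊗ T h h) (trans (sym (↑-distrib-⊗ T T h))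
      (trans (cong (_↑ h) T²) (ι-^ (- (+ 12) * (y * y)) h))))
      where
      h = proj₁ k-even

    -12y²≢0 : ¬ (- (+ 12) * (y * y) ≡ 0ℤ ⟨mod p ⟩)
    -12y²≢0 e = *-nonzero (*-nonzero 2≢0 2≢0) (*-nonzero 3≢0 (*-nonzero y≢0 y≢0))
      (mod-trans (≡⇒mod (identity y)) (mod-neg e))
      where
      identity : ∀ y → + 2 * + 2 * (+ 3 * (y * y)) ≡ - (- (+ 12) * (y * y))
      identity = solve-∀

    c≢0 : ¬ (c ≡ 0ℤ ⟨mod p ⟩)
    c≢0 = ^-nonzero (proj₁ k-even) -12y²≢0

    conj-T : conj T ≡ ⊖ T
    conj-T = trans (conj-√-3 0ℤ (+ 2 * y)) (cong₂ _+ω_ (real y) (imag y))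
      where
      real : ∀ y → 0ℤ + - (+ 2 * y) ≡ - (0ℤ + + 2 * y)
      real = solve-∀
      imag : ∀ y → + 2 * - (+ 2 * y) ≡ - (+ 2 * (+ 2 * y))
      imag = solve-∀

    ⊖-⊗ : ∀ β γ → ⊖ (β ⊗ γ) ≡ ⊖ β ⊗ γ
    ⊖-⊗ = -‿distribˡ-*
      where open import Algebra.Properties.Ring (CommutativeRing.ring 𝔼-ring)

    ⊖-⊗ʳ : ∀ β γ → ⊖ (β ⊗ γ) ≡ β ⊗ ⊖ γ
    ⊖-⊗ʳ = -‿distribʳ-*
      where open import Algebra.Properties.Ring (CommutativeRing.ring 𝔼-ring)

    conj-formula : T ⊗ conj α ↑ k ≈ ⊖ (ι c ⊗ conj (Z k)) ⟨mod p ⟩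
    conj-formula = ≈-trans (≡⇒≈ (trans (double-⊖ (T ⊗ conj α ↑ k)) (cong ⊖_ shape))) (⊖-cong (≈-trans (conj-cong (power-formula k))
      (≡⇒≈ (trans (conj-⊗ (T ↑ k) (Z k)) (cong (_⊗ conj (Z k)) (trans (cong conj T↑k) (conj-ι c)))))))
      where
      double-⊖ : ∀ β → β ≡ ⊖ (⊖ β)
      double-⊖ (a +ω b) = cong₂ _+ω_ (sym (ℤ.neg-involutive a)) (sym (ℤ.neg-involutive b))
      shape : ⊖ (T ⊗ conj α ↑ k) ≡ conj (T ⊗ α ↑ k)
      shape = trans (⊖-⊗ T (conj α ↑ k)) (sym (trans (conj-⊗ T (α ↑ k)) (cong₂ _⊗_ conj-T (conj-↑ α k))))
      ⊖-cong : ∀ {β γ} → β ≈ γ ⟨mod p ⟩ → ⊖ β ≈ ⊖ γ ⟨mod p ⟩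
      ⊖-cong (r ,ω i) = mod-neg r ,ω mod-neg i

    -- Here c Z(k) = T α^k, and since conj(T) = - T, conjugation gives T conj(α)^k = - c conj(Z(k)).
    -- Cancelling c turns the cubic symbol W into a linear condition on the coordinates of Z(k).
    reflection : ∀ W → α ↑ k ≈ W ⊗ conj α ↑ k ⟨mod p ⟩ → Z k ≈ ⊖ (W ⊗ conj (Z k)) ⟨mod p ⟩
    reflection W e = ι-cancel-mod c≢0 (begin
      ι c ⊗ Z k                       ≡⟨ cong (_⊗ Z k) T↑k ⟨
      T ↑ k ⊗ Z k                     ≈⟨ power-formula k ⟨
      T ⊗ α ↑ k                       ≈⟨ ⊗-congˡ {T} e ⟩
      T ⊗ (W ⊗ conj α ↑ k)            ≡⟨ trans (sym (⊗-assoc T W _)) (trans (cong (_⊗ conj α ↑ k) (⊗-comm T W)) (⊗-assoc W T _)) ⟩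
      W ⊗ (T ⊗ conj α ↑ k)            ≈⟨ ⊗-congˡ {W} conj-formula ⟩
      W ⊗ ⊖ (ι c ⊗ conj (Z k))        ≡⟨ cong (W ⊗_) (⊖-⊗ʳ (ι c) (conj (Z k))) ⟩
      W ⊗ (ι c ⊗ ⊖ conj (Z k))        ≡⟨ trans (sym (⊗-assoc W (ι c) _)) (trans (cong (_⊗ ⊖ conj (Z k)) (⊗-comm W (ι c))) (⊗-assoc (ι c) W _)) ⟩
      ι c ⊗ (W ⊗ ⊖ conj (Z k))        ≡⟨ cong (ι c ⊗_) (⊖-⊗ʳ W (conj (Z k))) ⟨
      ι c ⊗ ⊖ (W ⊗ conj (Z k))        ∎)
      where
      open import Relation.Binary.Reasoning.Setoid ≈-setoid

    module _ (p∤α : ¬ (norm α ≡ 0ℤ ⟨mod p ⟩)) where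

      p∤T : ¬ (norm T ≡ 0ℤ ⟨mod p ⟩)
      p∤T e = -12y²≢0 (mod-trans (≡⇒mod (identity y)) (mod-neg (mod-trans (≡⇒mod (sym (norm-√-3 0ℤ (+ 2 * y)))) e)))
        where
        identity : ∀ y → - (+ 12) * (y * y) ≡ - (0ℤ * 0ℤ + + 3 * (+ 2 * y * (+ 2 * y)))
        identity = solve-∀

      -- The linear condition determines Z(k) only up to a rational factor. Cubing T α^k = T^k Z(k)
      -- fixes the scale, because 3 k = p - 1 makes the 3 k-th powers of α and T equal to 1.
      Z-cube : T ↑ 3 ≈ Z k ↑ 3 ⟨mod p ⟩
      Z-cube = begin
        T ↑ 3                        ≡⟨ ⊗-identityʳ (T ↑ 3) ⟨
        T ↑ 3 ⊗ ι 1ℤ                 ≈⟨ ⊗-congˡ {T ↑ 3} (fermat-unit-𝔼 α p∤α) ⟨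
        T ↑ 3 ⊗ α ↑ (k ℕ.* 3)        ≡⟨ cong (T ↑ 3 ⊗_) (↑-assocʳ α k 3) ⟨
        T ↑ 3 ⊗ (α ↑ k) ↑ 3          ≡⟨ ↑-distrib-⊗ T (α ↑ k) 3 ⟨
        (T ⊗ α ↑ k) ↑ 3              ≈⟨ ↑-cong 3 (power-formula k) ⟩
        (T ↑ k ⊗ Z k) ↑ 3            ≡⟨ ↑-distrib-⊗ (T ↑ k) (Z k) 3 ⟩
        (T ↑ k) ↑ 3 ⊗ Z k ↑ 3        ≡⟨ cong (_⊗ Z k ↑ 3) (↑-assocʳ T k 3) ⟩
        T ↑ (k ℕ.* 3) ⊗ Z k ↑ 3      ≈⟨ ⊗-congʳ {Z k ↑ 3} (fermat-unit-𝔼 T p∤T) ⟩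
        ι 1ℤ ⊗ Z k ↑ 3               ≡⟨ ⊗-identityˡ (Z k ↑ 3) ⟩
        Z k ↑ 3                      ∎
        where
        open import Relation.Binary.Reasoning.Setoid ≈-setoid

      √-3-cube : ∀ A B → (A +√-3 B) ↑ 3 ≡ (A * A * A - + 9 * A * (B * B)) +√-3 (+ 3 * (A * A) * B - + 3 * (B * B * B))
      √-3-cube A B = trans (cong (λ γ → (A +√-3 B) ⊗ ((A +√-3 B) ⊗ γ)) (⊗-identityʳ (A +√-3 B)))
        (trans (cong ((A +√-3 B) ⊗_) (√-3-⊗ A B A B)) (trans (√-3-⊗ A B (A * A - + 3 * (B * B)) (A * B + B * A)) (cong₂ _+√-3_ (real A B) (imag A B))))
        where
        real : ∀ A B → A * (A * A - + 3 * (B * B)) - + 3 * (B * (A * B + B * A)) ≡ A * A * A - + 9 * A * (B * B)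
        real = solve-∀
        imag : ∀ A B → A * (A * B + B * A) + B * (A * A - + 3 * (B * B)) ≡ + 3 * (A * A) * B - + 3 * (B * B * B)
        imag = solve-∀

      a b : ℤ
      a = n * x * U m 1ℤ k
      b = y * V m k

      -- If a = ± 3 b then T³ = Z³ reads b³ = - y³, while a² = 9 b² gives V² = 1.
      V≡-1 : ∀ e → e * e ≡ + 9 → a ≡ e * b ⟨mod p ⟩ → V m k ≡ - 1ℤ ⟨mod p ⟩
      V≡-1 e e² a≡eb = mod-trans (≡⇒mod (sym (ℤ.*-identityˡ v))) (mod-trans (mod-*ʳ v (mod-sym V²≡1)) V³≡-1)
        where
        v u : ℤ
        v = V m k
        u = U m 1ℤ k
        cube-im : + 2 * (+ 3 * (0ℤ * 0ℤ) * (+ 2 * y) - + 3 * (+ 2 * y * (+ 2 * y) * (+ 2 * y)))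
          ≡ + 2 * (+ 3 * (a * a) * b - + 3 * (b * b * b)) ⟨mod p ⟩
        cube-im = im≡ {α = (0ℤ * 0ℤ * 0ℤ - + 9 * 0ℤ * (+ 2 * y * (+ 2 * y))) +√-3 (+ 3 * (0ℤ * 0ℤ) * (+ 2 * y) - + 3 * (+ 2 * y * (+ 2 * y) * (+ 2 * y)))}
          {β = (a * a * a - + 9 * a * (b * b)) +√-3 (+ 3 * (a * a) * b - + 3 * (b * b * b))}
          (≈-trans (≡⇒≈ (sym (√-3-cube 0ℤ (+ 2 * y)))) (≈-trans Z-cube (≡⇒≈ (√-3-cube a b))))
        a²≡ : a * a ≡ + 9 * (b * b) ⟨mod p ⟩
        a²≡ = mod-trans (mod-* a≡eb a≡eb) (≡⇒mod (trans (regroup e b) (cong (_* (b * b)) e²)))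
          where
          regroup : ∀ e b → e * b * (e * b) ≡ e * e * (b * b)
          regroup = solve-∀
        V³≡-1 : v * v * v ≡ - 1ℤ ⟨mod p ⟩
        V³≡-1 = cancelˡ (+ 2 * + 2 * (+ 2 * + 2) * (+ 3 * (y * y * y))) (*-nonzero (*-nonzero (*-nonzero 2≢0 2≢0) (*-nonzero 2≢0 2≢0)) (*-nonzero 3≢0 (*-nonzero (*-nonzero y≢0 y≢0) y≢0)))
          (mod-trans (≡⇒mod (expand y v)) (mod-trans (mod-sym (compare a b a²≡)) (mod-trans (mod-sym cube-im) (≡⇒mod (collect y)))))
          where
          expand : ∀ y v → + 2 * + 2 * (+ 2 * + 2) * (+ 3 * (y * y * y)) * (v * v * v)
            ≡ + 2 * (+ 3 * (+ 9 * (y * v * (y * v))) * (y * v) - + 3 * (y * v * (y * v) * (y * v)))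
          expand = solve-∀
          collect : ∀ y → + 2 * (+ 3 * (0ℤ * 0ℤ) * (+ 2 * y) - + 3 * (+ 2 * y * (+ 2 * y) * (+ 2 * y)))
            ≡ + 2 * + 2 * (+ 2 * + 2) * (+ 3 * (y * y * y)) * - 1ℤ
          collect = solve-∀
          compare : ∀ a b → a * a ≡ + 9 * (b * b) ⟨mod p ⟩ → + 2 * (+ 3 * (a * a) * b - + 3 * (b * b * b))
            ≡ + 2 * (+ 3 * (+ 9 * (b * b)) * b - + 3 * (b * b * b)) ⟨mod p ⟩
          compare a b e = mod-*ˡ (+ 2) (mod-+ʳ (- (+ 3 * (b * b * b))) (mod-*ʳ b (mod-*ˡ (+ 3) e)))
        V²≡1 : v * v ≡ 1ℤ ⟨mod p ⟩
        V²≡1 = cancelˡ (+ 3 * (y * y) * (+ 2 * + 2)) (*-nonzero (*-nonzero 3≢0 (*-nonzero y≢0 y≢0)) (*-nonzero 2≢0 2≢0))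
          (mod-trans (≡⇒mod (rearrange y v)) (mod-trans (mod-+ˡ (+ 3 * (y * y) * (v * v)) (mod-sym square)) (mod-trans (≡⇒mod (gather d n x y u v))
            (mod-trans (mod-+ˡ (+ 3 * (y * y) * (v * v - d * (n * n) * (u * u))) (mod-*ˡ (n * n * (u * u)) p∣form))
              (≡⇒mod (trans (cong (λ z → + 3 * (y * y) * z + n * n * (u * u) * 0ℤ) (V²-dn²U² m d n pell k)) (finish y n u)))))))
          where
          square : n * x * u * (n * x * u) ≡ + 9 * (y * v * (y * v)) ⟨mod p ⟩
          square = a²≡
          rearrange : ∀ y v → + 3 * (y * y) * (+ 2 * + 2) * (v * v) ≡ + 3 * (y * y) * (v * v) + + 9 * (y * v * (y * v))
          rearrange = solve-∀
          gather : ∀ d n x y u v → + 3 * (y * y) * (v * v) + n * x * u * (n * x * u)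
            ≡ + 3 * (y * y) * (v * v - d * (n * n) * (u * u)) + n * n * (u * u) * (x * x + + 3 * d * (y * y))
          gather = solve-∀
          finish : ∀ y n u → + 3 * (y * y) * + 4 + n * n * (u * u) * 0ℤ ≡ + 3 * (y * y) * (+ 2 * + 2) * 1ℤ
          finish = solve-∀

      -- For W = 1, ω, ω² the condition Z = - W conj(Z) reads a = 0, a = - 3 b, a = 3 b. In the last
      -- two cases V ≡ - 1, so b = - y.
      lucas-value : ∀ i → α ↑ k ≈ ω ↑ i ⊗ conj α ↑ k ⟨mod p ⟩ → a ≡ + 3 * y * sign₃ i ⟨mod p ⟩
      lucas-value (suc (suc (suc i))) e = lucas-value i (≈-trans e (≡⇒≈ (cong (_⊗ conj α ↑ k) (ω-periodic i))))
      lucas-value 0 e = solve-0 a b y (re≡ reflected) (im≡ reflected)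
        where
        reflected : (a +√-3 b) ≈ ⊖ (ι 1ℤ ⊗ conj (a +√-3 b)) ⟨mod p ⟩
        reflected = reflection (ι 1ℤ) e
        solve-0 : ∀ a b y → a + b ≡ - (1ℤ * (a + b - + 2 * b) - 0ℤ * (- (+ 2 * b))) ⟨mod p ⟩ →
          + 2 * b ≡ - (1ℤ * (- (+ 2 * b)) + 0ℤ * (a + b - + 2 * b) - 0ℤ * (- (+ 2 * b))) ⟨mod p ⟩ → a ≡ + 3 * y * 0ℤ ⟨mod p ⟩
        solve-0 a b y e _ = cancelˡ (+ 2) 2≢0 (mod-trans (≡⇒mod (id₁ a b)) (mod-trans (mod-+ʳ (a - b) e) (≡⇒mod (id₂ a b y))))
          where
          id₁ : ∀ a b → + 2 * a ≡ a + b + (a - b)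
          id₁ = solve-∀
          id₂ : ∀ a b y → - (1ℤ * (a + b - + 2 * b) - 0ℤ * (- (+ 2 * b))) + (a - b) ≡ + 2 * (+ 3 * y * 0ℤ)
          id₂ = solve-∀
      lucas-value 1 e = mod-trans a≡-3b (mod-trans (≡⇒mod (regroup y (V m k))) (mod-trans (mod-*ˡ (- (+ 3) * y) (V≡-1 (- (+ 3)) refl a≡-3b)) (≡⇒mod (finish y))))
        where
        reflected : (a +√-3 b) ≈ ⊖ (ω ⊗ conj (a +√-3 b)) ⟨mod p ⟩
        reflected = reflection ω e
        solve-1 : ∀ a b → + 2 * b ≡ - (0ℤ * (- (+ 2 * b)) + 1ℤ * (a + b - + 2 * b) - 1ℤ * (- (+ 2 * b))) ⟨mod p ⟩ → a ≡ - (+ 3) * b ⟨mod p ⟩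
        solve-1 a b e = mod-trans (≡⇒mod (id₁ a b)) (mod-trans (mod-neg (mod-+ʳ b (mod-sym e))) (≡⇒mod (id₂ b)))
          where
          id₁ : ∀ a b → a ≡ - (- (0ℤ * (- (+ 2 * b)) + 1ℤ * (a + b - + 2 * b) - 1ℤ * (- (+ 2 * b))) + b)
          id₁ = solve-∀
          id₂ : ∀ b → - (+ 2 * b + b) ≡ - (+ 3) * b
          id₂ = solve-∀
        a≡-3b : a ≡ - (+ 3) * b ⟨mod p ⟩
        a≡-3b = solve-1 a b (im≡ reflected)
        regroup : ∀ y v → - (+ 3) * (y * v) ≡ - (+ 3) * y * v
        regroup = solve-∀
        finish : ∀ y → - (+ 3) * y * - 1ℤ ≡ + 3 * y * 1ℤ
        finish = solve-∀
      lucas-value 2 e = mod-trans a≡3b (mod-trans (≡⇒mod (regroup y (V m k))) (mod-*ˡ (+ 3 * y) (V≡-1 (+ 3) refl a≡3b)))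
        where
        reflected : (a +√-3 b) ≈ ⊖ (ω² ⊗ conj (a +√-3 b)) ⟨mod p ⟩
        reflected = reflection ω² e
        solve-2 : ∀ a b → + 2 * b ≡ - (-1ℤ * (- (+ 2 * b)) + -1ℤ * (a + b - + 2 * b) - -1ℤ * (- (+ 2 * b))) ⟨mod p ⟩ → a ≡ + 3 * b ⟨mod p ⟩
        solve-2 a b e = mod-trans (≡⇒mod (id₁ a b)) (mod-trans (mod-+ʳ b (mod-sym e)) (≡⇒mod (id₂ b)))
          where
          id₁ : ∀ a b → a ≡ - (-1ℤ * (- (+ 2 * b)) + -1ℤ * (a + b - + 2 * b) - -1ℤ * (- (+ 2 * b))) + b
          id₁ = solve-∀
          id₂ : ∀ b → + 2 * b + b ≡ + 3 * b
          id₂ = solve-∀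
        a≡3b : a ≡ + 3 * b ⟨mod p ⟩
        a≡3b = solve-2 a b (im≡ reflected)
        regroup : ∀ y v → + 3 * (y * v) ≡ + 3 * y * v
        regroup = solve-∀

      -- The known quantity is n x U. Multiplying it by x and replacing x² by - 3 d y² produces the
      -- denominator d n y; the minus sign comes from this replacement.
      U-value : ∀ i → α ↑ k ≈ ω ↑ i ⊗ conj α ↑ k ⟨mod p ⟩ → U m 1ℤ k * (d * n * y) ≡ - sign₃ i * x ⟨mod p ⟩
      U-value i e = cancelˡ (+ 3 * y) (*-nonzero 3≢0 y≢0) (mod-trans (modulo₁ (lucas-value i e)) (≡⇒mod (id₂ x y (sign₃ i))))
        where
        u = U m 1ℤ k
        id₁ : ∀ d n x y u → + 3 * y * (u * (d * n * y)) ≡ n * u * (x * x + + 3 * d * (y * y)) - x * (n * x * u)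
        id₁ = solve-∀
        id₂ : ∀ x y s → n * u * 0ℤ - x * (+ 3 * y * s) ≡ + 3 * y * (- s * x)
        id₂ x y s = id₃ (n * u) x y s
          where
          id₃ : ∀ t x y s → t * 0ℤ - x * (+ 3 * y * s) ≡ + 3 * y * (- s * x)
          id₃ = solve-∀
        modulo₁ : n * x * u ≡ + 3 * y * sign₃ i ⟨mod p ⟩ → + 3 * y * (u * (d * n * y)) ≡ n * u * 0ℤ - x * (+ 3 * y * sign₃ i) ⟨mod p ⟩
        modulo₁ e = mod-trans (≡⇒mod (id₁ d n x y u)) (mod-+ (mod-*ˡ (n * u) p∣form) (mod-neg (mod-*ˡ x e)))

-- Common factors of the Pell solution and the two computations modulo 9

module PellReduction where

  open import Data.Fin as Fin using (Fin)
  open import Data.Integer using (ℤ; +_; _+_; _-_; _*_; -_; 0ℤ; 1ℤ; ∣_∣)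
  import Data.Integer.Properties as ℤ
  open import Data.Integer.Divisibility.Signed using () renaming (divides to dividesₛ)
  open import Data.Integer.Tactic.RingSolver using (solve-∀)
  open import Data.Nat as ℕ using (ℕ; zero; suc)
  import Data.Nat.Divisibility as ℕ
  open import Data.Nat.GCD using (gcd; gcd[m,n]∣m; gcd[m,n]∣n; gcd-greatest)
  open import Data.Nat.Primality using (Prime; prime?; prime⇒irreducible; prime⇒nonTrivial)
  import Data.Nat.Properties as ℕ
  open import Data.Product using (_,_; _×_; proj₁; proj₂)
  open import Data.Sum using ([_,_]′)
  open import Relation.Binary.PropositionalEquality hiding (J)
  open import Relation.Nullary using (Dec; yes; no; contradiction; ¬_)
  open import Relation.Nullary.Decidable using (from-yes)
  open import Defs using (Squarefree)
  open EisensteinIntegers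
  open GroupRings
  open PrimeFields
  open CubicSymbols using (3-prime)

  2-prime : Prime 2
  2-prime = from-yes (prime? 2)

  module ℤ/2 = PrimeModulus 2-prime
  module ℤ/3 = PrimeModulus 3-prime

  odd⇒1 : ∀ t → ¬ (t ≡ 0ℤ ⟨mod 2 ⟩) → t ≡ 1ℤ ⟨mod 2 ⟩
  odd⇒1 t t≢0 = go (residue t) (rep-residue t)
    where
    open Residue 2
    go : ∀ i → rep i ≡ t ⟨mod 2 ⟩ → t ≡ 1ℤ ⟨mod 2 ⟩
    go Fin.zero e = contradiction (mod-sym e) t≢0
    go (Fin.suc Fin.zero) e = mod-sym e

  square≡1 : ∀ t → ¬ (t ≡ 0ℤ ⟨mod 3 ⟩) → t * t ≡ 1ℤ ⟨mod 3 ⟩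
  square≡1 t t≢0 = go (residue t) (rep-residue t)
    where
    open Residue 3
    go : ∀ i → rep i ≡ t ⟨mod 3 ⟩ → t * t ≡ 1ℤ ⟨mod 3 ⟩
    go Fin.zero e = contradiction (mod-sym e) t≢0
    go (Fin.suc Fin.zero) e = mod-* (mod-sym e) (mod-sym e)
    go (Fin.suc (Fin.suc Fin.zero)) e = mod-trans (mod-* (mod-sym e) (mod-sym e)) (modulo 1ℤ refl)

  factor-nonzero : ∀ {l} a b → ¬ (a * b ≡ 0ℤ ⟨mod l ⟩) → ¬ (a ≡ 0ℤ ⟨mod l ⟩) × ¬ (b ≡ 0ℤ ⟨mod l ⟩)
  factor-nonzero a b ab≢0 =
    (λ e → ab≢0 (mod-trans (mod-*ʳ b e) (≡⇒mod (ℤ.*-zeroˡ b)))) ,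
    (λ e → ab≢0 (mod-trans (mod-*ˡ a e) (≡⇒mod (ℤ.*-zeroʳ a))))

  multiple≡0 : ∀ {l} a {b} → b ≡ 0ℤ ⟨mod l ⟩ → a * b ≡ 0ℤ ⟨mod l ⟩
  multiple≡0 a e = mod-trans (mod-*ˡ a e) (≡⇒mod (ℤ.*-zeroʳ a))

  multiple≡0ʳ : ∀ {l a} b → a ≡ 0ℤ ⟨mod l ⟩ → a * b ≡ 0ℤ ⟨mod l ⟩
  multiple≡0ʳ b e = mod-trans (mod-*ʳ b e) (≡⇒mod (ℤ.*-zeroˡ b))

  squarefree-multiple : ∀ {d} → Squarefree d → ∀ k → ∣ k ∣ ≢ 1 → ∀ q → d ≢ q * (k * k)
  squarefree-multiple sqf k k≢1 q e = k≢1 (sqf k (dividesₛ q e))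

  -- Removing a common factor 2 from (m , n): e = 2, c = 1 if both are even, and e = 1, c = 2 otherwise.
  record Reduced (d m n : ℤ) : Set where
    field
      e c μ ν : ℤ
      m≡      : m ≡ e * μ
      n≡      : n ≡ e * ν
      ec≡2    : e * c ≡ + 2
      pell    : μ * μ - d * (ν * ν) ≡ c * c
      coprime : ∀ {l} → Prime l → μ ≡ 0ℤ ⟨mod l ⟩ → ¬ (ν ≡ 0ℤ ⟨mod l ⟩)
      even-c  : ∀ {l} → Prime l → c ≡ 0ℤ ⟨mod l ⟩ →
                l ≡ 2 × ¬ (μ ≡ 0ℤ ⟨mod 2 ⟩) × ¬ (ν ≡ 0ℤ ⟨mod 2 ⟩) × ¬ (d ≡ 0ℤ ⟨mod 2 ⟩)

  module _ {d m n : ℤ} (sqf : Squarefree d) (pell : m * m - d * (n * n) ≡ + 4) where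

    private
      common⇒c : ∀ {l} μ ν c → μ * μ - d * (ν * ν) ≡ c * c → μ ≡ 0ℤ ⟨mod l ⟩ → ν ≡ 0ℤ ⟨mod l ⟩ → c * c ≡ 0ℤ ⟨mod l ⟩
      common⇒c μ ν c pell₀ μ≡0 ν≡0 = mod-trans (≡⇒mod (sym pell₀)) (mod-trans
        (mod-+ (mod-* μ≡0 μ≡0) (mod-neg (mod-*ˡ d (mod-* ν≡0 ν≡0)))) (≡⇒mod (vanish d)))
        where
        vanish : ∀ d → 0ℤ * 0ℤ + - (d * (0ℤ * 0ℤ)) ≡ 0ℤ
        vanish = solve-∀

      both-even : m ≡ 0ℤ ⟨mod 2 ⟩ → n ≡ 0ℤ ⟨mod 2 ⟩ → Reduced d m n
      both-even (modulo μ m≡) (modulo ν n≡) = record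
        { e = + 2 ; c = 1ℤ ; μ = μ ; ν = ν
        ; m≡ = trans m≡ (swap μ) ; n≡ = trans n≡ (swap ν) ; ec≡2 = refl
        ; pell = pell₀
        ; coprime = λ pr μ≡0 ν≡0 → PrimeModulus.1≢0 pr (common⇒c μ ν 1ℤ pell₀ μ≡0 ν≡0)
        ; even-c = λ pr 1≡0 → contradiction 1≡0 (PrimeModulus.1≢0 pr) }
        where
        swap : ∀ μ → 0ℤ + μ * + 2 ≡ + 2 * μ
        swap = solve-∀
        quadruple : ∀ d μ ν → + 4 * (μ * μ - d * (ν * ν)) ≡ (0ℤ + μ * + 2) * (0ℤ + μ * + 2) - d * ((0ℤ + ν * + 2) * (0ℤ + ν * + 2))
        quadruple = solve-∀
        pell₀ : μ * μ - d * (ν * ν) ≡ 1ℤ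
        pell₀ = ℤ.*-cancelˡ-≡ (+ 4) (μ * μ - d * (ν * ν)) 1ℤ (trans (quadruple d μ ν)
          (trans (cong₂ (λ x y → x * x - d * (y * y)) (sym m≡) (sym n≡)) pell))

      not-both-even : ¬ (m ≡ 0ℤ ⟨mod 2 ⟩ × n ≡ 0ℤ ⟨mod 2 ⟩) → Reduced d m n
      not-both-even not-both = record
        { e = 1ℤ ; c = + 2 ; μ = m ; ν = n
        ; m≡ = sym (ℤ.*-identityˡ m) ; n≡ = sym (ℤ.*-identityˡ n) ; ec≡2 = refl
        ; pell = pell
        ; coprime = λ pr m≡0 n≡0 → coprime pr m≡0 n≡0
        ; even-c = λ pr 2≡0 → divides-2 pr 2≡0 , m-odd , n-odd , d-odd }
        where
        divides-2 : ∀ {l} → Prime l → + 2 ≡ 0ℤ ⟨mod l ⟩ → l ≡ 2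
        divides-2 pr e = [ (λ l≡1 → contradiction l≡1 (ℕ.nonTrivial⇒≢1 {{prime⇒nonTrivial pr}})) , (λ l≡2 → l≡2) ]′
          (prime⇒irreducible 2-prime (≡0⇒∣ e))
        coprime : ∀ {l} → Prime l → m ≡ 0ℤ ⟨mod l ⟩ → ¬ (n ≡ 0ℤ ⟨mod l ⟩)
        coprime {l} pr m≡0 n≡0 = not-both (subst (λ l → m ≡ 0ℤ ⟨mod l ⟩) l≡2 m≡0 , subst (λ l → n ≡ 0ℤ ⟨mod l ⟩) l≡2 n≡0)
          where
          l≡2 : l ≡ 2
          l≡2 = divides-2 pr ([ (λ z → z) , (λ z → z) ]′ (PrimeModulus.euclid pr (+ 2) (+ 2) (common⇒c m n (+ 2) pell m≡0 n≡0)))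
        -- If m were even, n would be odd while d n² = m² - 4 is a multiple of 4, so 4 would divide
        -- the squarefree d.
        m-odd : ¬ (m ≡ 0ℤ ⟨mod 2 ⟩)
        m-odd m≡0 = go m≡0 (odd⇒1 n (λ n≡0 → not-both (m≡0 , n≡0)))
          where
          expand : ∀ d q r → d ≡ (1ℤ + r * + 2) * (1ℤ + r * + 2) * d + - (d * (r + r * r)) * (+ 2 * + 2)
          expand = solve-∀
          collect : ∀ d q r t → (0ℤ + q * + 2) * (0ℤ + q * + 2) - (((0ℤ + q * + 2) * (0ℤ + q * + 2)) - d * ((1ℤ + r * + 2) * (1ℤ + r * + 2))) + t
            ≡ (1ℤ + r * + 2) * (1ℤ + r * + 2) * d + t
          collect = solve-∀
          finish : ∀ d q r → (0ℤ + q * + 2) * (0ℤ + q * + 2) - + 4 + - (d * (r + r * r)) * (+ 2 * + 2)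
            ≡ (q * q - 1ℤ - d * (r + r * r)) * (+ 2 * + 2)
          finish = solve-∀
          go : m ≡ 0ℤ ⟨mod 2 ⟩ → ¬ (n ≡ 1ℤ ⟨mod 2 ⟩)
          go (modulo q m≡) (modulo r n≡) = squarefree-multiple sqf (+ 2) (λ ()) (q * q - 1ℤ - d * (r + r * r))
            (trans (expand d q r) (trans (sym (collect d q r t)) (trans (cong (λ z → (0ℤ + q * + 2) * (0ℤ + q * + 2) - z + t) pell′) (finish d q r))))
            where
            t = - (d * (r + r * r)) * (+ 2 * + 2)
            pell′ : (0ℤ + q * + 2) * (0ℤ + q * + 2) - d * ((1ℤ + r * + 2) * (1ℤ + r * + 2)) ≡ + 4
            pell′ = trans (cong₂ (λ x y → x * x - d * (y * y)) (sym m≡) (sym n≡)) pell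
        dnn-odd : ¬ (d * (n * n) ≡ 0ℤ ⟨mod 2 ⟩)
        dnn-odd z = ℤ/2.*-nonzero m-odd m-odd (mod-trans (≡⇒mod (add (m * m) (d * (n * n)))) (mod-trans (mod-+ (≡⇒mod pell) z) (modulo (+ 2) refl)))
          where
          add : ∀ x y → x ≡ x - y + y
          add = solve-∀
        n-odd : ¬ (n ≡ 0ℤ ⟨mod 2 ⟩)
        n-odd = proj₁ (factor-nonzero n n (proj₂ (factor-nonzero d (n * n) dnn-odd)))
        d-odd : ¬ (d ≡ 0ℤ ⟨mod 2 ⟩)
        d-odd = proj₁ (factor-nonzero d (n * n) dnn-odd)

    reduce : Reduced d m n
    reduce = decide (Residue.mod? 2 m 0ℤ) (Residue.mod? 2 n 0ℤ)
      where
      decide : Dec (m ≡ 0ℤ ⟨mod 2 ⟩) → Dec (n ≡ 0ℤ ⟨mod 2 ⟩) → Reduced d m n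
      decide (yes m≡0) (yes n≡0) = both-even m≡0 n≡0
      decide (no m≢0)  _         = not-both-even (λ z → m≢0 (proj₁ z))
      decide (yes _)   (no n≢0)  = not-both-even (λ z → n≢0 (proj₂ z))

  record CommonFactor (x μ : ℤ) : Set where
    field
      g x₀ μ₀ : ℤ
      x≡      : x ≡ x₀ * g
      μ≡      : μ ≡ μ₀ * g
      coprime : ∀ {l} → Prime l → x₀ ≡ 0ℤ ⟨mod l ⟩ → ¬ (μ₀ ≡ 0ℤ ⟨mod l ⟩)

  commonFactor : ∀ x μ → x ≢ 0ℤ → CommonFactor x μ
  commonFactor x μ x≢0 = from-multiples (∣⇒≡0 (gcd[m,n]∣m ∣ x ∣ ∣ μ ∣)) (∣⇒≡0 (gcd[m,n]∣n ∣ x ∣ ∣ μ ∣))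
    where
    G = gcd ∣ x ∣ ∣ μ ∣
    from-multiples : x ≡ 0ℤ ⟨mod G ⟩ → μ ≡ 0ℤ ⟨mod G ⟩ → CommonFactor x μ
    from-multiples (modulo x₀ x≡) (modulo μ₀ μ≡) = record
      { g = + G ; x₀ = x₀ ; μ₀ = μ₀
      ; x≡ = trans x≡ (ℤ.+-identityˡ (x₀ * + G)) ; μ≡ = trans μ≡ (ℤ.+-identityˡ (μ₀ * + G)) ; coprime = coprime }
      where
      abs-multiple : ∀ {z z₀} l → z ≡ 0ℤ + z₀ * + G → z₀ ≡ 0ℤ ⟨mod l ⟩ → l ℕ.* G ℕ.∣ ∣ z ∣
      abs-multiple {z} {z₀} l e z₀≡0 = subst (l ℕ.* G ℕ.∣_) (sym (trans (cong ∣_∣ (trans e (ℤ.+-identityˡ (z₀ * + G)))) (ℤ.abs-* z₀ (+ G))))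
        (ℕ.*-monoˡ-∣ G (≡0⇒∣ z₀≡0))
      G≢0 : G ≢ 0
      G≢0 G≡0 = x≢0 (trans x≡ (trans (cong (λ g → 0ℤ + x₀ * + g) G≡0) (trans (ℤ.+-identityˡ (x₀ * 0ℤ)) (ℤ.*-zeroʳ x₀))))
      coprime : ∀ {l} → Prime l → x₀ ≡ 0ℤ ⟨mod l ⟩ → ¬ (μ₀ ≡ 0ℤ ⟨mod l ⟩)
      coprime {l} pr x₀≡0 μ₀≡0 = ℕ.nonTrivial⇒≢1 {{prime⇒nonTrivial pr}} (ℕ.∣1⇒≡1 (ℕ.*-cancelʳ-∣ G {{ℕ.≢-nonZero G≢0}}
        (subst (l ℕ.* G ℕ.∣_) (sym (ℕ.*-identityˡ G)) (gcd-greatest (abs-multiple l x≡ x₀≡0) (abs-multiple l μ≡ μ₀≡0)))))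

  -- The exponent of ω when 3 ∤ n (then 3 ∣ d and 3 ∣ m - 2).
  module ExponentUnit where

    -- As 3 ∣ d, p ≡ x² = 1 + 3 s modulo 9. Then p² - 1 and 4 x² contribute 6 s + 12 s ≡ 0, the
    -- constants cancel, and - 12 m′ from - m² remains.
    bracket : ∀ {hh p xx m} s t w m′ → hh ≡ 1ℤ + t * + 3 → p ≡ 1ℤ + s * + 3 + + 9 * w → xx ≡ 1ℤ + s * + 3 → m ≡ + 2 + m′ * + 3 →
      hh * (p * p - 1ℤ) + + 4 * xx - m * m ≡ - (+ 3 * m′) ⟨mod 9 ⟩
    bracket s t w m′ refl refl refl refl = modulo
      (+ 2 * s - m′ - m′ * m′ + (s * s + + 2 * w + + 6 * s * w + + 9 * w * w) + + 2 * t * s + + 3 * t * (s * s + + 2 * w + + 6 * s * w + + 9 * w * w))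
      (identity s t w m′)
      where
      identity : ∀ s t w m → (1ℤ + t * + 3) * ((1ℤ + s * + 3 + + 9 * w) * (1ℤ + s * + 3 + + 9 * w) - 1ℤ) + + 4 * (1ℤ + s * + 3) - (+ 2 + m * + 3) * (+ 2 + m * + 3)
        ≡ - (+ 3 * m) + (+ 2 * s - m - m * m + (s * s + + 2 * w + + 6 * s * w + + 9 * w * w) + + 2 * t * s + + 3 * t * (s * s + + 2 * w + + 6 * s * w + + 9 * w * w)) * + 9
      identity = solve-∀

    left : ∀ {nn xx hh} i r s t → nn ≡ 1ℤ + r * + 3 → xx ≡ 1ℤ + s * + 3 → hh ≡ 1ℤ + t * + 3 →
      + 3 * i * (nn * xx) * hh ≡ + 3 * i ⟨mod 9 ⟩
    left i r s t refl refl refl = modulo (i * (r + s + + 3 * r * s + (1ℤ + s * + 3) * (1ℤ + r * + 3) * t)) (identity i r s t)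
      where
      identity : ∀ i r s t → + 3 * i * ((1ℤ + r * + 3) * (1ℤ + s * + 3)) * (1ℤ + t * + 3)
        ≡ + 3 * i + i * (r + s + + 3 * r * s + (1ℤ + s * + 3) * (1ℤ + r * + 3) * t) * + 9
      identity = solve-∀

    right : ∀ {xx m} n m′ s z → xx ≡ 1ℤ + s * + 3 → m ≡ + 2 + m′ * + 3 →
      + 3 * n * m′ * m * (xx + + 3 * z) ≡ - (n * (m - + 2)) ⟨mod 9 ⟩
    right n m′ s z refl refl = modulo (n * m′ * (1ℤ + + 2 * s + m′ + + 3 * m′ * s) + n * m′ * z * (+ 2 + + 3 * m′)) (identity n z s m′)
      where
      identity : ∀ n z s m → + 3 * n * m * (+ 2 + m * + 3) * (1ℤ + s * + 3 + + 3 * z) ≡ - (n * (+ 2 + m * + 3 - + 2))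
        + (n * m * (1ℤ + + 2 * s + m + + 3 * m * s) + n * m * z * (+ 2 + + 3 * m)) * + 9
      identity = solve-∀

    form : ∀ {p xx d} s d′ y → p ≡ xx + + 3 * d * (y * y) → xx ≡ 1ℤ + s * + 3 → d ≡ 0ℤ + d′ * + 3 → p ≡ 1ℤ + s * + 3 + + 9 * (d′ * (y * y))
    form s d′ y refl refl refl = identity (1ℤ + s * + 3) d′ (y * y)
      where
      identity : ∀ a d y → a + + 3 * (0ℤ + d * + 3) * y ≡ a + + 9 * (d * y)
      identity = solve-∀

    regroupˡ : ∀ n x h i → n * x * (+ 3 * (n * x) * (h * h) * i) ≡ + 3 * i * (n * n * (x * x)) * (h * h)
    regroupˡ = solve-∀

    regroupʳ : ∀ {y} n x y′ m m′ → y ≡ x + y′ * + 3 → n * x * (- (m * y) * - (+ 3 * m′)) ≡ + 3 * n * m′ * m * (x * x + + 3 * (x * y′))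
    regroupʳ n x y′ m m′ refl = identity n x y′ m m′
      where
      identity : ∀ n x y m m′ → n * x * (- (m * (x + y * + 3)) * - (+ 3 * m′)) ≡ + 3 * n * m′ * m * (x * x + + 3 * (x * y))
      identity = solve-∀

    exponent : ∀ n x y d m h i p → ¬ (x ≡ 0ℤ ⟨mod 3 ⟩) → ¬ (n ≡ 0ℤ ⟨mod 3 ⟩) → ¬ (h ≡ 0ℤ ⟨mod 3 ⟩) →
      y ≡ x ⟨mod 3 ⟩ → m ≡ + 2 ⟨mod 3 ⟩ → d ≡ 0ℤ ⟨mod 3 ⟩ → p ≡ x * x + + 3 * d * (y * y) →
      + 3 * (n * x) * (h * h) * i ≡ - (m * y) * (h * h * (p * p - 1ℤ) + + 4 * (x * x) - m * m) ⟨mod 9 ⟩ →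
      + 3 * i ≡ - (n * (m - + 2)) ⟨mod 9 ⟩
    exponent n x y d m h i p x≢0 n≢0 h≢0 y≡x m≡2 d≡0 p≡ e =
      mod-trans (mod-sym (mod-trans (≡⇒mod (regroupˡ n x h i)) (left i r s t (eq n²) (eq x²) (eq h²))))
        (mod-trans (mod-*ˡ (n * x) (mod-trans e (mod-*ˡ (- (m * y)) (bracket s t (d′ * (y * y)) m′ (eq h²) (form s d′ y p≡ (eq x²) (eq d≡0)) (eq x²) (eq m≡2)))))
          (mod-trans (≡⇒mod (regroupʳ n x y′ m m′ (eq y≡x))) (right n m′ s (x * y′) (eq x²) (eq m≡2))))
      where
      open _≡_⟨mod_⟩ using (quotient) renaming (equality to eq)
      x² = square≡1 x x≢0
      n² = square≡1 n n≢0
      h² = square≡1 h h≢0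
      s r t y′ m′ d′ : ℤ
      s = quotient x²
      r = quotient n²
      t = quotient h²
      y′ = quotient y≡x
      m′ = quotient m≡2
      d′ = quotient d≡0

  divide-3 : ∀ a b → + 3 * a ≡ + 3 * b ⟨mod 9 ⟩ → a ≡ b ⟨mod 3 ⟩
  divide-3 a b (modulo q e) = modulo q (ℤ.*-cancelˡ-≡ (+ 3) a (b + q * + 3) (trans e (factor b q)))
    where
    factor : ∀ b q → + 3 * b + q * + 9 ≡ + 3 * (b + q * + 3)
    factor = solve-∀

  -- The exponent of ω when n = 3 n₁ (then 9 ∣ m - 2).
  module ExponentMultiple where

    -- Now p ≡ 1 + 3 (s + d) modulo 9 and m² ≡ 4, so the terms in s again add up to 18 s and 6 d
    -- survives.
    bracket : ∀ {hh p xx m} s t v d w m′ → hh ≡ 1ℤ + t * + 3 → p ≡ 1ℤ + v * + 3 → xx ≡ 1ℤ + s * + 3 → m ≡ + 2 + m′ * + 9 → v ≡ s + d + + 3 * w →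
      hh * (p * p - 1ℤ) + + 4 * xx - m * m ≡ + 6 * d ⟨mod 9 ⟩
    bracket s t v d w m′ refl refl refl refl refl = modulo
      (+ 2 * s + + 2 * w + (s + d + + 3 * w) * (s + d + + 3 * w) + + 2 * t * (s + d + + 3 * w) + + 3 * t * ((s + d + + 3 * w) * (s + d + + 3 * w)) - + 4 * m′ - + 9 * m′ * m′)
      (identity s t d w m′)
      where
      identity : ∀ s t d w m → (1ℤ + t * + 3) * ((1ℤ + (s + d + + 3 * w) * + 3) * (1ℤ + (s + d + + 3 * w) * + 3) - 1ℤ) + + 4 * (1ℤ + s * + 3) - (+ 2 + m * + 9) * (+ 2 + m * + 9)
        ≡ + 6 * d + (+ 2 * s + + 2 * w + (s + d + + 3 * w) * (s + d + + 3 * w) + + 2 * t * (s + d + + 3 * w) + + 3 * t * ((s + d + + 3 * w) * (s + d + + 3 * w)) - + 4 * m - + 9 * m * m) * + 9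
      identity = solve-∀

    left : ∀ {yy hh m} i r t m′ → yy ≡ 1ℤ + r * + 3 → hh ≡ 1ℤ + t * + 3 → m ≡ + 2 + m′ * + 9 →
      + 6 * i * m * (yy * hh) ≡ + 3 * i ⟨mod 9 ⟩
    left i r t m′ refl refl refl = modulo (i * (1ℤ + + 6 * m′ + (+ 4 + + 18 * m′) * (r + t + + 3 * r * t))) (identity i m′ r t)
      where
      identity : ∀ i m r t → + 6 * i * (+ 2 + m * + 9) * ((1ℤ + r * + 3) * (1ℤ + t * + 3))
        ≡ + 3 * i + i * (1ℤ + + 6 * m + (+ 4 + + 18 * m) * (r + t + + 3 * r * t)) * + 9
      identity = solve-∀

    right : ∀ {xx} c s z → xx ≡ 1ℤ + s * + 3 → + 12 * c * (xx + + 3 * z) ≡ + 3 * c ⟨mod 9 ⟩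
    right c s z refl = modulo (c * (1ℤ + + 4 * (s + z))) (identity c s z)
      where
      identity : ∀ c s z → + 12 * c * (1ℤ + s * + 3 + + 3 * z) ≡ + 3 * c + c * (1ℤ + + 4 * (s + z)) * + 9
      identity = solve-∀

    form : ∀ {p xx yy} s d r → p ≡ xx + + 3 * d * yy → xx ≡ 1ℤ + s * + 3 → yy ≡ 1ℤ + r * + 3 → p ≡ 1ℤ + (s + d + + 3 * (d * r)) * + 3
    form s d r refl refl refl = identity s d r
      where
      identity : ∀ s d r → 1ℤ + s * + 3 + + 3 * d * (1ℤ + r * + 3) ≡ 1ℤ + (s + d + + 3 * (d * r)) * + 3
      identity = solve-∀

    regroupˡ : ∀ y m h i → + 2 * y * (+ 3 * (m * y) * (h * h) * i) ≡ + 6 * i * m * (y * y * (h * h))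
    regroupˡ = solve-∀

    regroupʳ : ∀ {y} n d x y′ → y ≡ x + y′ * + 3 → + 2 * y * (n * x * (+ 6 * d)) ≡ + 12 * (n * d) * (x * x + + 3 * (x * y′))
    regroupʳ n d x y′ refl = identity n d x y′
      where
      identity : ∀ n d x y → + 2 * (x + y * + 3) * (n * x * (+ 6 * d)) ≡ + 12 * (n * d) * (x * x + + 3 * (x * y))
      identity = solve-∀

    -- Multiplication by 2 y makes the coefficient of i equal to 6 m y² h², which is 3 modulo 9
    -- because m ≡ 2; the other side becomes 12 n₁ d x y ≡ 3 n₁ d.
    exponent : ∀ n₁ x y d m h i p → ¬ (x ≡ 0ℤ ⟨mod 3 ⟩) → ¬ (y ≡ 0ℤ ⟨mod 3 ⟩) → ¬ (h ≡ 0ℤ ⟨mod 3 ⟩) →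
      y ≡ x ⟨mod 3 ⟩ → m ≡ + 2 ⟨mod 9 ⟩ → p ≡ x * x + + 3 * d * (y * y) →
      + 3 * (m * y) * (h * h) * i ≡ n₁ * x * (h * h * (p * p - 1ℤ) + + 4 * (x * x) - m * m) ⟨mod 9 ⟩ →
      i ≡ n₁ * d ⟨mod 3 ⟩
    exponent n₁ x y d m h i p x≢0 y≢0 h≢0 y≡x m≡2 p≡ e = divide-3 i (n₁ * d)
      (mod-trans (mod-sym (mod-trans (≡⇒mod (regroupˡ y m h i)) (left i r t m′ (eq y²) (eq h²) (eq m≡2))))
        (mod-trans (mod-*ˡ (+ 2 * y) (mod-trans e (mod-*ˡ (n₁ * x) (bracket s t (s + d + + 3 * (d * r)) d (d * r) m′ (eq h²) (form s d r p≡ (eq x²) (eq y²)) (eq x²) (eq m≡2) refl))))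
          (mod-trans (≡⇒mod (regroupʳ n₁ d x y′ (eq y≡x))) (right (n₁ * d) s (x * y′) (eq x²)))))
      where
      open _≡_⟨mod_⟩ using (quotient) renaming (equality to eq)
      x² = square≡1 x x≢0
      y² = square≡1 y y≢0
      h² = square≡1 h h≢0
      s r t y′ m′ : ℤ
      s = quotient x²
      r = quotient y²
      t = quotient h²
      y′ = quotient y≡x
      m′ = quotient m≡2

-- The cubic symbol of α at p from the representation of p

module QuadraticForm where

  open import Data.Integer using (ℤ; +_; _+_; _-_; _*_; -_; 0ℤ; 1ℤ; ∣_∣)
  import Data.Integer.Properties as ℤ
  open import Data.Integer.Tactic.RingSolver using (solve-∀)
  open import Data.Nat as ℕ using (ℕ; s≤s; z≤n)
  import Data.Nat.Divisibility as ℕ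
  open import Data.Nat.Primality using (Prime; prime⇒irreducible; prime⇒nonTrivial)
  import Data.Nat.Properties as ℕ
  open import Data.Product using (∃; _,_; _×_; proj₁; proj₂)
  open import Data.Sum using (_⊎_; inj₁; inj₂; [_,_]′)
  open import Relation.Binary.PropositionalEquality hiding (J)
  open import Relation.Nullary using (Dec; yes; no; contradiction; ¬_)
  open import Defs using (Squarefree)
  open EisensteinIntegers
  open GroupRings
  open PrimeFields
  open ResidueCharacters
  open JacobiSums
  open CubicSymbols
  open Factorisation
  open AmbiguousPrimes
  open SymbolExponents
  open LucasSequences
  open PellReduction

  -- The formula modulo 9 is homogeneous of degree 3 except for P - 1 and the left side. Multiplying
  -- by h³ restores the original coordinates and leaves h² only there, where h² ≡ 1 (mod 3) is
  -- enough.
  scaled-exponent : ∀ h A B C M P i a b c m → h * A ≡ a → h * B ≡ b → h * C ≡ + 2 * c → h * M ≡ m →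
    + 3 * A * i ≡ - B * (P - 1ℤ + C * C - M * M) ⟨mod 9 ⟩ →
    + 3 * a * (h * h) * i ≡ - b * (h * h * (P - 1ℤ) + + 4 * (c * c) - m * m) ⟨mod 9 ⟩
  scaled-exponent h A B C M P i a b c m refl refl hC refl e = mod-trans (≡⇒mod (left h A i))
    (mod-trans (mod-*ˡ (h * h * h) e) (≡⇒mod (trans (right h B C M P)
      (cong (λ z → - (h * B) * (h * h * (P - 1ℤ) + z - h * M * (h * M))) (trans (cong (λ z → z * z) hC) (quadruple c))))))
    where
    left : ∀ h A i → + 3 * (h * A) * (h * h) * i ≡ h * h * h * (+ 3 * A * i)
    left = solve-∀
    right : ∀ h B C M P → h * h * h * (- B * (P - 1ℤ + C * C - M * M)) ≡ - (h * B) * (h * h * (P - 1ℤ) + h * C * (h * C) - h * M * (h * M))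
    right = solve-∀
    quadruple : ∀ c → + 2 * c * (+ 2 * c) ≡ + 4 * (c * c)
    quadruple = solve-∀

  CubicRatio : ℕ → ℕ → 𝔼 → ℕ → Set
  CubicRatio p k α i = α ↑ k ≈ ω ↑ i ⊗ conj α ↑ k ⟨mod p ⟩

  -- Used for rational ρ, and, because k is even, for rational multiples of √-3.
  scale-ratio : ∀ {p} k ρ γ i → conj ρ ↑ k ≡ ρ ↑ k → CubicRatio p k γ i → CubicRatio p k (ρ ⊗ γ) i
  scale-ratio {p} k ρ γ i ρ̄ e = ≈-trans (≡⇒≈ (↑-distrib-⊗ ρ γ k)) (≈-trans (⊗-congˡ {ρ ↑ k} e) (≡⇒≈ (begin
    ρ ↑ k ⊗ (ω ↑ i ⊗ conj γ ↑ k)          ≡⟨ ⊗-assoc (ρ ↑ k) (ω ↑ i) (conj γ ↑ k) ⟨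
    (ρ ↑ k ⊗ ω ↑ i) ⊗ conj γ ↑ k          ≡⟨ cong (_⊗ conj γ ↑ k) (trans (⊗-comm (ρ ↑ k) (ω ↑ i)) (cong (ω ↑ i ⊗_) (sym ρ̄))) ⟩
    (ω ↑ i ⊗ conj ρ ↑ k) ⊗ conj γ ↑ k     ≡⟨ ⊗-assoc (ω ↑ i) (conj ρ ↑ k) (conj γ ↑ k) ⟩
    ω ↑ i ⊗ (conj ρ ↑ k ⊗ conj γ ↑ k)     ≡⟨ cong (ω ↑ i ⊗_) (↑-distrib-⊗ (conj ρ) (conj γ) k) ⟨
    ω ↑ i ⊗ (conj ρ ⊗ conj γ) ↑ k         ≡⟨ cong (λ δ → ω ↑ i ⊗ δ ↑ k) (conj-⊗ ρ γ) ⟨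
    ω ↑ i ⊗ conj (ρ ⊗ γ) ↑ k              ∎)))
    where
    open Mod p
    open ≡-Reasoning

  even-power-invariant : ∀ {k} ρ → (∃ λ h → k ≡ h ℕ.+ h) → conj ρ ⊗ conj ρ ≡ ρ ⊗ ρ → conj ρ ↑ k ≡ ρ ↑ k
  even-power-invariant ρ (h , refl) e = trans (double (conj ρ)) (trans (cong (_↑ h) e) (sym (double ρ)))
    where
    double : ∀ α → α ↑ (h ℕ.+ h) ≡ (α ⊗ α) ↑ h
    double α = trans (↑-homo-⊗ α h h) (sym (↑-distrib-⊗ α α h))

  square-conj : ∀ h → (conj (0ℤ +√-3 h)) ⊗ (conj (0ℤ +√-3 h)) ≡ (0ℤ +√-3 h) ⊗ (0ℤ +√-3 h)
  square-conj h = trans (cong (λ δ → δ ⊗ δ) (conj-√-3 0ℤ h)) (trans (√-3-⊗ 0ℤ (- h) 0ℤ (- h))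
    (trans (cong₂ _+√-3_ (real h) (imag h)) (sym (√-3-⊗ 0ℤ h 0ℤ h))))
    where
    real : ∀ h → 0ℤ * 0ℤ - + 3 * (- h * - h) ≡ 0ℤ * 0ℤ - + 3 * (h * h)
    real = solve-∀
    imag : ∀ h → 0ℤ * - h + - h * 0ℤ ≡ 0ℤ * h + h * 0ℤ
    imag = solve-∀

  module Form {p k : ℕ} (p-prime : Prime p) (p≡ : p ≡ 1 ℕ.+ k ℕ.* 3) (d x y : ℤ) (sqf : Squarefree d)
    (form : + p ≡ x * x + + 3 * d * (y * y)) (3∤x : ¬ (x ≡ 0ℤ ⟨mod 3 ⟩)) (3∤y : ¬ (y ≡ 0ℤ ⟨mod 3 ⟩))
    (y≡x : y ≡ x ⟨mod 3 ⟩) (p∤x : ¬ (x ≡ 0ℤ ⟨mod p ⟩)) (2≢0 : ¬ (+ 2 ≡ 0ℤ ⟨mod p ⟩)) where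

    no-common-divisor : ∀ {l} → Prime l → x ≡ 0ℤ ⟨mod l ⟩ → ¬ (y ≡ 0ℤ ⟨mod l ⟩)
    no-common-divisor {l} pr x≡0 y≡0 = [ (λ l≡1 → ℕ.nonTrivial⇒≢1 {{prime⇒nonTrivial pr}} l≡1) ,
        (λ l≡p → p∤x (subst (λ l → x ≡ 0ℤ ⟨mod l ⟩) l≡p x≡0)) ]′ (prime⇒irreducible p-prime (≡0⇒∣ {a = + p} p≡0))
      where
      p≡0 : + p ≡ 0ℤ ⟨mod l ⟩
      p≡0 = mod-trans (≡⇒mod form) (mod-+ (mod-* x≡0 x≡0) (multiple≡0 (+ 3 * d) (mod-* y≡0 y≡0)))

    not-both-odd : ¬ (d ≡ 0ℤ ⟨mod 2 ⟩) → ¬ (x ≡ 0ℤ ⟨mod 2 ⟩) → y ≡ 0ℤ ⟨mod 2 ⟩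
    not-both-odd d≢0 x≢0 = decide (Residue.mod? 2 y 0ℤ)
      where
      p-even : ¬ (y ≡ 0ℤ ⟨mod 2 ⟩) → + p ≡ 0ℤ ⟨mod 2 ⟩
      p-even y≢0 = mod-trans (≡⇒mod form) (mod-trans (mod-+ (mod-* (odd⇒1 x x≢0) (odd⇒1 x x≢0))
        (mod-* (mod-*ˡ (+ 3) (odd⇒1 d d≢0)) (mod-* (odd⇒1 y y≢0) (odd⇒1 y y≢0)))) (modulo (+ 2) refl))
      decide : Dec (y ≡ 0ℤ ⟨mod 2 ⟩) → y ≡ 0ℤ ⟨mod 2 ⟩
      decide (yes y≡0) = y≡0
      decide (no y≢0) = contradiction (∣⇒≡0 {a = + 2} (ℕ.∣-reflexive (even-prime p-prime (≡0⇒∣ {a = + p} (p-even y≢0))))) 2≢0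

    p∤norm : ∀ m n → m * m - d * (n * n) ≡ + 4 → ¬ (norm ((n * x) +√-3 (m * y)) ≡ 0ℤ ⟨mod p ⟩)
    p∤norm m n pell z = P.*-nonzero (P.*-nonzero 2≢0 2≢0) (P.*-nonzero p∤x p∤x) (mod-trans (≡⇒mod (trans (split m n d x y)
        (cong₂ (λ u v → m * m * u - d * v + (+ 4 - (m * m - d * (n * n))) * (x * x)) (sym form) (sym (norm-√-3 (n * x) (m * y))))))
      (mod-trans (mod-+ (mod-+ (multiple≡0 (m * m) p≡0) (mod-neg (multiple≡0 d z))) (multiple≡0ʳ (x * x) (≡⇒mod (cong (λ z → + 4 - z) pell)))) mod-refl))
      where
      module P = PrimeModulus p-prime
      p≡0 : + p ≡ 0ℤ ⟨mod p ⟩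
      p≡0 = ∣⇒≡0 {a = + p} (ℕ.∣-refl {p})
      split : ∀ m n d x y → + 2 * + 2 * (x * x) ≡ m * m * (x * x + + 3 * d * (y * y)) - d * (n * x * (n * x) + + 3 * (m * y * (m * y)))
        + (+ 4 - (m * m - d * (n * n))) * (x * x)
      split = solve-∀

    module Core (m n : ℤ) (pell : m * m - d * (n * n) ≡ + 4) (m≡2 : m ≡ + 2 ⟨mod 3 ⟩) where

      α : 𝔼
      α = (n * x) +√-3 (m * y)

      p∤α : ¬ (norm α ≡ 0ℤ ⟨mod p ⟩)
      p∤α = p∤norm m n pell

      3∤m : ¬ (m ≡ 0ℤ ⟨mod 3 ⟩)
      3∤m z = contradiction (mod-trans (mod-sym m≡2) z) λ 2≡0 → ℕ.>⇒∤ (s≤s (s≤s (s≤s z≤n))) (≡0⇒∣ 2≡0)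

      R : Reduced d m n
      R = reduce sqf pell
      open Reduced R using (e; c; μ; ν; m≡; n≡; ec≡2; even-c) renaming (pell to pell₀; coprime to coprime-μν)

      x≢0 : x ≢ 0ℤ
      x≢0 x≡0 = 3∤x (≡⇒mod x≡0)

      CF : CommonFactor x μ
      CF = commonFactor x μ x≢0
      open CommonFactor CF using (g; x₀; x≡) renaming (μ₀ to M; μ≡ to μ≡; coprime to coprime-x₀M)

      -- The factor h unites the common factor e of m and n with the greatest common divisor g of x
      -- and m / e. With it h C = 2 x, h M = m, and α = h (ν x₀ + M y √-3).
      C h : ℤ
      C = c * x₀
      h = e * g

      3∤ec : ¬ (e * c ≡ 0ℤ ⟨mod 3 ⟩)
      3∤ec z = ℕ.>⇒∤ (s≤s (s≤s (s≤s z≤n))) (≡0⇒∣ {a = + 2} (mod-trans (≡⇒mod (sym ec≡2)) z))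

      3∤x₀g : ¬ (x₀ * g ≡ 0ℤ ⟨mod 3 ⟩)
      3∤x₀g z = 3∤x (mod-trans (≡⇒mod x≡) z)

      3∤C : ¬ (C ≡ 0ℤ ⟨mod 3 ⟩)
      3∤C = ℤ/3.*-nonzero (proj₂ (factor-nonzero e c 3∤ec)) (proj₁ (factor-nonzero x₀ g 3∤x₀g))

      3∤h : ¬ (h ≡ 0ℤ ⟨mod 3 ⟩)
      3∤h = ℤ/3.*-nonzero (proj₁ (factor-nonzero e c 3∤ec)) (proj₂ (factor-nonzero x₀ g 3∤x₀g))

      3∤M : ¬ (M ≡ 0ℤ ⟨mod 3 ⟩)
      3∤M = proj₁ (factor-nonzero M g (λ z → 3∤m (mod-trans (≡⇒mod m≡) (multiple≡0 e (mod-trans (≡⇒mod μ≡) z)))))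

      hνx₀ : h * (ν * x₀) ≡ n * x
      hνx₀ = trans (regroup e g ν x₀) (cong₂ _*_ (sym n≡) (sym x≡))
        where
        regroup : ∀ e g ν x → e * g * (ν * x) ≡ e * ν * (x * g)
        regroup = solve-∀

      hMy : h * (M * y) ≡ m * y
      hMy = trans (regroup e g M y) (cong (_* y) (trans (cong (e *_) (sym μ≡)) (sym m≡)))
        where
        regroup : ∀ e g M y → e * g * (M * y) ≡ e * (M * g) * y
        regroup = solve-∀

      hC : h * C ≡ + 2 * x
      hC = trans (regroup e g c x₀) (cong₂ _*_ ec≡2 (sym x≡))
        where
        regroup : ∀ e g c x → e * g * (c * x) ≡ e * c * (x * g)
        regroup = solve-∀

      hM : h * M ≡ m
      hM = trans (regroup e g M) (trans (cong (e *_) (sym μ≡)) (sym m≡))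
        where
        regroup : ∀ e g M → e * g * M ≡ e * (M * g)
        regroup = solve-∀

      -- The first alternative is about x₀, not ν x₀, because for 3 ∣ n the coordinate in use is
      -- built from (ν / 3) x₀.
      Ambiguity : ℕ → Set
      Ambiguity l = (x₀ ≡ 0ℤ ⟨mod l ⟩ ⊎ M * y ≡ 0ℤ ⟨mod l ⟩) × ¬ (ν * x₀ ≡ 0ℤ ⟨mod l ⟩ × M * y ≡ 0ℤ ⟨mod l ⟩)

      x₀-case : ∀ {l} → Prime l → x₀ ≡ 0ℤ ⟨mod l ⟩ → Ambiguity l
      x₀-case pr x₀≡0 = inj₁ x₀≡0 , λ (_ , My≡0) → [ coprime-x₀M pr x₀≡0 ,
        no-common-divisor pr (mod-trans (≡⇒mod x≡) (multiple≡0ʳ g x₀≡0)) ]′ (PrimeModulus.euclid pr M y My≡0)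

      M-case : ∀ {l} → Prime l → M ≡ 0ℤ ⟨mod l ⟩ → Ambiguity l
      M-case pr M≡0 = inj₂ (multiple≡0ʳ y M≡0) , λ (νx₀≡0 , _) → [ coprime-μν pr (mod-trans (≡⇒mod μ≡) (multiple≡0ʳ g M≡0)) ,
        (λ x₀≡0 → coprime-x₀M pr x₀≡0 M≡0) ]′ (PrimeModulus.euclid pr ν x₀ νx₀≡0)

      -- If x is even, so is x₀, since g divides the odd μ. If x is odd, y must be even, for
      -- otherwise x² + 3 d y² = p would be even.
      c-case : ¬ (μ ≡ 0ℤ ⟨mod 2 ⟩) → ¬ (ν ≡ 0ℤ ⟨mod 2 ⟩) → ¬ (d ≡ 0ℤ ⟨mod 2 ⟩) → Ambiguity 2
      c-case μ-odd ν-odd d-odd = decide (Residue.mod? 2 x 0ℤ)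
        where
        decide : Dec (x ≡ 0ℤ ⟨mod 2 ⟩) → Ambiguity 2
        decide (yes x≡0) = x₀-case 2-prime ([ (λ z → z) , (λ g≡0 → contradiction (mod-trans (≡⇒mod μ≡) (multiple≡0 M g≡0)) μ-odd) ]′
          (ℤ/2.euclid x₀ g (mod-trans (≡⇒mod (sym x≡)) x≡0)))
        decide (no x-odd) = inj₂ (multiple≡0 M (not-both-odd d-odd x-odd)) , λ (νx₀≡0 , _) → [ ν-odd ,
          (λ x₀≡0 → x-odd (mod-trans (≡⇒mod x≡) (multiple≡0ʳ g x₀≡0))) ]′ (ℤ/2.euclid ν x₀ νx₀≡0)

      ambiguity : ∀ l → Prime l → C ≡ 0ℤ ⟨mod l ⟩ ⊎ M ≡ 0ℤ ⟨mod l ⟩ → Ambiguity l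
      ambiguity l pr (inj₂ M≡0) = M-case pr M≡0
      ambiguity l pr (inj₁ C≡0) = [ from-c , x₀-case pr ]′ (PrimeModulus.euclid pr c x₀ C≡0)
        where
        from-c : c ≡ 0ℤ ⟨mod l ⟩ → Ambiguity l
        from-c c≡0 = subst Ambiguity (sym (proj₁ even)) (c-case (proj₁ (proj₂ even)) (proj₁ (proj₂ (proj₂ even))) (proj₂ (proj₂ (proj₂ even))))
          where
          even = even-c pr c≡0

      M²p : M * M * + p ≡ C * C + d * (ν * x₀ * (ν * x₀) + + 3 * (M * y * (M * y)))
      M²p = trans (cong (M * M *_) (trans form (cong (λ x → x * x + + 3 * d * (y * y)) x≡))) (trans (split M x₀ g d y ν)
        (trans (cong (λ z → x₀ * x₀ * z + d * (ν * x₀ * (ν * x₀) + + 3 * (M * y * (M * y)))) (trans (cong (λ z → z * z - d * (ν * ν)) (sym μ≡)) pell₀))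
          (merge c x₀ (d * (ν * x₀ * (ν * x₀) + + 3 * (M * y * (M * y)))))))
        where
        split : ∀ M x g d y ν → M * M * (x * g * (x * g) + + 3 * d * (y * y))
          ≡ x * x * (M * g * (M * g) - d * (ν * ν)) + d * (ν * x * (ν * x) + + 3 * (M * y * (M * y)))
        split = solve-∀
        merge : ∀ c x t → x * x * (c * c) + t ≡ c * x * (c * x) + t
        merge = solve-∀

      mod-norm : ∀ γ q → M * M * + p ≡ C * C + q * norm γ → M * M * + p ≡ C * C ⟨mod ∣ norm γ ∣ ⟩
      mod-norm γ q eq = modulo q (trans eq (cong (λ z → C * C + q * z) (norm-nonneg γ)))

      p∤factor : ∀ ρ γ → α ≡ ρ ⊗ γ → ¬ (norm γ ≡ 0ℤ ⟨mod p ⟩)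
      p∤factor ρ γ α≡ z = p∤α (mod-trans (≡⇒mod (trans (cong norm α≡) (norm-⊗ ρ γ))) (multiple≡0 (norm ρ) z))

      module UnitN (3∤n : ¬ (n ≡ 0ℤ ⟨mod 3 ⟩)) where

        A B : ℤ
        A = ν * x₀
        B = M * y

        ρ : 𝔼
        ρ = h +√-3 0ℤ

        α≡ : α ≡ ρ ⊗ (A +√-3 B)
        α≡ = sym (trans (√-3-⊗ h 0ℤ A B) (cong₂ _+√-3_ (trans (real h A B) hνx₀) (trans (imag h A B) hMy)))
          where
          real : ∀ h A B → h * A - + 3 * (0ℤ * B) ≡ h * A
          real = solve-∀
          imag : ∀ h A B → h * B + 0ℤ * A ≡ h * B
          imag = solve-∀

        3∤A : ¬ (A ≡ 0ℤ ⟨mod 3 ⟩)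
        3∤A = ℤ/3.*-nonzero (λ z → 3∤n (mod-trans (≡⇒mod n≡) (multiple≡0 e z))) (proj₁ (factor-nonzero x₀ g 3∤x₀g))

        3∣d : d ≡ 0ℤ ⟨mod 3 ⟩
        3∣d = [ (λ z → z) , (λ z → contradiction ([ (λ z → z) , (λ z → z) ]′ (ℤ/3.euclid n n z)) 3∤n) ]′ (ℤ/3.euclid d (n * n) dnn)
          where
          difference : ∀ m t → t ≡ m * m - (m * m - t)
          difference = solve-∀
          dnn : d * (n * n) ≡ 0ℤ ⟨mod 3 ⟩
          dnn = mod-trans (≡⇒mod (trans (difference m (d * (n * n))) (cong (λ z → m * m - z) pell))) (mod-+ʳ (- + 4) (mod-* m≡2 m≡2))

        open CubicSymbolOf {p} {k} p-prime p≡ A B C M 3∤A 3∤C 3∤M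
          (λ l pr z → [ (λ x₀≡0 → multiple≡0ʳ B (multiple≡0 ν x₀≡0)) , multiple≡0 A ]′ (proj₁ (ambiguity l pr z)) , proj₂ (ambiguity l pr z))
          (mod-norm (A +√-3 B) d (trans M²p (cong (λ z → C * C + d * z) (sym (norm-√-3 A B)))))
          (p∤factor ρ (A +√-3 B) α≡)
          using (i; symbol-p; i-mod-9) public

        ratio : CubicRatio p k α i
        ratio = subst (λ α → CubicRatio p k α i) (sym α≡) (scale-ratio k ρ (A +√-3 B) i (cong (_↑ k) real) symbol-p)
          where
          real : conj ρ ≡ ρ
          real = conj-√-3 h 0ℤ

        exponent : + 3 * + i ≡ - (n * (m - + 2)) ⟨mod 9 ⟩
        exponent = ExponentUnit.exponent n x y d m h (+ i) (+ p) 3∤x 3∤n 3∤h y≡x m≡2 3∣d form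
          (scaled-exponent h A B C M (+ p * + p) (+ i) (n * x) (m * y) x m hνx₀ hMy hC hM i-mod-9)

      module MultipleN (n≡0 : n ≡ 0ℤ ⟨mod 3 ⟩) where

        ν≡0 : ν ≡ 0ℤ ⟨mod 3 ⟩
        ν≡0 = [ (λ z → contradiction z (proj₁ (factor-nonzero e c 3∤ec))) , (λ z → z) ]′ (ℤ/3.euclid e ν (mod-trans (≡⇒mod (sym n≡)) n≡0))

        -- Here α = h √-3 (A + B √-3): multiplying by √-3 sends A + B √-3 to - 3 B + A √-3, and - 3
        -- B = ν x₀. The new first coordinate M y is prime to 3.
        ν₁ n₁ A B : ℤ
        ν₁ = _≡_⟨mod_⟩.quotient ν≡0
        n₁ = e * ν₁
        A = M * y
        B = - (ν₁ * x₀)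

        ν≡ : ν ≡ ν₁ * + 3
        ν≡ = trans (_≡_⟨mod_⟩.equality ν≡0) (ℤ.+-identityˡ (ν₁ * + 3))

        n≡3n₁ : n ≡ + 3 * n₁
        n≡3n₁ = trans n≡ (trans (cong (e *_) ν≡) (regroup e ν₁))
          where
          regroup : ∀ e ν → e * (ν * + 3) ≡ + 3 * (e * ν)
          regroup = solve-∀

        ρ : 𝔼
        ρ = 0ℤ +√-3 h

        α≡ : α ≡ ρ ⊗ (A +√-3 B)
        α≡ = sym (trans (√-3-⊗ 0ℤ h A B) (cong₂ _+√-3_ (trans (real h A ν₁ x₀) (trans (cong (λ ν → h * (ν * x₀)) (sym ν≡)) hνx₀)) (trans (imag h A B) hMy)))
          where
          real : ∀ h A ν x → 0ℤ * A - + 3 * (h * - (ν * x)) ≡ h * (ν * + 3 * x)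
          real = solve-∀
          imag : ∀ h A B → 0ℤ * B + h * A ≡ h * A
          imag = solve-∀

        3∤A : ¬ (A ≡ 0ℤ ⟨mod 3 ⟩)
        3∤A = ℤ/3.*-nonzero 3∤M 3∤y

        νx₀≡-3B : ν * x₀ ≡ - (+ 3) * B
        νx₀≡-3B = trans (cong (_* x₀) ν≡) (regroup ν₁ x₀)
          where
          regroup : ∀ ν x → ν * + 3 * x ≡ - (+ 3) * - (ν * x)
          regroup = solve-∀

        B-vanishes : ∀ {l} → x₀ ≡ 0ℤ ⟨mod l ⟩ → B ≡ 0ℤ ⟨mod l ⟩
        B-vanishes x₀≡0 = mod-neg (multiple≡0 ν₁ x₀≡0)

        norm-relation : M * M * + p ≡ C * C + + 3 * d * norm (A +√-3 B)
        norm-relation = trans M²p (cong (λ z → C * C + z) (trans (cong (λ z → d * (z * z + + 3 * (A * A))) νx₀≡-3B)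
          (trans (regroup d A B) (cong (+ 3 * d *_) (sym (norm-√-3 A B))))))
          where
          regroup : ∀ d A B → d * (- (+ 3) * B * (- (+ 3) * B) + + 3 * (A * A)) ≡ + 3 * d * (A * A + + 3 * (B * B))
          regroup = solve-∀

        open CubicSymbolOf {p} {k} p-prime p≡ A B C M 3∤A 3∤C 3∤M
          (λ l pr z → [ (λ x₀≡0 → multiple≡0 A (B-vanishes x₀≡0)) , multiple≡0ʳ B ]′ (proj₁ (ambiguity l pr z)) ,
            (λ (A≡0 , B≡0) → proj₂ (ambiguity l pr z) (mod-trans (≡⇒mod νx₀≡-3B) (multiple≡0 (- (+ 3)) B≡0) , A≡0)))
          (mod-norm (A +√-3 B) (+ 3 * d) norm-relation)
          (p∤factor ρ (A +√-3 B) α≡)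
          using (i; symbol-p; i-mod-9) public

        ratio : CubicRatio p k α i
        ratio = subst (λ α → CubicRatio p k α i) (sym α≡)
          (scale-ratio k ρ (A +√-3 B) i (even-power-invariant {k} ρ (even-exponent p-prime p≡ 2≢0) (square-conj h)) symbol-p)

        -- (m - 2)(m + 2) = d n² is divisible by 9, and m + 2 is prime to 3.
        m≡2-mod-9 : m ≡ + 2 ⟨mod 9 ⟩
        m≡2-mod-9 = from-quotients (_≡_⟨mod_⟩.quotient m≡2) (_≡_⟨mod_⟩.equality m≡2)
          where
          from-quotients : ∀ m′ → m ≡ + 2 + m′ * + 3 → m ≡ + 2 ⟨mod 9 ⟩
          from-quotients m′ m≡ = modulo (d * (n₁ * n₁) - m′ - m′ * m′) (trans m≡ (trans (cong (λ z → + 2 + z * + 3) m′≡) (nine (d * (n₁ * n₁)) m′)))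
            where
            expand : ∀ m d n → + 3 * (m * (+ 4 + + 3 * m)) ≡ (+ 2 + m * + 3) * (+ 2 + m * + 3) - d * (+ 3 * n * (+ 3 * n)) - + 4 + + 3 * (+ 3 * (d * (n * n)))
            expand = solve-∀
            collapse : ∀ t → + 4 - + 4 + + 3 * t ≡ + 3 * t
            collapse = solve-∀
            isolate : ∀ m → m ≡ m * (+ 4 + + 3 * m) - + 3 * m - + 3 * (m * m)
            isolate = solve-∀
            nine : ∀ t m → + 2 + (+ 3 * t - + 3 * m - + 3 * (m * m)) * + 3 ≡ + 2 + (t - m - m * m) * + 9
            nine = solve-∀
            relation : m′ * (+ 4 + + 3 * m′) ≡ + 3 * (d * (n₁ * n₁))
            relation = ℤ.*-cancelˡ-≡ (+ 3) (m′ * (+ 4 + + 3 * m′)) (+ 3 * (d * (n₁ * n₁))) (trans (expand m′ d n₁)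
              (trans (cong (λ z → z - + 4 + + 3 * (+ 3 * (d * (n₁ * n₁)))) (trans (cong₂ (λ m n → m * m - d * (n * n)) (sym m≡) (sym n≡3n₁)) pell))
                (collapse (+ 3 * (d * (n₁ * n₁))))))
            m′≡ : m′ ≡ + 3 * (d * (n₁ * n₁)) - + 3 * m′ - + 3 * (m′ * m′)
            m′≡ = trans (isolate m′) (cong (λ z → z - + 3 * m′ - + 3 * (m′ * m′)) relation)

        exponent : + i ≡ n₁ * d ⟨mod 3 ⟩
        exponent = ExponentMultiple.exponent n₁ x y d m h (+ i) (+ p) 3∤x 3∤y 3∤h y≡x m≡2-mod-9 form
          (subst (λ b → + 3 * (m * y) * (h * h) * + i ≡ b * (h * h * (+ p * + p - 1ℤ) + + 4 * (x * x) - m * m) ⟨mod 9 ⟩) (ℤ.neg-involutive (n₁ * x))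
            (scaled-exponent h A B C M (+ p * + p) (+ i) (m * y) (- (n₁ * x)) x m hMy hB hC hM i-mod-9))
          where
          regroup : ∀ e g ν x → e * g * - (ν * x) ≡ - (e * ν * (x * g))
          regroup = solve-∀
          hB : h * B ≡ - (n₁ * x)
          hB = trans (regroup e g ν₁ x₀) (cong (λ z → - (n₁ * z)) (sym x≡))

-- The Legendre symbol modulo 3, exact quotients and fractions modulo p

module LegendreModThree where

  open import Data.Fin as Fin using (Fin)
  open import Data.Integer using (ℤ; +_; _+_; _-_; _*_; -_; _/_; _^_; 0ℤ; 1ℤ; -1ℤ; ∣_∣)
  open import Data.Integer.DivMod using (n%d<d; a≡a%n+[a/n]*n; _%_)
  import Data.Integer.Properties as ℤ
  open import Data.Integer.Divisibility.Signed using (_∣_; _∣?_; divides)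
  open import Data.Integer.Tactic.RingSolver using (solve-∀)
  open import Data.Nat as ℕ using (ℕ; zero; suc; NonZero; _<_; s≤s; z≤n)
  import Data.Nat.Divisibility as ℕ
  import Data.Nat.Properties as ℕ
  open import Data.Product using (∃; _,_)
  open import Relation.Binary.PropositionalEquality hiding (J)
  open import Relation.Nullary using (yes; no; contradiction; ¬_)
  open import Defs using (_≡_[mod_]; _≡_÷_[mod_]; legendre; quadraticResidue?)
  open EisensteinIntegers
  open GroupRings
  open PrimeFields
  open LucasSequences using (sign₃)

  fromMod : ∀ {l a b} → a ≡ b [mod l ] → a ≡ b ⟨mod l ⟩
  fromMod {l} {a} {b} (divides q e) = modulo q (trans (identity a b) (cong (λ z → b + z) e))
    where
    identity : ∀ a b → a ≡ b + (a - b)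
    identity = solve-∀

  toMod : ∀ {l a b} → a ≡ b ⟨mod l ⟩ → a ≡ b [mod l ]
  toMod {l} {a} {b} (modulo q e) = divides q (trans (cong (_- b) e) (identity b (q * + l)))
    where
    identity : ∀ b z → b + z - b ≡ z
    identity = solve-∀

  toDivides : ∀ {l a} → a ≡ 0ℤ ⟨mod l ⟩ → + l ∣ a
  toDivides (modulo q e) = divides q (trans e (ℤ.+-identityˡ _))

  fromDivides : ∀ {l a} → + l ∣ a → a ≡ 0ℤ ⟨mod l ⟩
  fromDivides (divides q e) = modulo q (trans e (sym (ℤ.+-identityˡ _)))

  small-distinct : ∀ a b → a < 3 → b < 3 → a ≢ b → ¬ (+ a ≡ + b ⟨mod 3 ⟩)
  small-distinct a b a<3 b<3 a≢b e = a≢b (residue-unique a<3 b<3 e)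

  legendre-zero : ∀ t → t ≡ 0ℤ ⟨mod 3 ⟩ → legendre t 3 ≡ 0ℤ
  legendre-zero t e with + 3 ∣? t
  ... | yes _  = refl
  ... | no 3∤t = contradiction (toDivides e) 3∤t

  legendre-one : ∀ t → t ≡ 1ℤ ⟨mod 3 ⟩ → legendre t 3 ≡ 1ℤ
  legendre-one t e with + 3 ∣? t
  ... | yes 3∣t = contradiction (mod-trans (mod-sym e) (fromDivides 3∣t)) (small-distinct 1 0 (s≤s (s≤s z≤n)) (s≤s z≤n) λ ())
  ... | no _ with quadraticResidue? t 3
  ...   | yes _  = refl
  ...   | no ¬qr = contradiction (Fin.suc Fin.zero , toMod (mod-sym e)) ¬qr

  legendre-two : ∀ t → t ≡ + 2 ⟨mod 3 ⟩ → legendre t 3 ≡ -1ℤ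
  legendre-two t e with + 3 ∣? t
  ... | yes 3∣t = contradiction (mod-trans (mod-sym e) (fromDivides 3∣t)) (small-distinct 2 0 (s≤s (s≤s (s≤s z≤n))) (s≤s z≤n) λ ())
  ... | no _ with quadraticResidue? t 3
  ...   | no _  = refl
  ...   | yes (i , square) = contradiction (mod-trans (fromMod square) e) (non-residue i)
    where
    non-residue : ∀ (i : Fin 3) → ¬ ((+ Fin.toℕ i) ^ 2 ≡ + 2 ⟨mod 3 ⟩)
    non-residue Fin.zero = small-distinct 0 2 (s≤s z≤n) (s≤s (s≤s (s≤s z≤n))) λ ()
    non-residue (Fin.suc Fin.zero) = small-distinct 1 2 (s≤s (s≤s z≤n)) (s≤s (s≤s (s≤s z≤n))) λ ()
    non-residue (Fin.suc (Fin.suc Fin.zero)) e = small-distinct 1 2 (s≤s (s≤s z≤n)) (s≤s (s≤s (s≤s z≤n))) (λ ())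
      (mod-trans (modulo -1ℤ refl) e)

  legendre-sign : ∀ i t → t ≡ + i ⟨mod 3 ⟩ → legendre t 3 ≡ sign₃ i
  legendre-sign 0 t e = legendre-zero t e
  legendre-sign 1 t e = legendre-one t e
  legendre-sign 2 t e = legendre-two t e
  legendre-sign (suc (suc (suc i))) t e = legendre-sign i t (mod-trans e (modulo 1ℤ (ℤ.+-comm (+ 3) (+ i))))

  legendre-sign-neg : ∀ i t → t ≡ - + i ⟨mod 3 ⟩ → legendre t 3 ≡ - sign₃ i
  legendre-sign-neg 0 t e = legendre-zero t e
  legendre-sign-neg 1 t e = legendre-two t (mod-trans e (modulo -1ℤ refl))
  legendre-sign-neg 2 t e = legendre-one t (mod-trans e (modulo -1ℤ refl))
  legendre-sign-neg (suc (suc (suc i))) t e = legendre-sign-neg i t (mod-trans e (modulo -1ℤ (identity (+ i))))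
    where
    identity : ∀ i → - (+ 3 + i) ≡ - i + -1ℤ * + 3
    identity = solve-∀

  exact-quotient : ∀ a t n .{{_ : NonZero n}} .{{_ : Data.Integer.NonZero (+ n)}} → a ≡ t * + n → a / + n ≡ t
  exact-quotient a t n a≡ = ℤ.*-cancelʳ-≡ (a / + n) t (+ n) (trans (sym (ℤ.+-identityˡ _))
    (trans (cong (λ r → + r + a / + n * + n) (sym r≡0)) (trans (sym (a≡a%n+[a/n]*n a (+ n))) a≡)))
    where
    r : ℕ
    r = a % + n
    r-mod : + r ≡ + 0 ⟨mod n ⟩
    r-mod = modulo (t - a / + n) (trans (isolate (+ r) (a / + n * + n)) (trans (cong (_- a / + n * + n) (trans (sym (a≡a%n+[a/n]*n a (+ n))) a≡))
      (collect t (a / + n) (+ n))))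
      where
      isolate : ∀ r z → r ≡ r + z - z
      isolate = solve-∀
      collect : ∀ t q n → t * n - q * n ≡ 0ℤ + (t - q) * n
      collect = solve-∀
    r≡0 : r ≡ 0
    r≡0 = residue-unique (n%d<d a (+ n)) (ℕ.>-nonZero⁻¹ n) r-mod

  fraction : ∀ {p u D a} → (∃ λ D⁻¹ → D * D⁻¹ ≡ 1ℤ ⟨mod p ⟩) → u * D ≡ a ⟨mod p ⟩ → u ≡ a ÷ D [mod p ]
  fraction {p} {u} {D} {a} (D⁻¹ , unit) e = D⁻¹ , toMod unit , toMod (mod-trans (≡⇒mod (sym (ℤ.*-identityʳ u)))
    (mod-trans (mod-*ˡ u (mod-sym unit)) (mod-trans (≡⇒mod (sym (ℤ.*-assoc u D D⁻¹))) (mod-*ʳ D⁻¹ e))))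

-- The congruence classes of m

module CaseAnalysis where

  open import Data.Integer using (ℤ; +_; _+_; _-_; _*_; -_; _/_; 0ℤ; 1ℤ; -1ℤ; ∣_∣)
  import Data.Integer.Properties as ℤ
  open import Data.Integer.Tactic.RingSolver using (solve-∀)
  open import Data.Nat as ℕ using (ℕ; s≤s; z≤n)
  import Data.Nat.Divisibility as ℕ
  open import Data.Nat.Primality using (Prime)
  open import Data.Product using (∃; _,_; _×_; proj₁; proj₂)
  open import Data.Sum using ([_,_]′)
  open import Relation.Binary.PropositionalEquality hiding (J)
  open import Relation.Nullary using (Dec; yes; no; contradiction; ¬_)
  open import Defs using (Squarefree; U; legendre)
  open EisensteinIntegers
  open GroupRings
  open PrimeFields
  open ResidueCharacters
  open JacobiSums
  open CubicSymbols
  open Factorisation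
  open AmbiguousPrimes
  open LucasSequences
  open PellReduction
  open QuadraticForm
  open LegendreModThree

  -- Multiplication by conj(ρ)^k replaces ρ^k by a power of the rational norm, which can be
  -- cancelled modulo p.
  unscale-ratio : ∀ {p} → Prime p → ∀ k ρ γ i → ¬ (norm ρ ≡ 0ℤ ⟨mod p ⟩) → conj ρ ↑ k ≡ ρ ↑ k →
    CubicRatio p k (ρ ⊗ γ) i → CubicRatio p k γ i
  unscale-ratio {p} p-prime k ρ γ i p∤ρ ρ̄ e = PrimeMod.ι-cancel-mod p-prime (PrimeModulus.^-nonzero p-prime k p∤ρ) (begin
    c ⊗ γ ↑ k                                ≡⟨ cong (_⊗ γ ↑ k) c≡ ⟩
    (conj ρ ↑ k ⊗ ρ ↑ k) ⊗ γ ↑ k             ≡⟨ ⊗-assoc (conj ρ ↑ k) (ρ ↑ k) (γ ↑ k) ⟩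
    conj ρ ↑ k ⊗ (ρ ↑ k ⊗ γ ↑ k)             ≡⟨ cong (conj ρ ↑ k ⊗_) (↑-distrib-⊗ ρ γ k) ⟨
    conj ρ ↑ k ⊗ (ρ ⊗ γ) ↑ k                 ≈⟨ ⊗-congˡ {conj ρ ↑ k} e ⟩
    conj ρ ↑ k ⊗ (ω ↑ i ⊗ conj (ρ ⊗ γ) ↑ k)  ≡⟨ cong (λ δ → conj ρ ↑ k ⊗ (ω ↑ i ⊗ δ)) (trans (cong (_↑ k) (conj-⊗ ρ γ)) (↑-distrib-⊗ (conj ρ) (conj γ) k)) ⟩
    conj ρ ↑ k ⊗ (ω ↑ i ⊗ (conj ρ ↑ k ⊗ conj γ ↑ k)) ≡⟨ cong (conj ρ ↑ k ⊗_) (trans (sym (⊗-assoc (ω ↑ i) (conj ρ ↑ k) (conj γ ↑ k)))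
        (trans (cong (_⊗ conj γ ↑ k) (⊗-comm (ω ↑ i) (conj ρ ↑ k))) (⊗-assoc (conj ρ ↑ k) (ω ↑ i) (conj γ ↑ k)))) ⟩
    conj ρ ↑ k ⊗ (conj ρ ↑ k ⊗ (ω ↑ i ⊗ conj γ ↑ k)) ≡⟨ ⊗-assoc (conj ρ ↑ k) (conj ρ ↑ k) (ω ↑ i ⊗ conj γ ↑ k) ⟨
    (conj ρ ↑ k ⊗ conj ρ ↑ k) ⊗ (ω ↑ i ⊗ conj γ ↑ k) ≡⟨ cong (λ δ → (conj ρ ↑ k ⊗ δ) ⊗ (ω ↑ i ⊗ conj γ ↑ k)) ρ̄ ⟩
    (conj ρ ↑ k ⊗ ρ ↑ k) ⊗ (ω ↑ i ⊗ conj γ ↑ k)      ≡⟨ cong (_⊗ (ω ↑ i ⊗ conj γ ↑ k)) c≡ ⟨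
    c ⊗ (ω ↑ i ⊗ conj γ ↑ k)                 ∎)
    where
    open Mod p
    open import Relation.Binary.Reasoning.Setoid ≈-setoid
    c : 𝔼
    c = ι (norm ρ Data.Integer.^ k)
    c≡ : c ≡ conj ρ ↑ k ⊗ ρ ↑ k
    c≡ = trans (sym (ι-^ (norm ρ) k)) (trans (cong (_↑ k) (trans (sym (⊗-conj ρ)) (⊗-comm ρ (conj ρ)))) (↑-distrib-⊗ (conj ρ) ρ k))

  -- W a ≡ W a ā³ ≡ a³ ā ≡ ā, and W³ = 1.
  halve : ∀ {p} {a ā W} → W ⊗ (W ⊗ W) ≡ ι 1ℤ → a ⊗ a ≈ W ⊗ (ā ⊗ ā) ⟨mod p ⟩ →
    a ⊗ (a ⊗ a) ≈ ι 1ℤ ⟨mod p ⟩ → ā ⊗ (ā ⊗ ā) ≈ ι 1ℤ ⟨mod p ⟩ → a ≈ (W ⊗ W) ⊗ ā ⟨mod p ⟩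
  halve {p} {a} {ā} {W} W³ e a³ ā³ = begin
    a                              ≡⟨ ⊗-identityˡ a ⟨
    ι 1ℤ ⊗ a                       ≡⟨ cong (_⊗ a) (trans (⊗-comm (W ⊗ W) W) W³) ⟨
    ((W ⊗ W) ⊗ W) ⊗ a              ≡⟨ ⊗-assoc (W ⊗ W) W a ⟩
    (W ⊗ W) ⊗ (W ⊗ a)              ≈⟨ ⊗-congˡ {W ⊗ W} Wa≈ā ⟩
    (W ⊗ W) ⊗ ā                    ∎
    where
    open Mod p
    open import Relation.Binary.Reasoning.Setoid ≈-setoid
    Wa≈ā : W ⊗ a ≈ ā ⟨mod p ⟩
    Wa≈ā = begin
      W ⊗ a                        ≡⟨ ⊗-identityʳ (W ⊗ a) ⟨
      (W ⊗ a) ⊗ ι 1ℤ               ≈⟨ ⊗-congˡ {W ⊗ a} ā³ ⟨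
      (W ⊗ a) ⊗ (ā ⊗ (ā ⊗ ā))      ≡⟨ cong ((W ⊗ a) ⊗_) (⊗-comm ā (ā ⊗ ā)) ⟩
      (W ⊗ a) ⊗ ((ā ⊗ ā) ⊗ ā)      ≡⟨ ⊗-interchange W a (ā ⊗ ā) ā ⟩
      (W ⊗ (ā ⊗ ā)) ⊗ (a ⊗ ā)      ≈⟨ ⊗-congʳ {a ⊗ ā} e ⟨
      (a ⊗ a) ⊗ (a ⊗ ā)            ≡⟨ ⊗-assoc (a ⊗ a) a ā ⟨
      ((a ⊗ a) ⊗ a) ⊗ ā            ≡⟨ cong (_⊗ ā) (⊗-comm (a ⊗ a) a) ⟩
      (a ⊗ (a ⊗ a)) ⊗ ā            ≈⟨ ⊗-congʳ {ā} a³ ⟩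
      ι 1ℤ ⊗ ā                     ≡⟨ ⊗-identityˡ ā ⟩
      ā                            ∎

  module Cases {p k : ℕ} (p-prime : Prime p) (p≡ : p ≡ 1 ℕ.+ k ℕ.* 3) (d x y : ℤ) (sqf : Squarefree d)
    (form : + p ≡ x * x + + 3 * d * (y * y)) (3∤x : ¬ (x ≡ 0ℤ ⟨mod 3 ⟩)) (3∤y : ¬ (y ≡ 0ℤ ⟨mod 3 ⟩))
    (y≡x : y ≡ x ⟨mod 3 ⟩) (p∤x : ¬ (x ≡ 0ℤ ⟨mod p ⟩)) (p∤y : ¬ (y ≡ 0ℤ ⟨mod p ⟩))
    (2≢0 : ¬ (+ 2 ≡ 0ℤ ⟨mod p ⟩)) (3≢0 : ¬ (+ 3 ≡ 0ℤ ⟨mod p ⟩)) where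
    open Form {p} {k} p-prime p≡ d x y sqf form 3∤x 3∤y y≡x p∤x 2≢0
    open Mod p

    p∣form : x * x + + 3 * d * (y * y) ≡ 0ℤ ⟨mod p ⟩
    p∣form = mod-trans (≡⇒mod (sym form)) (modulo 1ℤ (sym (trans (ℤ.+-identityˡ (1ℤ * + p)) (ℤ.*-identityˡ (+ p)))))

    Pell : ℤ → ℤ → Set
    Pell m n = m * m - d * (n * n) ≡ + 4

    α : ℤ → ℤ → 𝔼
    α m n = (n * x) +√-3 (m * y)

    Value-of-U : ℤ → ℤ → ℤ → Set
    Value-of-U m n s = U m 1ℤ k * (d * n * y) ≡ s * x ⟨mod p ⟩

    from-ratio : ∀ m n → Pell m n → ∀ i → CubicRatio p k (α m n) i → Value-of-U m n (- sign₃ i)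
    from-ratio m n pell i ratio = Lucas.U-value {p} {k} p-prime p≡ m n d x y pell p∣form 2≢0 3≢0 p∤y (p∤norm m n pell) i ratio

    conclude : ∀ m n s {s′} → s ≡ s′ → Value-of-U m n s → Value-of-U m n s′
    conclude m n s refl e = e

    record UnitResult (m n : ℤ) : Set where
      field
        i        : ℕ
        ratio    : CubicRatio p k (α m n) i
        exponent : + 3 * + i ≡ - (n * (m - + 2)) ⟨mod 9 ⟩

    record MultipleResult (m n : ℤ) : Set where
      field
        i        : ℕ
        n₁       : ℤ
        n≡3n₁    : n ≡ + 3 * n₁
        ratio    : CubicRatio p k (α m n) i
        exponent : + i ≡ n₁ * d ⟨mod 3 ⟩

    opaque
      unit-result : ∀ m n → Pell m n → m ≡ + 2 ⟨mod 3 ⟩ → ¬ (n ≡ 0ℤ ⟨mod 3 ⟩) → UnitResult m n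
      unit-result m n pell m≡2 3∤n = record { i = i ; ratio = ratio ; exponent = exponent }
        where open Core.UnitN m n pell m≡2 3∤n using (i; ratio; exponent)

      multiple-result : ∀ m n → Pell m n → m ≡ + 2 ⟨mod 3 ⟩ → n ≡ 0ℤ ⟨mod 3 ⟩ → MultipleResult m n
      multiple-result m n pell m≡2 n≡0 = record { i = i ; n₁ = n₁ ; n≡3n₁ = n≡3n₁ ; ratio = ratio ; exponent = exponent }
        where open Core.MultipleN m n pell m≡2 n≡0 using (i; n₁; n≡3n₁; ratio; exponent)

    -- If m ≡ 2 (mod 9) then 9 ∣ d n², so 3 ∣ n because d is squarefree.
    three∣n : ∀ m n → Pell m n → m ≡ + 2 ⟨mod 9 ⟩ → n ≡ 0ℤ ⟨mod 3 ⟩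
    three∣n m n pell m≡2@(modulo w m≡) = decide (Residue.mod? 3 n 0ℤ)
      where
      m≡2-mod-3 : m ≡ + 2 ⟨mod 3 ⟩
      m≡2-mod-3 = mod-weaken (ℕ.divides 3 refl) m≡2
      impossible : ¬ (n ≡ 0ℤ ⟨mod 3 ⟩) → ¬ (d ≡ 0ℤ ⟨mod 3 ⟩)
      impossible 3∤n (modulo d′ d≡) = [ nine , (λ z → [ 3∤n , 3∤n ]′ (ℤ/3.euclid n n z)) ]′ (ℤ/3.euclid d′ (n * n) d′nn)
        where
        nine : ¬ (d′ ≡ 0ℤ ⟨mod 3 ⟩)
        nine (modulo d″ d′≡) = squarefree-multiple sqf (+ 3) (λ ()) d″ (trans d≡ (trans (cong (λ z → 0ℤ + z * + 3) d′≡) (regroup d″)))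
          where
          regroup : ∀ d → 0ℤ + (0ℤ + d * + 3) * + 3 ≡ d * (+ 3 * + 3)
          regroup = solve-∀
        expand : ∀ d w n → + 3 * (d * (n * n)) ≡ + 3 * (w * (+ 4 + + 9 * w) * + 3) + - ((+ 2 + w * + 9) * (+ 2 + w * + 9) - (0ℤ + d * + 3) * (n * n)) + + 4
        expand = solve-∀
        cancel-four : ∀ z → z + - (+ 4) + + 4 ≡ z
        cancel-four = solve-∀
        d′nn : d′ * (n * n) ≡ 0ℤ ⟨mod 3 ⟩
        d′nn = modulo (w * (+ 4 + + 9 * w)) (trans (ℤ.*-cancelˡ-≡ (+ 3) (d′ * (n * n)) (w * (+ 4 + + 9 * w) * + 3) (trans (expand d′ w n)
          (trans (cong (λ z → + 3 * (w * (+ 4 + + 9 * w) * + 3) + - z + + 4) (trans (cong₂ (λ m d → m * m - d * (n * n)) (sym m≡) (sym d≡)) pell))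
            (cancel-four (+ 3 * (w * (+ 4 + + 9 * w) * + 3)))))) (sym (ℤ.+-identityˡ _)))
      decide : Dec (n ≡ 0ℤ ⟨mod 3 ⟩) → n ≡ 0ℤ ⟨mod 3 ⟩
      decide (yes 3∣n) = 3∣n
      decide (no 3∤n) = contradiction (Core.UnitN.3∣d m n pell m≡2-mod-3 3∤n) (impossible 3∤n)

    -- With m = 2 + 9 w and n = 3 n₁ one has w (4 + 9 w) = d n₁².
    reduced-pell : ∀ m n n₁ w → Pell m n → m ≡ + 2 + w * + 9 → n ≡ + 3 * n₁ → w ≡ d * (n₁ * n₁) ⟨mod 3 ⟩
    reduced-pell m n n₁ w pell m≡ n≡ = mod-sym (modulo (w + + 3 * (w * w)) (ℤ.*-cancelˡ-≡ (+ 9) (d * (n₁ * n₁)) (w + (w + + 3 * (w * w)) * + 3) (trans (expand d w n₁)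
      (trans (cong (λ z → + 9 * (w + (w + + 3 * (w * w)) * + 3) + - z + + 4) (trans (cong₂ (λ m n → m * m - d * (n * n)) (sym m≡) (sym n≡)) pell))
        (cancel-four (+ 9 * (w + (w + + 3 * (w * w)) * + 3)))))))
      where
      expand : ∀ d w n → + 9 * (d * (n * n)) ≡ + 9 * (w + (w + + 3 * (w * w)) * + 3) + - ((+ 2 + w * + 9) * (+ 2 + w * + 9) - d * (+ 3 * n * (+ 3 * n))) + + 4
      expand = solve-∀
      cancel-four : ∀ z → z + - (+ 4) + + 4 ≡ z
      cancel-four = solve-∀

    module Nine (m n w : ℤ) (pell : Pell m n) (m≡ : m ≡ + 2 + w * + 9) where
      m≡2 : m ≡ + 2 ⟨mod 3 ⟩
      m≡2 = modulo (w * + 3) (trans m≡ (cong (λ z → + 2 + z) (sym (ℤ.*-assoc w (+ 3) (+ 3)))))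

      open MultipleResult (multiple-result m n pell m≡2 (three∣n m n pell (modulo w m≡))) public

      w≡ : w ≡ d * (n₁ * n₁) ⟨mod 3 ⟩
      w≡ = reduced-pell m n n₁ w pell m≡ n≡3n₁

    -- Now 3 divides w ≡ d n₁², so it divides d or n₁, and in either case i ≡ n₁ d ≡ 0.
    case-27 : ∀ m n → Pell m n → m ≡ + 2 ⟨mod 27 ⟩ → Value-of-U m n 0ℤ
    case-27 m n pell (modulo q m≡) = conclude m n (- sign₃ i) (cong -_ (trans (sym (legendre-sign i 0ℤ (mod-sym i≡0))) (legendre-zero 0ℤ mod-refl)))
        (from-ratio m n pell i ratio)
      where
      w : ℤ
      w = q * + 3
      open Nine m n w pell (trans m≡ (cong (λ z → + 2 + z) (sym (ℤ.*-assoc q (+ 3) (+ 9)))))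
      i≡0 : + i ≡ 0ℤ ⟨mod 3 ⟩
      i≡0 = mod-trans exponent ([ multiple≡0 n₁ , (λ z → multiple≡0ʳ d ([ (λ z → z) , (λ z → z) ]′ (ℤ/3.euclid n₁ n₁ z))) ]′
        (ℤ/3.euclid d (n₁ * n₁) (mod-trans (mod-sym w≡) (modulo q (sym (ℤ.+-identityˡ (q * + 3)))))))

    -- Since w ≡ d n₁² is prime to 3, n₁² ≡ 1 and w ≡ d. Hence (m - 2) n / 27 = w n₁ ≡ d n₁ ≡ i.
    case-9 : ∀ m n w → Pell m n → m ≡ + 2 + w * + 9 → ¬ (w ≡ 0ℤ ⟨mod 3 ⟩) →
      Value-of-U m n (- legendre ((m - + 2) * n / + 27) 3)
    case-9 m n w pell m≡ w≢0 = conclude m n (- sign₃ i) (cong -_ (sym (trans (cong (λ t → legendre t 3) (exact-quotient ((m - + 2) * n) (w * n₁) 27 numerator))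
        (legendre-sign i (w * n₁) wn₁≡i)))) (from-ratio m n pell i ratio)
      where
      open Nine m n w pell m≡
      regroup : ∀ w n → (+ 2 + w * + 9 - + 2) * (+ 3 * n) ≡ w * n * + 27
      regroup = solve-∀
      numerator : (m - + 2) * n ≡ w * n₁ * + 27
      numerator = trans (cong₂ (λ m n → (m - + 2) * n) m≡ n≡3n₁) (regroup w n₁)
      3∤n₁ : ¬ (n₁ ≡ 0ℤ ⟨mod 3 ⟩)
      3∤n₁ z = w≢0 (mod-trans w≡ (multiple≡0 d (multiple≡0 n₁ z)))
      w≡d : w ≡ d ⟨mod 3 ⟩
      w≡d = mod-trans w≡ (mod-trans (mod-*ˡ d (square≡1 n₁ 3∤n₁)) (≡⇒mod (ℤ.*-identityʳ d)))
      wn₁≡i : w * n₁ ≡ + i ⟨mod 3 ⟩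
      wn₁≡i = mod-trans (mod-*ʳ n₁ w≡d) (mod-trans (≡⇒mod (ℤ.*-comm d n₁)) (mod-sym exponent))

    case-unit : ∀ m n w → Pell m n → m ≡ + 2 + w * + 3 → ¬ (n ≡ 0ℤ ⟨mod 3 ⟩) →
      ∃ λ i → CubicRatio p k (α m n) i × w * n ≡ - + i ⟨mod 3 ⟩
    case-unit m n w pell m≡ 3∤n = i , ratio , mod-sym (mod-trans (mod-neg (divide-3 (+ i) (- (w * n)) (mod-trans exponent (≡⇒mod (trans (cong (λ m → - (n * (m - + 2))) m≡) (regroup w n))))))
        (≡⇒mod (ℤ.neg-involutive (w * n))))
      where
      open UnitResult (unit-result m n pell (modulo w m≡) 3∤n)
      regroup : ∀ w n → - (n * (+ 2 + w * + 3 - + 2)) ≡ + 3 * - (w * n)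
      regroup = solve-∀

    -- The class of m modulo 9 excludes 3 ∣ n, so i ≡ - w n, and this sign cancels the one in the
    -- value of U.
    case-3 : ∀ m n w → Pell m n → m ≡ + 2 + w * + 3 → ¬ (m ≡ + 2 ⟨mod 9 ⟩) →
      Value-of-U m n (legendre ((m - + 2) * n / + 3) 3)
    case-3 m n w pell m≡ m≢2 = conclude m n (- sign₃ (proj₁ unit)) (sym (trans (cong (λ t → legendre t 3) (exact-quotient ((m - + 2) * n) (w * n) 3 numerator))
        (legendre-sign-neg (proj₁ unit) (w * n) (proj₂ (proj₂ unit))))) (from-ratio m n pell (proj₁ unit) (proj₁ (proj₂ unit)))
      where
      3∤n : ¬ (n ≡ 0ℤ ⟨mod 3 ⟩)
      3∤n 3∣n = m≢2 (Core.MultipleN.m≡2-mod-9 m n pell (modulo w m≡) 3∣n)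
      unit = case-unit m n w pell m≡ 3∤n
      regroup : ∀ w n → (+ 2 + w * + 3 - + 2) * n ≡ w * n * + 3
      regroup = solve-∀
      numerator : (m - + 2) * n ≡ w * n * + 3
      numerator = trans (cong (λ m → (m - + 2) * n) m≡) (regroup w n)

    -- The pair (- m , - n) has first coordinate ≡ 2 (mod 3), and the two elements differ by the factor - 1.
    case-1 : ∀ m n q → Pell m n → m ≡ 1ℤ + q * + 3 → ¬ (n ≡ 0ℤ ⟨mod 3 ⟩) →
      Value-of-U m n (legendre ((m + + 2) * n / + 3) 3)
    case-1 m n q pell m≡ 3∤n = conclude m n (- sign₃ i) (sym (trans (cong (λ t → legendre t 3) (exact-quotient ((m + + 2) * n) ((1ℤ + q) * n) 3 numerator))
        (legendre-sign-neg i ((1ℤ + q) * n) (mod-trans (≡⇒mod (flip q n)) (proj₂ (proj₂ unit))))))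
        (from-ratio m n pell i (subst (λ δ → CubicRatio p k δ i) (sym α≡) (scale-ratio k (-1ℤ +√-3 0ℤ) (α (- m) (- n)) i refl (proj₁ (proj₂ unit)))))
      where
      pell′ : Pell (- m) (- n)
      pell′ = trans (squares m d n) pell
        where
        squares : ∀ m d n → - m * - m - d * (- n * - n) ≡ m * m - d * (n * n)
        squares = solve-∀
      shift : ∀ q → - (1ℤ + q * + 3) ≡ + 2 + (- (1ℤ + q)) * + 3
      shift = solve-∀
      unit = case-unit (- m) (- n) (- (1ℤ + q)) pell′ (trans (cong -_ m≡) (shift q)) (λ z → 3∤n (mod-trans (≡⇒mod (sym (ℤ.neg-involutive n))) (mod-neg z)))
      i : ℕ
      i = proj₁ unit
      flip : ∀ q n → (1ℤ + q) * n ≡ - (1ℤ + q) * - n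
      flip = solve-∀
      regroup : ∀ q n → (1ℤ + q * + 3 + + 2) * n ≡ (1ℤ + q) * n * + 3
      regroup = solve-∀
      numerator : (m + + 2) * n ≡ (1ℤ + q) * n * + 3
      numerator = trans (cong (λ m → (m + + 2) * n) m≡) (regroup q n)
      α≡ : α m n ≡ (-1ℤ +√-3 0ℤ) ⊗ α (- m) (- n)
      α≡ = sym (trans (√-3-⊗ -1ℤ 0ℤ (- n * x) (- m * y)) (cong₂ _+√-3_ (real n x m y) (imag n x m y)))
        where
        real : ∀ n x m y → -1ℤ * (- n * x) - + 3 * (0ℤ * (- m * y)) ≡ n * x
        real = solve-∀
        imag : ∀ n x m y → -1ℤ * (- m * y) + 0ℤ * (- n * x) ≡ m * y
        imag = solve-∀

    -- The pair (2 - m² , - m n) belongs to - ε², where ε = (m + n √d) / 2.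
    square-pell : ∀ m n → Pell m n → Pell (+ 2 - m * m) (- (m * n))
    square-pell m n pell = trans (expand m d n) (trans (cong (λ z → m * m * (z - + 4) + + 4) pell) (collapse m))
      where
      expand : ∀ m d n → (+ 2 - m * m) * (+ 2 - m * m) - d * (- (m * n) * - (m * n)) ≡ m * m * (m * m - d * (n * n) - + 4) + + 4
      expand = solve-∀
      collapse : ∀ m → m * m * (+ 4 - + 4) + + 4 ≡ + 4
      collapse = solve-∀

    -- With α = T ε and T = 2 y √-3, the element for - ε² is α'' = - T ε², so √-3 α² = - √-3 T α'' =
    -- 6 y α''.
    square-relation : ∀ m n → Pell m n →
      (0ℤ +√-3 1ℤ) ⊗ (α m n ⊗ α m n) ≈ ((+ 6 * y) +√-3 0ℤ) ⊗ α (+ 2 - m * m) (- (m * n)) ⟨mod p ⟩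
    square-relation m n pell = ≈-trans (≡⇒≈ (trans (cong ((0ℤ +√-3 1ℤ) ⊗_) (√-3-⊗ (n * x) (m * y) (n * x) (m * y)))
        (√-3-⊗ 0ℤ 1ℤ (n * x * (n * x) - + 3 * (m * y * (m * y))) (n * x * (m * y) + m * y * (n * x)))))
      (≈-trans (√-3-cong (≡⇒mod (real m n x y)) imag) (≡⇒≈ (sym (√-3-⊗ (+ 6 * y) 0ℤ (- (m * n) * x) ((+ 2 - m * m) * y)))))
      where
      real : ∀ m n x y → 0ℤ * (n * x * (n * x) - + 3 * (m * y * (m * y))) - + 3 * (1ℤ * (n * x * (m * y) + m * y * (n * x)))
        ≡ + 6 * y * (- (m * n) * x) - + 3 * (0ℤ * ((+ 2 - m * m) * y))
      real = solve-∀
      expand : ∀ m n d x y → 0ℤ * (n * x * (m * y) + m * y * (n * x)) + 1ℤ * (n * x * (n * x) - + 3 * (m * y * (m * y)))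
        ≡ n * n * (x * x + + 3 * d * (y * y)) + + 3 * (y * y) * (m * m - d * (n * n) - + 2 * (m * m))
      expand = solve-∀
      collapse : ∀ m n x y → n * n * 0ℤ + + 3 * (y * y) * (+ 4 - + 2 * (m * m)) ≡ + 6 * y * ((+ 2 - m * m) * y) + 0ℤ * (- (m * n) * x)
      collapse = solve-∀
      imag : 0ℤ * (n * x * (m * y) + m * y * (n * x)) + 1ℤ * (n * x * (n * x) - + 3 * (m * y * (m * y)))
        ≡ + 6 * y * ((+ 2 - m * m) * y) + 0ℤ * (- (m * n) * x) ⟨mod p ⟩
      imag = mod-trans (≡⇒mod (expand m n d x y)) (mod-trans (mod-+ (mod-*ˡ (n * n) p∣form)
        (≡⇒mod (cong (λ z → + 3 * (y * y) * (z - + 2 * (m * m))) pell))) (≡⇒mod (collapse m n x y)))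

    cube≈1 : ∀ m n → Pell m n → α m n ↑ k ⊗ (α m n ↑ k ⊗ α m n ↑ k) ≈ ι 1ℤ ⟨mod p ⟩
    cube≈1 m n pell = ≈-trans (≡⇒≈ (cong (λ δ → α m n ↑ k ⊗ (α m n ↑ k ⊗ δ)) (sym (⊗-identityʳ (α m n ↑ k)))))
      (≈-trans (≡⇒≈ (↑-assocʳ (α m n) k 3)) (Fermat.fermat-unit-𝔼 {p} {k} p-prime p≡ (α m n) (p∤norm m n pell)))

    ratio-congruent : ∀ {δ δ′} i → δ ≈ δ′ ⟨mod p ⟩ → CubicRatio p k δ′ i → CubicRatio p k δ i
    ratio-congruent i e r = ≈-trans (↑-cong k e) (≈-trans r (⊗-congˡ {ω ↑ i} (↑-cong k (conj-cong (≈-sym e)))))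

    -- The given ratio is that of α². On cube roots of unity squaring is its own inverse, so the
    -- ratio of α has twice the exponent.
    halve-ratio : ∀ m n → Pell m n → ∀ i → CubicRatio p k (α (+ 2 - m * m) (- (m * n))) i → CubicRatio p k (α m n) (i ℕ.+ i)
    halve-ratio m n pell i r = ≈-trans (halve {a = α m n ↑ k} {conj (α m n) ↑ k} {ω ↑ i} (value-cube (value-↑ i vω) (ω↑≢0 vω (λ ()) i)) doubled (cube≈1 m n pell)
        (≈-trans (≡⇒≈ conj-cube) (conj-cong (cube≈1 m n pell))))
        (≡⇒≈ (cong (_⊗ conj (α m n) ↑ k) (sym (↑-homo-⊗ ω i i))))
      where
      a = α m n
      ā : conj a ↑ k ≡ conj (a ↑ k)
      ā = sym (conj-↑ a k)
      conj-cube : conj a ↑ k ⊗ (conj a ↑ k ⊗ conj a ↑ k) ≡ conj (a ↑ k ⊗ (a ↑ k ⊗ a ↑ k))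
      conj-cube = trans (cong (λ δ → δ ⊗ (δ ⊗ δ)) ā) (sym (trans (conj-⊗ (a ↑ k) (a ↑ k ⊗ a ↑ k)) (cong (conj (a ↑ k) ⊗_) (conj-⊗ (a ↑ k) (a ↑ k)))))
      even = even-exponent {p} {k} p-prime p≡ 2≢0
      s : 𝔼
      s = 0ℤ +√-3 1ℤ
      squared : CubicRatio p k (a ⊗ a) i
      -- The norm of √-3 computes to 3, so `3≢0` is the required invertibility.
      squared = unscale-ratio p-prime k s (a ⊗ a) i 3≢0 (even-power-invariant {k} s even (square-conj 1ℤ))
        (ratio-congruent i (square-relation m n pell)
          (scale-ratio k ((+ 6 * y) +√-3 0ℤ) (α (+ 2 - m * m) (- (m * n))) i (cong (_↑ k) (conj-√-3 (+ 6 * y) 0ℤ)) r))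
      doubled : a ↑ k ⊗ a ↑ k ≈ ω ↑ i ⊗ (conj a ↑ k ⊗ conj a ↑ k) ⟨mod p ⟩
      doubled = ≈-trans (≡⇒≈ (sym (↑-distrib-⊗ a a k))) (≈-trans squared
        (≡⇒≈ (cong (ω ↑ i ⊗_) (trans (cong (_↑ k) (conj-⊗ a a)) (↑-distrib-⊗ (conj a) (conj a) k)))))

    -- The new pair has first entry ≡ 2 (mod 3) and second entry divisible by 3, with third part n₁
    -- = - m₁ n. From d n² = m² - 4 one gets d ≡ - 1, so i ≡ m₁ n, and the doubled exponent 2 i ≡ -
    -- i supplies the sign.
    case-0 : ∀ m n m₁ → Pell m n → m ≡ m₁ * + 3 → Value-of-U m n (legendre (m * n / + 3) 3)
    case-0 m n m₁ pell m≡ = conclude m n (- sign₃ (i ℕ.+ i)) (sym (trans (cong (λ t → legendre t 3) (exact-quotient (m * n) (m₁ * n) 3 numerator))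
        (legendre-sign-neg (i ℕ.+ i) (m₁ * n) m₁n≡))) (from-ratio m n pell (i ℕ.+ i) (halve-ratio m n pell i ratio))
      where
      m″≡2 : + 2 - m * m ≡ + 2 ⟨mod 3 ⟩
      m″≡2 = modulo (- (+ 3 * (m₁ * m₁))) (trans (cong (λ m → + 2 - m * m) m≡) (square m₁))
        where
        square : ∀ m → + 2 - m * + 3 * (m * + 3) ≡ + 2 + - (+ 3 * (m * m)) * + 3
        square = solve-∀
      n″≡0 : - (m * n) ≡ 0ℤ ⟨mod 3 ⟩
      n″≡0 = modulo (- (m₁ * n)) (trans (cong (λ m → - (m * n)) m≡) (regroup m₁ n))
        where
        regroup : ∀ m n → - (m * + 3 * n) ≡ 0ℤ + - (m * n) * + 3
        regroup = solve-∀
      open MultipleResult (multiple-result (+ 2 - m * m) (- (m * n)) (square-pell m n pell) m″≡2 n″≡0)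
      numerator : m * n ≡ m₁ * n * + 3
      numerator = trans (cong (_* n) m≡) (regroup m₁ n)
        where
        regroup : ∀ m n → m * + 3 * n ≡ m * n * + 3
        regroup = solve-∀
      n₁≡ : n₁ ≡ - (m₁ * n)
      n₁≡ = ℤ.*-cancelˡ-≡ (+ 3) n₁ (- (m₁ * n)) (trans (sym n≡3n₁) (trans (cong (λ m → - (m * n)) m≡) (regroup m₁ n)))
        where
        regroup : ∀ m n → - (m * + 3 * n) ≡ + 3 * - (m * n)
        regroup = solve-∀
      dnn≡-1 : d * (n * n) ≡ -1ℤ ⟨mod 3 ⟩
      dnn≡-1 = mod-trans (≡⇒mod (trans (isolate (m * m) (d * (n * n))) (cong₂ (λ m z → m * m - z) m≡ pell))) (modulo (m₁ * m₁ * + 3 - 1ℤ) (square m₁))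
        where
        isolate : ∀ t z → z ≡ t - (t - z)
        isolate = solve-∀
        square : ∀ m → m * + 3 * (m * + 3) - + 4 ≡ -1ℤ + (m * m * + 3 - 1ℤ) * + 3
        square = solve-∀
      3∤n : ¬ (n ≡ 0ℤ ⟨mod 3 ⟩)
      3∤n z = small-distinct 0 2 (s≤s z≤n) (s≤s (s≤s (s≤s z≤n))) (λ ())
        (mod-trans (mod-sym (multiple≡0 d (multiple≡0 n z))) (mod-trans dnn≡-1 (modulo -1ℤ refl)))
      d≡-1 : d ≡ -1ℤ ⟨mod 3 ⟩
      d≡-1 = mod-trans (mod-trans (≡⇒mod (sym (ℤ.*-identityʳ d))) (mod-*ˡ d (mod-sym (square≡1 n 3∤n)))) dnn≡-1
      i≡ : + i ≡ m₁ * n ⟨mod 3 ⟩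
      i≡ = mod-trans exponent (mod-trans (mod-*ˡ n₁ d≡-1) (≡⇒mod (trans (cong (_* -1ℤ) n₁≡) (negate (m₁ * n)))))
        where
        negate : ∀ z → - z * -1ℤ ≡ z
        negate = solve-∀
      m₁n≡ : m₁ * n ≡ - + (i ℕ.+ i) ⟨mod 3 ⟩
      m₁n≡ = mod-trans (mod-sym i≡) (modulo (+ i) (trans (triple (+ i)) (cong (λ z → - z + + i * + 3) (sym (ℤ.pos-+ i i)))))
        where
        triple : ∀ i → i ≡ - (i + i) + i * + 3
        triple = solve-∀

-- Numbers smaller than p, and the condition on 3-adic orders

module SizeBounds where

  open import Data.Integer using (ℤ; +_; _+_; _*_; _^_; _<_; +<+; 0ℤ; 1ℤ; ∣_∣)
  import Data.Integer.Properties as ℤ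
  open import Data.Integer.Tactic.RingSolver using (solve-∀)
  open import Data.Nat as ℕ using (ℕ; zero; suc; NonZero; s≤s; z≤n)
  import Data.Nat.Divisibility as ℕ
  import Data.Nat.DivMod as ℕ
  import Data.Nat.Properties as ℕ
  open import Relation.Binary.PropositionalEquality hiding (J)
  open import Relation.Nullary using (contradiction; ¬_)
  open import Defs using (ord; ord-divides; ord-greatest)
  open EisensteinIntegers
  open GroupRings
  open PrimeFields
  open Factorisation using (square-abs)
  open PellReduction using (square≡1)

  ^2≡ : ∀ a → a ^ 2 ≡ a * a
  ^2≡ a = cong (a *_) (ℤ.*-identityʳ a)

  small-nonzero : ∀ {p} a → ∣ a ∣ ≢ 0 → ∣ a ∣ ℕ.< p → ¬ (a ≡ 0ℤ ⟨mod p ⟩)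
  small-nonzero a a≢0 a<p e = contradiction (≡0⇒∣ e) (ℕ.>⇒∤ {{ℕ.≢-nonZero a≢0}} a<p)

  n≤n*n : ∀ n → n ℕ.≤ n ℕ.* n
  n≤n*n zero = z≤n
  n≤n*n n@(suc _) = ℕ.m≤m*n n n

  abs≢0 : ∀ {a} → ¬ (a ≡ 0ℤ ⟨mod 3 ⟩) → ∣ a ∣ ≢ 0
  abs≢0 {a} 3∤a e = 3∤a (≡⇒mod (ℤ.∣i∣≡0⇒i≡0 {a} e))

  module Bounds {p : ℕ} (d x y : ℤ) (1<d : 1ℤ < d) (form : + p ≡ x * x + + 3 * d * (y * y))
    (3∤x : ¬ (x ≡ 0ℤ ⟨mod 3 ⟩)) (3∤y : ¬ (y ≡ 0ℤ ⟨mod 3 ⟩)) where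

    X Y D S T : ℕ
    X = ∣ x ∣
    Y = ∣ y ∣
    D = ∣ d ∣
    S = X ℕ.* X
    T = Y ℕ.* Y

    d≡D : d ≡ + D
    d≡D = positive 1<d
      where
      positive : ∀ {d} → 1ℤ < d → d ≡ + ∣ d ∣
      positive (+<+ _) = refl

    1<D : 1 ℕ.< D
    1<D = positive 1<d
      where
      positive : ∀ {d} → 1ℤ < d → 1 ℕ.< ∣ d ∣
      positive (+<+ 1<D) = 1<D

    p≡ : p ≡ S ℕ.+ 3 ℕ.* D ℕ.* T
    p≡ = ℤ.+-injective (trans form (trans (cong₂ _+_ (square-abs x) (cong₂ (λ d z → + 3 * d * z) d≡D (square-abs y)))
      (cong (λ z → + S + z) (trans (cong (_* + T) (sym (ℤ.pos-* 3 D))) (sym (ℤ.pos-* (3 ℕ.* D) T))))))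

    instance
      S-nonZero : NonZero S
      S-nonZero = ℕ.m*n≢0 X X {{ℕ.≢-nonZero (abs≢0 3∤x)}} {{ℕ.≢-nonZero (abs≢0 3∤x)}}
      T-nonZero : NonZero T
      T-nonZero = ℕ.m*n≢0 Y Y {{ℕ.≢-nonZero (abs≢0 3∤y)}} {{ℕ.≢-nonZero (abs≢0 3∤y)}}
      3D-nonZero : NonZero (3 ℕ.* D)
      3D-nonZero = ℕ.m*n≢0 3 D {{_}} {{ℕ.>-nonZero (ℕ.<-trans (s≤s z≤n) 1<D)}}
      3DT-nonZero : NonZero (3 ℕ.* D ℕ.* T)
      3DT-nonZero = ℕ.m*n≢0 (3 ℕ.* D) T

    below-right : ∀ {a} → a ℕ.≤ 3 ℕ.* D ℕ.* T → a ℕ.< p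
    below-right a≤ = ℕ.≤-<-trans a≤ (subst (3 ℕ.* D ℕ.* T ℕ.<_) (sym p≡) (ℕ.m<n+m (3 ℕ.* D ℕ.* T) (ℕ.>-nonZero⁻¹ S)))

    x<p : X ℕ.< p
    x<p = ℕ.≤-<-trans (n≤n*n X) (subst (S ℕ.<_) (sym p≡) (ℕ.m<m+n S (ℕ.>-nonZero⁻¹ (3 ℕ.* D ℕ.* T))))

    y<p : Y ℕ.< p
    y<p = below-right (ℕ.≤-trans (n≤n*n Y) (ℕ.m≤n*m T (3 ℕ.* D)))

    d<p : D ℕ.< p
    d<p = below-right (ℕ.≤-trans (ℕ.m≤n*m D 3) (ℕ.m≤m*n (3 ℕ.* D) T))

    -- From d ≥ 2 and y ≠ 0, p > 3 d y² ≥ 6. This makes 2 and 3 invertible modulo p.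
    5<p : 5 ℕ.< p
    5<p = below-right (ℕ.≤-trans (ℕ.n≤1+n 5) (ℕ.≤-trans (ℕ.*-monoʳ-≤ 3 1<D) (ℕ.m≤m*n (3 ℕ.* D) T)))

    p∤x : ¬ (x ≡ 0ℤ ⟨mod p ⟩)
    p∤x = small-nonzero x (abs≢0 3∤x) x<p

    p∤y : ¬ (y ≡ 0ℤ ⟨mod p ⟩)
    p∤y = small-nonzero y (abs≢0 3∤y) y<p

    p∤d : ¬ (d ≡ 0ℤ ⟨mod p ⟩)
    p∤d = small-nonzero d (λ e → ℕ.<⇒≢ (ℕ.<-trans (s≤s z≤n) 1<D) (sym e)) d<p

    p∤2 : ¬ (+ 2 ≡ 0ℤ ⟨mod p ⟩)
    p∤2 = small-nonzero (+ 2) (λ ()) (ℕ.≤-trans (ℕ.m≤m+n 3 3) 5<p)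

    p∤3 : ¬ (+ 3 ≡ 0ℤ ⟨mod p ⟩)
    p∤3 = small-nonzero (+ 3) (λ ()) (ℕ.≤-trans (ℕ.m≤m+n 4 2) 5<p)

    p≡1 : + p ≡ 1ℤ ⟨mod 3 ⟩
    p≡1 = mod-trans (≡⇒mod form) (mod-+ (square≡1 x 3∤x) vanishes)
      where
      regroup : ∀ d z → + 3 * d * z ≡ 0ℤ + d * z * + 3
      regroup = solve-∀
      vanishes : + 3 * d * (y * y) ≡ 0ℤ ⟨mod 3 ⟩
      vanishes = modulo (d * (y * y)) (regroup d (y * y))

    p-split : p ≡ 1 ℕ.+ (p ℕ.∸ 1) ℕ./ 3 ℕ.* 3
    p-split = trans p≡1+ (cong (λ k → 1 ℕ.+ k ℕ.* 3) (sym k≡))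
      where
      remainder : p ℕ.% 3 ≡ 1
      remainder = residue-unique (ℕ.m%n<n p 3) (s≤s (s≤s z≤n)) (mod-trans (mod-sym (modulo (+ (p ℕ./ 3)) (trans (cong +_ (ℕ.m≡m%n+[m/n]*n p 3))
        (trans (ℤ.pos-+ (p ℕ.% 3) (p ℕ./ 3 ℕ.* 3)) (cong (λ z → + (p ℕ.% 3) + z) (ℤ.pos-* (p ℕ./ 3) 3)))))) p≡1)
      p≡1+ : p ≡ 1 ℕ.+ p ℕ./ 3 ℕ.* 3
      p≡1+ = trans (ℕ.m≡m%n+[m/n]*n p 3) (cong (ℕ._+ p ℕ./ 3 ℕ.* 3) remainder)
      k≡ : (p ℕ.∸ 1) ℕ./ 3 ≡ p ℕ./ 3
      k≡ = trans (cong (λ q → (q ℕ.∸ 1) ℕ./ 3) p≡1+) (ℕ.m*n/n≡m (p ℕ./ 3) 3)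

  -- If 3 ∣ n the order of n is at least 1, and the inequality passes this on to a, which will be m
  -- - 2.
  three∣-of-ord : ∀ a n → n ≢ 0ℤ → ord 3 n ℕ.≤ ord 3 a → n ≡ 0ℤ ⟨mod 3 ⟩ → a ≡ 0ℤ ⟨mod 3 ⟩
  three∣-of-ord a n n≢0 ord≤ 3∣n = ∣⇒≡0 (ℕ.∣-trans (3∣power (ord 3 a) positive) (ord-divides 3 a))
    where
    positive : 1 ℕ.≤ ord 3 a
    positive = ℕ.≤-trans (ord-greatest 3 n (s≤s (s≤s z≤n)) n≢0 1 (≡0⇒∣ 3∣n)) ord≤
    3∣power : ∀ k → 1 ℕ.≤ k → 3 ℕ.∣ 3 ℕ.^ k
    3∣power (suc k) _ = ℕ.m∣m*n (3 ℕ.^ k)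

-- From the value of U · d n y to the five congruences

open import Data.Nat using (ℕ; _∸_) renaming (_/_ to _/ₙ_; _≥_ to _≥ₙ_)
open import Data.Nat.Primality using (Prime)
open import Data.Integer using (ℤ; +_; _+_; _-_; _*_; -_; _/_; _^_; _<_; 0ℤ; 1ℤ)
open import Data.Integer.Divisibility.Signed using (_∣_)
open import Data.Product using (_×_)
open import Data.Sum using (_⊎_)
open import Relation.Nullary using (¬_)
open import Relation.Nullary using (contradiction)
open import Relation.Binary.PropositionalEquality using (_≡_; _≢_)
open import Defs

import Data.Integer.Properties as ℤ
open import Data.Integer.Tactic.RingSolver using (solve-∀)
open import Data.Nat.Properties using (m≤m+n)
open import Data.Product using (_,_)
open import Data.Sum using ([_,_]′)
open import Relation.Binary.PropositionalEquality using (sym; trans; cong₂; refl)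
open EisensteinIntegers
open GroupRings using (residue-unique)
open PrimeFields
open LegendreModThree
open CaseAnalysis
open SizeBounds

corollary8p4 : (d m n : ℤ) → 1ℤ < d → Squarefree d →
    m ≢ 0ℤ → n ≢ 0ℤ → m ^ 2 - d * n ^ 2 ≡ + 4 →
    ord 3 (m - + 2) ≥ₙ ord 3 n →
    (p : ℕ) → Prime p → ¬ (+ p ∣ n) →
    (x y : ℤ) → + p ≡ x ^ 2 + + 3 * d * y ^ 2 →
    ¬ (+ 3 ∣ y) → x ≡ y [mod 3 ] →
    (m ≡ + 2 [mod 27 ] →
    U m 1ℤ ((p ∸ 1) /ₙ 3) ≡ 0ℤ [mod p ])
    × (m ≡ + 5 [mod 9 ] ⊎ m ≡ + 8 [mod 9 ] →
    U m 1ℤ ((p ∸ 1) /ₙ 3) ≡ legendre ((m - + 2) * n / + 3) 3 * x ÷ d * n * y [mod p ])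
    × (m ≡ + 11 [mod 27 ] ⊎ m ≡ + 20 [mod 27 ] →
    U m 1ℤ ((p ∸ 1) /ₙ 3) ≡ - legendre ((m - + 2) * n / + 27) 3 * x ÷ d * n * y [mod p ])
    × (m ≡ + 0 [mod 3 ] →
    U m 1ℤ ((p ∸ 1) /ₙ 3) ≡ legendre (m * n / + 3) 3 * x ÷ d * n * y [mod p ])
    × (m ≡ + 1 [mod 3 ] →
    U m 1ℤ ((p ∸ 1) /ₙ 3) ≡ legendre ((m + + 2) * n / + 3) 3 * x ÷ d * n * y [mod p ])
corollary8p4 d m n 1<d sqf m≢0 n≢0 pell-^2 ord≥ p p-prime p∤n x y form-^2 ¬3∣y x≡y-mod-3 =
    (λ e → toMod (vanish (case-27 m n pell (fromMod e))))
  , [ (λ e → five (fromMod e)) , (λ e → eight (fromMod e)) ]′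
  , [ (λ e → eleven (fromMod e)) , (λ e → twenty (fromMod e)) ]′
  , (λ e → zero-mod-3 (fromMod e))
  , (λ e → one-mod-3 (fromMod e))
  where
  x≡y : x ≡ y ⟨mod 3 ⟩
  x≡y = fromMod x≡y-mod-3

  3∤y : ¬ (y ≡ 0ℤ ⟨mod 3 ⟩)
  3∤y e = ¬3∣y (toDivides e)

  3∤x : ¬ (x ≡ 0ℤ ⟨mod 3 ⟩)
  3∤x e = 3∤y (mod-trans (mod-sym x≡y) e)

  pell : m * m - d * (n * n) ≡ + 4
  pell = trans (cong₂ (λ a b → a - d * b) (sym (^2≡ m)) (sym (^2≡ n))) pell-^2

  form : + p ≡ x * x + + 3 * d * (y * y)
  form = trans form-^2 (cong₂ (λ a b → a + + 3 * d * b) (^2≡ x) (^2≡ y))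

  open Bounds d x y 1<d form 3∤x 3∤y using (p∤x; p∤y; p∤d; p∤2; p∤3; p-split)
  open Cases {p} {(p ∸ 1) /ₙ 3} p-prime p-split d x y sqf form 3∤x 3∤y (mod-sym x≡y) p∤x p∤y p∤2 p∤3
  open PrimeModulus p-prime

  denominator≢0 : ¬ (d * n * y ≡ 0ℤ ⟨mod p ⟩)
  denominator≢0 = *-nonzero (*-nonzero p∤d (λ e → p∤n (toDivides e))) p∤y

  u : ℤ
  u = U m 1ℤ ((p ∸ 1) /ₙ 3)

  vanish : u * (d * n * y) ≡ 0ℤ * x ⟨mod p ⟩ → u ≡ 0ℤ ⟨mod p ⟩
  vanish e = [ (λ z → z) , (λ z → contradiction z denominator≢0) ]′ (euclid u (d * n * y) (mod-trans e (≡⇒mod (ℤ.*-zeroˡ x))))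

  divided : ∀ {a} → u * (d * n * y) ≡ a ⟨mod p ⟩ → u ≡ a ÷ d * n * y [mod p ]
  divided {a} = fraction {p} {u} {d * n * y} {a} (inverse (d * n * y) denominator≢0)

  five : m ≡ + 5 ⟨mod 9 ⟩ → u ≡ legendre ((m - + 2) * n / + 3) 3 * x ÷ d * n * y [mod p ]
  five e@(modulo q m≡) = divided (case-3 m n (1ℤ + q * + 3) pell (trans m≡ (shift q)) (λ e′ → distinct (mod-trans (mod-sym e) e′)))
    where
    shift : ∀ q → + 5 + q * + 9 ≡ + 2 + (1ℤ + q * + 3) * + 3
    shift = solve-∀
    distinct : ¬ (+ 5 ≡ + 2 ⟨mod 9 ⟩)
    distinct e with () ← residue-unique (m≤m+n 6 3) (m≤m+n 3 6) e

  eight : m ≡ + 8 ⟨mod 9 ⟩ → u ≡ legendre ((m - + 2) * n / + 3) 3 * x ÷ d * n * y [mod p ]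
  eight e@(modulo q m≡) = divided (case-3 m n (+ 2 + q * + 3) pell (trans m≡ (shift q)) (λ e′ → distinct (mod-trans (mod-sym e) e′)))
    where
    shift : ∀ q → + 8 + q * + 9 ≡ + 2 + (+ 2 + q * + 3) * + 3
    shift = solve-∀
    distinct : ¬ (+ 8 ≡ + 2 ⟨mod 9 ⟩)
    distinct e with () ← residue-unique (m≤m+n 9 0) (m≤m+n 3 6) e

  eleven : m ≡ + 11 ⟨mod 27 ⟩ → u ≡ - legendre ((m - + 2) * n / + 27) 3 * x ÷ d * n * y [mod p ]
  eleven (modulo q m≡) = divided (case-9 m n (1ℤ + q * + 3) pell (trans m≡ (shift q))
      (λ e → small-distinct 1 0 (m≤m+n 2 1) (m≤m+n 1 2) (λ ()) (mod-trans (mod-sym (modulo q refl)) e)))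
    where
    shift : ∀ q → + 11 + q * + 27 ≡ + 2 + (1ℤ + q * + 3) * + 9
    shift = solve-∀

  twenty : m ≡ + 20 ⟨mod 27 ⟩ → u ≡ - legendre ((m - + 2) * n / + 27) 3 * x ÷ d * n * y [mod p ]
  twenty (modulo q m≡) = divided (case-9 m n (+ 2 + q * + 3) pell (trans m≡ (shift q))
      (λ e → small-distinct 2 0 (m≤m+n 3 0) (m≤m+n 1 2) (λ ()) (mod-trans (mod-sym (modulo q refl)) e)))
    where
    shift : ∀ q → + 20 + q * + 27 ≡ + 2 + (+ 2 + q * + 3) * + 9
    shift = solve-∀

  zero-mod-3 : m ≡ + 0 ⟨mod 3 ⟩ → u ≡ legendre (m * n / + 3) 3 * x ÷ d * n * y [mod p ]
  zero-mod-3 (modulo q m≡) = divided (case-0 m n q pell (trans m≡ (ℤ.+-identityˡ (q * + 3))))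

  one-mod-3 : m ≡ + 1 ⟨mod 3 ⟩ → u ≡ legendre ((m + + 2) * n / + 3) 3 * x ÷ d * n * y [mod p ]
  -- The condition on the orders enters here: 3 ∣ n would give 3 ∣ m - 2, against m ≡ 1 (mod 3).
  one-mod-3 e@(modulo q m≡) = divided (case-1 m n q pell m≡ (λ 3∣n → small-distinct 1 2 (m≤m+n 2 1) (m≤m+n 3 0) (λ ())
    (mod-trans (mod-sym e) (difference-mod (three∣-of-ord (m - + 2) n n≢0 ord≥ 3∣n)))))
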